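{- Let $a$ be an integer and let $n$ be a positive odd integer. Then, for an indeterminate $q$ (equivalently, for every complex number $q\neq 0,1$), $$\det\left[\left[\left\lceil\frac{(a+1)j-ak}{n}\right\rceil\right]_q\right]_{1\leqslant j,k\leqslant n}=\left(\frac{a(a+1)}{n}\right)q^{(n-1)/2}.$$
   Context: For an integer $m$, its $q$-analogue is $[m]_q=(1-q^m)/(1-q)$. $\lceil x\rceil$ denotes the least integer not smaller than $x$. $\left(\frac{\cdot}{n}\right)$ denotes the Jacobi symbol modulo the positive odd integer $n$ (equal to $0$ when the argument is not coprime to $n$, and $\left(\frac{\cdot}{1}\right)=1$). -}

module Defs where

open import Level using (Level)
open import Algebra.Apartness.Bundles using (HeytingCommutativeRing; HeytingField)
open import Algebra.Bundles using (CommutativeRing)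
import Algebra.Properties.Semiring.Exp as Exp
import Algebra.Properties.Semiring.Mult as Mult
import Algebra.Properties.Semiring.Sum as Sum
open import Data.Fin.Base using (Fin; zero; suc; toℕ; punchIn)
open import Data.Fin.Properties using (any?)
open import Data.Integer.Base as ℤ using (ℤ; +_; -[1+_]; 0ℤ; 1ℤ; -1ℤ)
open import Data.Integer.Divisibility.Signed using (_∣_; _∣?_)
open import Data.List.Base using (foldr; map)
open import Data.Nat.Base using (ℕ; zero; suc; NonZero)
open import Data.Nat.Primality.Factorisation using (factors; factorise)
open import Data.Product.Base using (∃-syntax; proj₁)
open import Relation.Nullary.Decidable using (Dec; yes; no)

private
  variable
    c ℓ₁ ℓ₂ : Level

-- It suffices to look for a square root among the residues 0, …, p - 1.
QuadraticResidue : ℤ → ℕ → Set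
QuadraticResidue a p = ∃[ x ] (+ p) ∣ (+ toℕ {p} x ℤ.* + toℕ x ℤ.- a)

quadraticResidue? : ∀ a p → Dec (QuadraticResidue a p)
quadraticResidue? a p = any? λ x → (+ p) ∣? (+ toℕ {p} x ℤ.* + toℕ x ℤ.- a)

-- Meaningful when p is an odd prime.
legendre : ℤ → ℕ → ℤ
legendre a p with (+ p) ∣? a
... | yes _ = 0ℤ
... | no  _ with quadraticResidue? a p
...   | yes _ = 1ℤ
...   | no  _ = -1ℤ

-- Product of Legendre symbols over the prime factors of n, with multiplicity;
-- meaningful when n is odd.
jacobi : ℤ → (n : ℕ) .{{_ : NonZero n}} → ℤ
jacobi a n = foldr ℤ._*_ 1ℤ (map (legendre a) (factors (factorise n)))

module _ (R : CommutativeRing c ℓ₁) where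
  open CommutativeRing R hiding (zero)
  open Exp semiring using (_^_)
  open Mult semiring using (_×_)
  open Sum semiring using (sum)

  fromℤ : ℤ → Carrier
  fromℤ (+ n)    = n × 1#
  fromℤ -[1+ n ] = - (suc n × 1#)

  -- Laplace expansion along the first row.
  det : ∀ {n} → (Fin n → Fin n → Carrier) → Carrier
  det {zero}  M = 1#
  det {suc n} M = sum λ k →
    (- 1#) ^ toℕ k * M zero k * det (λ i j → M (suc i) (punchIn k j))

module _ (F : HeytingField c ℓ₁ ℓ₂) where
  open HeytingField F hiding (zero)

  fieldRing : CommutativeRing c ℓ₁
  fieldRing = HeytingCommutativeRing.commutativeRing heytingCommutativeRing

  open CommutativeRing fieldRing using (semiring)
  open Exp semiring using (_^_)

  -- The inverse of the difference x - y; for y = 0# it is the inverse of x.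
  recipDiff : ∀ x y → x # y → Carrier
  recipDiff x y x#y = proj₁ (#⇒invertible x#y)

  zpow : (q : Carrier) → q # 0# → ℤ → Carrier
  zpow q q#0 (+ m)    = q ^ m
  zpow q q#0 -[1+ m ] = recipDiff q 0# q#0 ^ suc m

  -- (1 - q ^ m) / (1 - q)
  qAnalogue : (q : Carrier) → q # 0# → q # 1# → ℤ → Carrier
  qAnalogue q q#0 q#1 m = (1# - zpow q q#0 m) * recipDiff 1# q (#-sym q#1)

{-# OPTIONS --safe #-}

-- Put b = a + 1 and divide with remainder: b j = n u_j + r_j and a k = n v_k + s_k.
-- Then ⌈(b j - a k) / n⌉ = u_j - v_k + [r_j > s_k].
--
-- If a prime p ≥ 3 divides n and a b, three columns have the same comparison pattern
-- [r_j > s_k], hence lie in a common plane, and both sides vanish.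
--
-- Otherwise r and s are permutations; arranging the columns such that s_k = r_k costs
-- the sign of x ↦ a⁻¹ b x on ℤ/n, which is the Jacobi symbol of a b by Zolotarev's
-- lemma.  For a prime p that lemma holds because x ↦ α x is the composite of the
-- involutions x ↦ 1/x and x ↦ α/x, whose fixed points are the square roots of 1 and α.
-- Scaling columns and taking differences of cyclically consecutive columns (in the
-- order of r_k), which multiplies the determinant by 1 - q, leaves a diagonal matrix
-- plus a matrix of rank one.  The sum in the resulting determinant collapses to 1/q.
--
-- All manipulations are on columns only, so that the Laplace expansion along the first
-- row needs no theory of transposes or of row operations.
module Submission where

-- In q^⌈(b j - a k) / n⌉ = q^(u_j) q^(-v_k) q^[r_j > s_k] only the last factor couples rows and
-- columns. As a function of s it changes only on reaching s = r, so the difference of columns with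
-- neighbouring s sees it on the diagonal alone; the factor q that closes the cycle makes s = 0 no
-- exception. The rank one part is what remains of the constant 1 in 1 - q^m.
--
-- The power of q has two sources. The column scaling and the diagonal together contribute the
-- exponent (n + 1)/2, obtained by summing the divisions with remainder, where matched residues
-- cancel. The rank one factor lowers it by one.
--
-- The relation b - a = 1 determines that sum. It is also behind the collapse of the rank one sum:
-- stepping back by one from a multiple b k + b gives b k + a.
--
-- Oddness of n governs every sign: translations of ℤ/n are even, a sign raised to an odd number of
-- fibres is unchanged, and (-1)^n = -1 cancels the sign of the rank one factor 1 - 1/q = -(1 -
-- q)/q.

open import Defs
open import Algebra.Apartness.Bundles using (HeytingField)
open import Algebra.Bundles using (CommutativeRing)

-- Normalisation of polynomial identities over a commutative ring

module RingSolver {c ℓ} (R : CommutativeRing c ℓ) where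
  open import Algebra.Bundles using (RawRing)
  import Algebra.Properties.AbelianGroup as AbelianGroupProperties
  import Algebra.Properties.Ring as RingProperties
  import Algebra.Properties.Semiring.Mult.TCOptimised as Mult
  open import Algebra.Solver.Ring.AlmostCommutativeRing using (fromCommutativeRing; _-Raw-AlmostCommutative⟶_)
  import Algebra.Solver.Ring as RingSolver
  import Algebra.Properties.CommutativeSemigroup as CSG
  open import Data.Maybe.Base using (Maybe; just; nothing)
  open import Data.Nat.Base as ℕ using (ℕ)
  import Data.Nat.Properties as ℕ
  open import Data.Product.Base using (_,_) renaming (_×_ to _⊗_)
  open import Level using (0ℓ)
  open import Relation.Binary.PropositionalEquality.Core as ≡ using (_≡_)
  open import Relation.Nullary.Decidable using (yes; no)

  open CommutativeRing R
  open Mult semiring using (_×_; ×-homo-+; ×1-homo-*)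
  open RingProperties ring using (-‿distribʳ-*; x[y-z]≈xy-xz; [y-z]x≈yx-zx)
  open AbelianGroupProperties +-abelianGroup using (⁻¹-∙-comm; ⁻¹-anti-homo‿-; ε⁻¹≈ε; x∙y⁻¹≈ε⇒x≈y)
  open CSG +-commutativeSemigroup using (interchange)
  open import Relation.Binary.Reasoning.Setoid setoid

  -- A pair (m , n) stands for the integer coefficient m - n.
  differenceRing : RawRing 0ℓ 0ℓ
  differenceRing = record
    { Carrier = ℕ ⊗ ℕ
    ; _≈_     = _≡_
    ; _+_     = λ (a , b) (c , d) → a ℕ.+ c , b ℕ.+ d
    ; _*_     = λ (a , b) (c , d) → a ℕ.* c ℕ.+ b ℕ.* d , a ℕ.* d ℕ.+ b ℕ.* c
    ; -_      = λ (a , b) → b , a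
    ; 0#      = 0 , 0
    ; 1#      = 1 , 0
    }

  value : ℕ ⊗ ℕ → Carrier
  value (a , b) = a × 1# - b × 1#

  interchange-minus : ∀ w x y z → (w + x) - (y + z) ≈ (w - y) + (x - z)
  interchange-minus w x y z = trans (+-congˡ (sym (⁻¹-∙-comm y z))) (interchange w x (- y) (- z))

  value-+ : ∀ x y → value (RawRing._+_ differenceRing x y) ≈ value x + value y
  value-+ (a , b) (c , d) =
    trans (+-cong (×-homo-+ 1# a c) (-‿cong (×-homo-+ 1# b d))) (interchange-minus _ _ _ _)

  value-* : ∀ x y → value (RawRing._*_ differenceRing x y) ≈ value x * value y
  value-* (a , b) (c , d) = begin
    (a ℕ.* c ℕ.+ b ℕ.* d) × 1# - (a ℕ.* d ℕ.+ b ℕ.* c) × 1#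
      ≈⟨ +-cong (homo a c b d) (-‿cong (homo a d b c)) ⟩
    (A * C + B * D) - (A * D + B * C) ≈⟨ interchange-minus _ _ _ _ ⟩
    (A * C - A * D) + (B * D - B * C) ≈⟨ +-cong (x[y-z]≈xy-xz A C D) (x[y-z]≈xy-xz B D C) ⟨
    A * (C - D) + B * (D - C)
      ≈⟨ +-congˡ (*-congˡ (⁻¹-anti-homo‿- C D)) ⟨
    A * (C - D) + B * - (C - D)
      ≈⟨ +-congˡ (-‿distribʳ-* B (C - D)) ⟨
    A * (C - D) - B * (C - D)         ≈⟨ [y-z]x≈yx-zx (C - D) A B ⟨
    (A - B) * (C - D)                 ∎
    where
    A = a × 1#
    B = b × 1#
    C = c × 1#
    D = d × 1#
    homo : ∀ k l m n → (k ℕ.* l ℕ.+ m ℕ.* n) × 1# ≈ (k × 1#) * (l × 1#) + (m × 1#) * (n × 1#)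
    homo k l m n = trans (×-homo-+ 1# (k ℕ.* l) (m ℕ.* n)) (+-cong (×1-homo-* k l) (×1-homo-* m n))

  -- Agrees with value, but 1 and 0 are interpreted as 1# and 0# definitionally.
  ⟦_⟧ : ℕ ⊗ ℕ → Carrier
  ⟦ a , ℕ.zero  ⟧ = a × 1#
  ⟦ a , ℕ.suc b ⟧ = value (a , ℕ.suc b)

  ⟦⟧≈value : ∀ x → ⟦ x ⟧ ≈ value x
  ⟦⟧≈value (a , ℕ.zero)  = sym (trans (+-congˡ ε⁻¹≈ε) (+-identityʳ _))
  ⟦⟧≈value (a , ℕ.suc b) = refl

  morphism : differenceRing -Raw-AlmostCommutative⟶ fromCommutativeRing R
  morphism = record
    { ⟦_⟧    = ⟦_⟧
    ; +-homo = λ x y → trans (⟦⟧≈value (RawRing._+_ differenceRing x y))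
                 (trans (value-+ x y) (sym (+-cong (⟦⟧≈value x) (⟦⟧≈value y))))
    ; *-homo = λ x y → trans (⟦⟧≈value (RawRing._*_ differenceRing x y))
                 (trans (value-* x y) (sym (*-cong (⟦⟧≈value x) (⟦⟧≈value y))))
    ; -‿homo = λ x@(a , b) → trans (⟦⟧≈value (b , a))
                 (trans (sym (⁻¹-anti-homo‿- (a × 1#) (b × 1#))) (-‿cong (sym (⟦⟧≈value x))))
    ; 0-homo = refl
    ; 1-homo = refl
    }

  -- Pairs are not kept reduced, so one integer has many pairs; the test therefore compares cross
  -- sums.
  _coeff≟_ : ∀ x y → Maybe (⟦ x ⟧ ≈ ⟦ y ⟧)
  x@(a , b) coeff≟ y@(c , d) with a ℕ.+ d ℕ.≟ b ℕ.+ c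
  ... | no  _       = nothing
  ... | yes a+d≡b+c = just (trans (⟦⟧≈value x) (trans (x∙y⁻¹≈ε⇒x≈y _ _ (begin
    value x - value y              ≈⟨ +-congˡ (⁻¹-anti-homo‿- (c × 1#) (d × 1#)) ⟩
    value x + value (d , c)        ≈⟨ value-+ (a , b) (d , c) ⟨
    value (a ℕ.+ d , b ℕ.+ c)      ≡⟨ ≡.cong (λ x → value (x , b ℕ.+ c)) a+d≡b+c ⟩
    value (b ℕ.+ c , b ℕ.+ c)      ≈⟨ -‿inverseʳ _ ⟩
    0#                             ∎)) (sym (⟦⟧≈value y))))

  open RingSolver differenceRing (fromCommutativeRing R) morphism _coeff≟_ public
    using (Polynomial; con; solve; _:=_; _:+_; _:*_; _:-_; :-_)

  𝟘 𝟙 : ∀ {n} → Polynomial n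
  𝟘 = con (0 , 0)
  𝟙 = con (1 , 0)

-- Determinants as alternating multilinear functions of the columns

module Determinant {c ℓ} (R : CommutativeRing c ℓ) where
  import Algebra.Properties.Semiring.Exp as Exp
  import Algebra.Properties.Semiring.Sum as Sum
  import Algebra.Properties.CommutativeMonoid.Sum as ProductSum
  import Algebra.Properties.Ring as RingProperties
  open import Data.Fin.Base using (Fin; zero; suc; toℕ; punchIn; punchOut; inject₁; fromℕ)
  open import Data.Fin.Properties using (_≟_; punchInᵢ≢i; punchIn-punchOut; punchIn-injective; suc-injective)
  open import Data.Nat.Base as ℕ using (ℕ)
  import Data.Nat.Properties as ℕ
  open import Data.Vec.Functional using (_∷_)
  open import Relation.Binary.Definitions using (tri<; tri≈; tri>)
  open import Data.Fin.Properties using (toℕ-injective)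
  open import Data.Product.Base using (_,_; ∃-syntax; _×_)
  open import Data.Sum.Base using (_⊎_; inj₁; inj₂)
  open import Data.Empty using (⊥-elim)
  open import Function.Base using (_∘_)
  open import Level using (_⊔_)
  open import Relation.Binary.PropositionalEquality.Core as ≡ using (_≡_; _≢_)
  open import Relation.Nullary.Decidable using (yes; no)

  open CommutativeRing R hiding (zero)
  open Exp semiring using (_^_)
  open ProductSum *-commutativeMonoid using () renaming (sum to prod)
  open Sum semiring using (sum; sum-cong-≋; ∑-distrib-+; *-distribˡ-sum)
  open RingSolver R using (solve; _:=_; _:+_; _:*_; _:-_; :-_; 𝟘; 𝟙)
  open RingProperties ring using (-1*x≈-x)
  open import Relation.Binary.Reasoning.Setoid setoid

  Columns : ℕ → ℕ → Set c
  Columns m n = Fin n → Fin m → Carrier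

  infix 4 _≐_
  _≐_ : ∀ {m} (u v : Fin m → Carrier) → Set ℓ
  u ≐ v = ∀ x → u x ≈ v x

  -- The number n of columns is independent of their length m, because fixing one argument lowers n
  -- alone. A single law for c * v i + w i covers both additivity and homogeneity.
  record IsMultilinear {m n} (Φ : Columns m n → Carrier) : Set (c ⊔ ℓ) where
    field
      cong   : ∀ {u v} → (∀ i → u i ≐ v i) → Φ u ≈ Φ v
      linear : ∀ i c {u v w} →
               (∀ j → j ≢ i → u j ≐ v j) → (∀ j → j ≢ i → u j ≐ w j) →
               (∀ x → u i x ≈ c * v i x + w i x) →
               Φ u ≈ c * Φ v + Φ w

  record IsAlternating {m n} (Φ : Columns m n → Carrier) : Set (c ⊔ ℓ) where
    field
      isMultilinear : IsMultilinear Φ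
      alternating   : ∀ {i j} → i ≢ j → ∀ {v} → v i ≐ v j → Φ v ≈ 0#
    open IsMultilinear isMultilinear public

  colDet : ∀ {n} → Columns n n → Carrier
  colDet v = det R λ j k → v k j

  minor : ∀ {m n} → Fin (ℕ.suc n) → Columns (ℕ.suc m) (ℕ.suc n) → Columns m n
  minor k v j x = v (punchIn k j) (suc x)

  colDet-cong : ∀ {n} {u v : Columns n n} → (∀ i → u i ≐ v i) → colDet u ≈ colDet v
  colDet-cong {ℕ.zero}  u≐v = refl
  colDet-cong {ℕ.suc n} {u} {v} u≐v = sum-cong-≋ {ℕ.suc n} λ k →
    *-cong (*-congˡ {x = (- 1#) ^ toℕ k} (u≐v k zero)) (colDet-cong λ j x → u≐v (punchIn k j) (suc x))

  -- In the Laplace expansion the term of column i is linear through its entry, its minor being free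
  -- of that column. Every other term is linear through its minor, where column i sits at position
  -- `punchOut k≢i`.
  colDet-linear : ∀ {n} i c {u v w : Columns n n} →
    (∀ j → j ≢ i → u j ≐ v j) → (∀ j → j ≢ i → u j ≐ w j) →
    (∀ x → u i x ≈ c * v i x + w i x) → colDet u ≈ c * colDet v + colDet w
  colDet-linear {ℕ.suc n} i c {u} {v} {w} u≐v u≐w uᵢ = begin
    sum (λ k → s k * u k zero * colDet (minor k u))  ≈⟨ sum-cong-≋ term ⟩
    sum (λ k → c * V k + W k)                        ≈⟨ ∑-distrib-+ (λ k → c * V k) W ⟩
    sum (λ k → c * V k) + sum W                      ≈⟨ +-congʳ (*-distribˡ-sum c V) ⟨
    c * sum V + sum W                                ∎
    where
    s : Fin (ℕ.suc n) → Carrier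
    s k = (- 1#) ^ toℕ k
    V W : Fin (ℕ.suc n) → Carrier
    V k = s k * v k zero * colDet (minor k v)
    W k = s k * w k zero * colDet (minor k w)
    term : ∀ k → s k * u k zero * colDet (minor k u) ≈ c * V k + W k
    term k with k ≟ i
    ... | yes ≡.refl = begin
      s k * u k zero * colDet (minor k u)
        ≈⟨ *-congʳ (*-congˡ (uᵢ zero)) ⟩
      s k * (c * v k zero + w k zero) * colDet (minor k u)
        ≈⟨ solve 5 (λ s c v w d → s :* (c :* v :+ w) :* d := c :* (s :* v :* d) :+ s :* w :* d) refl
             (s k) c (v k zero) (w k zero) _ ⟩
      c * (s k * v k zero * colDet (minor k u)) + s k * w k zero * colDet (minor k u)
        ≈⟨ +-cong (*-congˡ (*-congˡ (colDet-cong λ j x → u≐v _ (punchInᵢ≢i k j) (suc x))))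
                  (*-congˡ (colDet-cong λ j x → u≐w _ (punchInᵢ≢i k j) (suc x))) ⟩
      c * V k + W k ∎
    ... | no k≢i = begin
      s k * u k zero * colDet (minor k u)
        ≈⟨ *-congˡ (colDet-linear (punchOut k≢i) c {minor k u} {minor k v} {minor k w}
             (λ j j≢ x → u≐v _ (≢i j j≢) (suc x)) (λ j j≢ x → u≐w _ (≢i j j≢) (suc x))
             (λ x → ≡.subst (λ l → u l (suc x) ≈ c * v l (suc x) + w l (suc x))
                      (≡.sym (punchIn-punchOut k≢i)) (uᵢ (suc x)))) ⟩
      s k * u k zero * (c * colDet (minor k v) + colDet (minor k w))
        ≈⟨ solve 5 (λ s c u v w → s :* u :* (c :* v :+ w) := c :* (s :* u :* v) :+ s :* u :* w) refl
             (s k) c (u k zero) _ _ ⟩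
      c * (s k * u k zero * colDet (minor k v)) + s k * u k zero * colDet (minor k w)
        ≈⟨ +-cong (*-congˡ (*-congʳ (*-congˡ (u≐v k k≢i zero)))) (*-congʳ (*-congˡ (u≐w k k≢i zero))) ⟩
      c * V k + W k ∎
      where
      ≢i : ∀ j → j ≢ punchOut k≢i → punchIn k j ≢ i
      ≢i j j≢ eq = j≢ (punchIn-injective k _ _ (≡.trans eq (≡.sym (punchIn-punchOut k≢i))))

  colDet-isMultilinear : ∀ {n} → IsMultilinear (colDet {n})
  colDet-isMultilinear = record { cong = colDet-cong ; linear = colDet-linear }

  -- From equal adjacent columns to arbitrary equal columns

  data Adjacent : ∀ {n} → Fin n → Fin n → Set where
    here  : ∀ {n} → Adjacent {ℕ.suc (ℕ.suc n)} zero (suc zero)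
    there : ∀ {n} {i j : Fin n} → Adjacent i j → Adjacent (suc i) (suc j)

  adjacent⇒toℕ : ∀ {n} {i j : Fin n} → Adjacent i j → toℕ j ≡ ℕ.suc (toℕ i)
  adjacent⇒toℕ here      = ≡.refl
  adjacent⇒toℕ (there a) = ≡.cong ℕ.suc (adjacent⇒toℕ a)

  adjacent⇒≢ : ∀ {n} {i j : Fin n} → Adjacent i j → i ≢ j
  adjacent⇒≢ (there a) eq = adjacent⇒≢ a (suc-injective eq)

  punchIn-adjacent : ∀ {n} (k : Fin (ℕ.suc n)) {i j} → Adjacent i j → k ≢ i → k ≢ j →
    ∃[ i′ ] ∃[ j′ ] (Adjacent i′ j′ × punchIn k i′ ≡ i × punchIn k j′ ≡ j)
  punchIn-adjacent zero          here      k≢i _   = ⊥-elim (k≢i ≡.refl)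
  punchIn-adjacent zero          (there a) _   _   = _ , _ , a , ≡.refl , ≡.refl
  punchIn-adjacent (suc zero)    here      _   k≢j = ⊥-elim (k≢j ≡.refl)
  punchIn-adjacent {ℕ.suc (ℕ.suc _)} (suc (suc k)) here _ _ = _ , _ , here , ≡.refl , ≡.refl
  punchIn-adjacent {ℕ.suc _} (suc k) (there a) k≢i k≢j
    with i′ , j′ , a′ , eqᵢ , eqⱼ ← punchIn-adjacent k a (k≢i ∘ ≡.cong suc) (k≢j ∘ ≡.cong suc)
    = suc i′ , suc j′ , there a′ , ≡.cong suc eqᵢ , ≡.cong suc eqⱼ

  -- This makes the two minors belonging to equal adjacent columns coincide: the column sequences
  -- differ only where one holds j and the other i.
  punchIn-adjacent-either : ∀ {n} {i j : Fin (ℕ.suc n)} → Adjacent i j → ∀ k →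
    punchIn i k ≡ punchIn j k ⊎ (punchIn i k ≡ j × punchIn j k ≡ i)
  punchIn-adjacent-either here      zero    = inj₂ (≡.refl , ≡.refl)
  punchIn-adjacent-either here      (suc k) = inj₁ ≡.refl
  punchIn-adjacent-either (there a) zero    = inj₁ ≡.refl
  punchIn-adjacent-either {ℕ.suc n} (there a) (suc k) with punchIn-adjacent-either a k
  ... | inj₁ eq        = inj₁ (≡.cong suc eq)
  ... | inj₂ (eq , eq′) = inj₂ (≡.cong suc eq , ≡.cong suc eq′)

  sum-zero : ∀ {n} (f : Fin n → Carrier) → (∀ k → f k ≈ 0#) → sum f ≈ 0#
  sum-zero {ℕ.zero}  f f≈0 = refl
  sum-zero {ℕ.suc n} f f≈0 = trans (+-cong (f≈0 zero) (sum-zero (f ∘ suc) (f≈0 ∘ suc))) (+-identityˡ 0#)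

  sum-single : ∀ {n} (f : Fin n → Carrier) i → (∀ k → k ≢ i → f k ≈ 0#) → sum f ≈ f i
  sum-single f zero f≈0 = trans (+-congˡ (sum-zero (f ∘ suc) λ k → f≈0 (suc k) λ ())) (+-identityʳ _)
  sum-single f (suc i) f≈0 = trans
    (+-cong (f≈0 zero λ ()) (sum-single (f ∘ suc) i λ k k≢i → f≈0 (suc k) (k≢i ∘ suc-injective)))
    (+-identityˡ _)

  sum-adjacent : ∀ {n} (f : Fin n → Carrier) {i j} → Adjacent i j →
    (∀ k → k ≢ i → k ≢ j → f k ≈ 0#) → sum f ≈ f i + f j
  sum-adjacent f here f≈0 = +-congˡ (sum-single (f ∘ suc) zero λ k k≢ → f≈0 (suc k) (λ ()) (k≢ ∘ suc-injective))
  sum-adjacent f (there a) f≈0 = trans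
    (+-cong (f≈0 zero (λ ()) λ ()) (sum-adjacent (f ∘ suc) a λ k k≢i k≢j →
      f≈0 (suc k) (k≢i ∘ suc-injective) (k≢j ∘ suc-injective)))
    (+-identityˡ _)

  -- A minor that keeps both columns vanishes by induction. The two remaining terms share entry and
  -- minor, and their signs are opposite because the positions differ by one.
  colDet-adjacent : ∀ {n} {i j : Fin n} → Adjacent i j → ∀ {v : Columns n n} → v i ≐ v j → colDet v ≈ 0#
  colDet-adjacent {ℕ.suc n} {i} {j} adj {v} vᵢ≐vⱼ = begin
    sum T                                    ≈⟨ sum-adjacent T adj other ⟩
    T i + T j                                ≈⟨ +-congˡ Tⱼ ⟩
    T i + (- 1#) * T i                       ≈⟨ solve 1 (λ t → t :+ (:- 𝟙) :* t := 𝟘) refl (T i) ⟩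
    0#                                       ∎
    where
    T : Fin (ℕ.suc n) → Carrier
    T k = (- 1#) ^ toℕ k * v k zero * colDet (minor k v)
    other : ∀ k → k ≢ i → k ≢ j → T k ≈ 0#
    other k k≢i k≢j with i′ , j′ , a′ , ≡.refl , ≡.refl ← punchIn-adjacent k adj k≢i k≢j =
      trans (*-congˡ (colDet-adjacent a′ λ x → vᵢ≐vⱼ (suc x))) (zeroʳ _)
    minors : ∀ k → minor j v k ≐ minor i v k
    minors k x with punchIn-adjacent-either adj k
    ... | inj₁ eq = reflexive (≡.cong (λ l → v l (suc x)) (≡.sym eq))
    ... | inj₂ (eqⱼ , eqᵢ) = begin
      v (punchIn j k) (suc x)  ≡⟨ ≡.cong (λ l → v l (suc x)) eqᵢ ⟩
      v i (suc x)              ≈⟨ vᵢ≐vⱼ (suc x) ⟩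
      v j (suc x)              ≡⟨ ≡.cong (λ l → v l (suc x)) eqⱼ ⟨
      v (punchIn i k) (suc x)  ∎
    Tⱼ : T j ≈ (- 1#) * T i
    Tⱼ = begin
      (- 1#) ^ toℕ j * v j zero * colDet (minor j v)
        ≈⟨ *-cong (*-cong (reflexive (≡.cong ((- 1#) ^_) (adjacent⇒toℕ adj))) (sym (vᵢ≐vⱼ zero))) (colDet-cong minors) ⟩
      (- 1#) * (- 1#) ^ toℕ i * v i zero * colDet (minor i v)
        ≈⟨ trans (*-congʳ (*-assoc _ _ _)) (*-assoc _ _ _) ⟩
      (- 1#) * T i ∎

  infixl 6 _[_≔_]
  _[_≔_] : ∀ {m n} → Columns m n → Fin n → (Fin m → Carrier) → Columns m n
  (v [ i ≔ y ]) k with k ≟ i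
  ... | yes _ = y
  ... | no  _ = v k

  ≔-updates : ∀ {m n} (v : Columns m n) i y → (v [ i ≔ y ]) i ≡ y
  ≔-updates v i y with i ≟ i
  ... | yes _   = ≡.refl
  ... | no  i≢i = ⊥-elim (i≢i ≡.refl)

  ≔-minimal : ∀ {m n} (v : Columns m n) i y {k} → k ≢ i → (v [ i ≔ y ]) k ≡ v k
  ≔-minimal v i y {k} k≢i with k ≟ i
  ... | yes k≡i = ⊥-elim (k≢i k≡i)
  ... | no  _   = ≡.refl

  ≡⇒≐ : ∀ {m} {u v : Fin m → Carrier} → u ≡ v → u ≐ v
  ≡⇒≐ ≡.refl x = refl

  module MultilinearProperties {m n} {Φ : Columns m n → Carrier} (isMultilinear : IsMultilinear Φ) where
    open IsMultilinear isMultilinear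

    -- A zero column equals -1 times itself plus itself, and linearity with `v` in all three places
    -- gives Φ v = -Φ v + Φ v.
    zero-column : ∀ i {v} → (∀ x → v i x ≈ 0#) → Φ v ≈ 0#
    zero-column i {v} vᵢ≈0 = trans
      (linear i (- 1#) {v} {v} {v} (λ _ _ _ → refl) (λ _ _ _ → refl) λ x →
        trans (vᵢ≈0 x) (sym (-1*x+x≈0 (v i x))))
      (-1*x+x≈0 (Φ v))
      where
      -1*x+x≈0 : ∀ x → - 1# * x + x ≈ 0#
      -1*x+x≈0 = solve 1 (λ x → (:- 𝟙) :* x :+ x := 𝟘) refl

    -- Alternation is assumed for the pair i, j alone: the exchange rule is applied to adjacent
    -- columns while alternation for distant ones is still being proved.
    module _ {i j} (i≢j : i ≢ j) (alternating : ∀ {v} → v i ≐ v j → Φ v ≈ 0#) where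

      module _ (v : Columns m n) where
        private
          P : (x y : Fin m → Carrier) → Columns m n
          P x y = v [ i ≔ x ] [ j ≔ y ]

          Pᵢ : ∀ x y → P x y i ≡ x
          Pᵢ x y = ≡.trans (≔-minimal (v [ i ≔ x ]) j y i≢j) (≔-updates v i x)

          Pⱼ : ∀ x y → P x y j ≡ y
          Pⱼ x y = ≔-updates (v [ i ≔ x ]) j y

          P-apart-i : ∀ x x′ y k → k ≢ i → P x y k ≡ P x′ y k
          P-apart-i x x′ y k k≢i with k ≟ j
          ... | yes ≡.refl = ≡.refl
          ... | no  k≢j    = ≡.trans (≔-minimal v i x k≢i) (≡.sym (≔-minimal v i x′ k≢i))

          P-apart-j : ∀ x y y′ k → k ≢ j → P x y k ≡ P x y′ k
          P-apart-j x y y′ k k≢j = ≡.trans (≔-minimal (v [ i ≔ x ]) j y k≢j) (≡.sym (≔-minimal (v [ i ≔ x ]) j y′ k≢j))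

        linearˡ : ∀ c x x′ y → Φ (P (λ t → c * x t + x′ t) y) ≈ c * Φ (P x y) + Φ (P x′ y)
        linearˡ c x x′ y = linear i c
          (λ k k≢i → ≡⇒≐ (P-apart-i _ x y k k≢i)) (λ k k≢i → ≡⇒≐ (P-apart-i _ x′ y k k≢i))
          λ t → trans (≡⇒≐ (Pᵢ _ y) t) (sym (+-cong (*-congˡ (≡⇒≐ (Pᵢ x y) t)) (≡⇒≐ (Pᵢ x′ y) t)))

        linearʳ : ∀ c x y y′ → Φ (P x (λ t → c * y t + y′ t)) ≈ c * Φ (P x y) + Φ (P x y′)
        linearʳ c x y y′ = linear j c
          (λ k k≢j → ≡⇒≐ (P-apart-j x _ y k k≢j)) (λ k k≢j → ≡⇒≐ (P-apart-j x _ y′ k k≢j))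
          λ t → trans (≡⇒≐ (Pⱼ x _) t) (sym (+-cong (*-congˡ (≡⇒≐ (Pⱼ x y) t)) (≡⇒≐ (Pⱼ x y′) t)))

        diagonal : ∀ x → Φ (P x x) ≈ 0#
        diagonal x = alternating (≡⇒≐ (≡.trans (Pᵢ x x) (≡.sym (Pⱼ x x))))

        -- Polarisation: Φ vanishes when both places hold `z` = x + y, and the expansion leaves only
        -- the two mixed terms. The factors `1#` and the zeros fit the terms to the shape of
        -- `linear`.
        exchange-updates : ∀ x y → Φ (P x y) ≈ - Φ (P y x)
        exchange-updates x y = begin
          Φ (P x y)
            ≈⟨ solve 2 (λ a b → a := (𝟙 :* (𝟙 :* 𝟘 :+ a) :+ (𝟙 :* b :+ 𝟘)) :- b)
                 refl (Φ (P x y)) (Φ (P y x)) ⟩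
          (1# * (1# * 0# + Φ (P x y)) + (1# * Φ (P y x) + 0#)) - Φ (P y x)
            ≈⟨ +-congʳ (+-cong (*-congˡ (+-congʳ (*-congˡ (sym (diagonal x))))) (+-congˡ (sym (diagonal y)))) ⟩
          (1# * (1# * Φ (P x x) + Φ (P x y)) + (1# * Φ (P y x) + Φ (P y y))) - Φ (P y x)
            ≈⟨ +-congʳ (+-cong (*-congˡ (linearʳ 1# x x y)) (linearʳ 1# y x y)) ⟨
          (1# * Φ (P x z) + Φ (P y z)) - Φ (P y x)
            ≈⟨ +-congʳ (linearˡ 1# x y z) ⟨
          Φ (P z z) - Φ (P y x)
            ≈⟨ trans (+-congʳ (diagonal z)) (+-identityˡ _) ⟩
          - Φ (P y x) ∎
          where
          z : Fin m → Carrier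
          z t = 1# * x t + y t

        update-with : ∀ {w x y} → w i ≐ x → w j ≐ y → (∀ k → k ≢ i → k ≢ j → w k ≐ v k) → Φ w ≈ Φ (P x y)
        update-with {w} {x} {y} wᵢ wⱼ wₖ = cong eq
          where
          eq : ∀ k → w k ≐ P x y k
          eq k t with k ≟ i
          ... | yes ≡.refl = trans (wᵢ t) (≡⇒≐ (≡.sym (Pᵢ x y)) t)
          ... | no  k≢i with k ≟ j
          ...   | yes ≡.refl = wⱼ t
          ...   | no  k≢j    = trans (wₖ k k≢i k≢j t) (≡⇒≐ (≡.sym (≔-minimal v i x k≢i)) t)

      exchange : ∀ {v w} → w i ≐ v j → w j ≐ v i → (∀ k → k ≢ i → k ≢ j → w k ≐ v k) → Φ w ≈ - Φ v
      exchange {v} {w} wᵢ wⱼ wₖ = begin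
        Φ w                               ≈⟨ update-with v wᵢ wⱼ wₖ ⟩
        Φ (v [ i ≔ v j ] [ j ≔ v i ])     ≈⟨ exchange-updates v (v j) (v i) ⟩
        - Φ (v [ i ≔ v i ] [ j ≔ v j ])
          ≈⟨ -‿cong (update-with v (λ _ → refl) (λ _ → refl) (λ _ _ _ _ → refl)) ⟨
        - Φ v                             ∎

      -- Expanding both columns leaves the 2 × 2 determinant of their coordinates with respect to p
      -- and q.
      two-columns-in-a-plane : ∀ {v p q} a b → (∀ x → v i x ≈ a * q x + p x) → (∀ x → v j x ≈ b * q x + p x) →
        Φ v ≈ (b - a) * Φ (v [ i ≔ p ] [ j ≔ q ])
      two-columns-in-a-plane {v} {p} {q} a b vᵢ vⱼ = begin
        Φ v ≈⟨ update-with v vᵢ vⱼ (λ _ _ _ _ → refl) ⟩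
        Φ (v [ i ≔ A ] [ j ≔ B ]) ≈⟨ linearˡ v a q p B ⟩
        a * Φ (v [ i ≔ q ] [ j ≔ B ]) + Φ (v [ i ≔ p ] [ j ≔ B ])
          ≈⟨ +-cong (*-congˡ (linearʳ v b q q p)) (linearʳ v b p q p) ⟩
        a * (b * Φ (v [ i ≔ q ] [ j ≔ q ]) + Φ (v [ i ≔ q ] [ j ≔ p ]))
          + (b * Φ (v [ i ≔ p ] [ j ≔ q ]) + Φ (v [ i ≔ p ] [ j ≔ p ]))
          ≈⟨ +-cong (*-congˡ (+-cong (*-congˡ (diagonal v q)) (exchange-updates v q p))) (+-congˡ (diagonal v p)) ⟩
        a * (b * 0# + - Φ (v [ i ≔ p ] [ j ≔ q ])) + (b * Φ (v [ i ≔ p ] [ j ≔ q ]) + 0#)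
          ≈⟨ solve 3 (λ a b f → a :* (b :* 𝟘 :+ :- f) :+ (b :* f :+ 𝟘) := (b :- a) :* f) refl a b _ ⟩
        (b - a) * Φ (v [ i ≔ p ] [ j ≔ q ]) ∎
        where
        A B : Fin m → Carrier
        A x = a * q x + p x
        B x = b * q x + p x

  open MultilinearProperties

  adjacent-predecessor : ∀ {n} (j : Fin n) {d} → toℕ j ≡ ℕ.suc d → ∃[ i ] (Adjacent i j × toℕ i ≡ d)
  adjacent-predecessor (suc zero)          {ℕ.zero}  eq = zero , here , ≡.refl
  adjacent-predecessor (suc (suc j)) {ℕ.suc d} eq
    with i , adj , eq′ ← adjacent-predecessor (suc j) (ℕ.suc-injective eq) = suc i , there adj , ≡.cong ℕ.suc eq′

  -- Induction on the distance: exchanging column j with its left neighbour only changes the sign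
  -- and brings the equal columns one step closer, until they are adjacent.
  colDet-alternating-< : ∀ {n} {i : Fin n} d {j} → toℕ j ≡ ℕ.suc (d ℕ.+ toℕ i) →
    ∀ {v : Columns n n} → v i ≐ v j → colDet v ≈ 0#
  colDet-alternating-< {i = i} d {j} eq {v} vᵢ≐vⱼ
    with j′ , adj , eq′ ← adjacent-predecessor j eq
    with d
  ... | ℕ.zero with ≡.refl ← toℕ-injective eq′ = colDet-adjacent adj {v} vᵢ≐vⱼ
  ... | ℕ.suc d = begin
    colDet v    ≈⟨ exchange colDet-isMultilinear (adjacent⇒≢ adj) (λ {v} → colDet-adjacent adj {v})
                     {w} {v} (≡⇒≐ (≡.sym wⱼ)) (≡⇒≐ (≡.sym wⱼ′))
                     (λ k k≢j′ k≢j → ≡⇒≐ (≡.sym (w-other k k≢j′ k≢j))) ⟩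
    - colDet w  ≈⟨ -‿cong (colDet-alternating-< {i = i} d {j′} eq′ {w} λ x → begin
                     w i x   ≡⟨ ≡.cong (λ y → y x) (w-other i i≢j′ i≢j) ⟩
                     v i x   ≈⟨ vᵢ≐vⱼ x ⟩
                     v j x   ≡⟨ ≡.cong (λ y → y x) wⱼ′ ⟨
                     w j′ x  ∎) ⟩
    - 0#        ≈⟨ solve 0 (:- 𝟘 := 𝟘) refl ⟩
    0#          ∎
    where
    w : Columns _ _
    w = v [ j′ ≔ v j ] [ j ≔ v j′ ]
    wⱼ : w j ≡ v j′
    wⱼ = ≔-updates (v [ j′ ≔ v j ]) j (v j′)
    wⱼ′ : w j′ ≡ v j
    wⱼ′ = ≡.trans (≔-minimal (v [ j′ ≔ v j ]) j (v j′) (adjacent⇒≢ adj)) (≔-updates v j′ (v j))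
    w-other : ∀ k → k ≢ j′ → k ≢ j → w k ≡ v k
    w-other k k≢j′ k≢j = ≡.trans (≔-minimal (v [ j′ ≔ v j ]) j (v j′) k≢j) (≔-minimal v j′ (v j) k≢j′)
    i≢j′ : i ≢ j′
    i≢j′ ≡.refl = ℕ.m≢1+n+m _ eq′
    i≢j : i ≢ j
    i≢j ≡.refl = ℕ.m≢1+n+m _ eq

  colDet-isAlternating : ∀ {n} → IsAlternating (colDet {n})
  colDet-isAlternating = record
    { isMultilinear = colDet-isMultilinear
    ; alternating   = alternating
    }
    where
    gap : ∀ {m n} → m ℕ.< n → n ≡ ℕ.suc ((n ℕ.∸ ℕ.suc m) ℕ.+ m)
    gap {m} {n} m<n = ≡.sym (≡.trans (≡.sym (ℕ.+-suc (n ℕ.∸ ℕ.suc m) m)) (ℕ.m∸n+n≡m m<n))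
    alternating : ∀ {n} {i j : Fin n} → i ≢ j → ∀ {v} → v i ≐ v j → colDet v ≈ 0#
    alternating {i = i} {j} i≢j {v} vᵢ≐vⱼ with ℕ.<-cmp (toℕ i) (toℕ j)
    ... | tri< i<j _ _ = colDet-alternating-< _ (gap i<j) {v} vᵢ≐vⱼ
    ... | tri≈ _ i≡j _ = ⊥-elim (i≢j (toℕ-injective i≡j))
    ... | tri> _ _ j<i = colDet-alternating-< _ (gap j<i) {v} λ x → sym (vᵢ≐vⱼ x)

  module AlternatingProperties {m n} {Φ : Columns m n → Carrier} (isAlternating : IsAlternating Φ) where
    open IsAlternating isAlternating

    -- Two of the columns can be replaced by p and q up to a scalar. The third is a combination of
    -- these, and each summand repeats one of them.
    three-columns-in-a-plane : ∀ {i j k} → i ≢ j → i ≢ k → j ≢ k → ∀ {v p q} a b c →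
      (∀ x → v i x ≈ a * q x + p x) → (∀ x → v j x ≈ b * q x + p x) → (∀ x → v k x ≈ c * q x + p x) →
      Φ v ≈ 0#
    three-columns-in-a-plane {i} {j} {k} i≢j i≢k j≢k {v} {p} {q} a b c vᵢ vⱼ vₖ = begin
      Φ v
        ≈⟨ two-columns-in-a-plane isMultilinear i≢j (λ {v} → alternating i≢j {v}) a b vᵢ vⱼ ⟩
      (b - a) * Φ w             ≈⟨ *-congˡ (linear k c {w} {w [ k ≔ q ]} {w [ k ≔ p ]}
                                     (λ l l≢k → ≡⇒≐ (≡.sym (≔-minimal w k q l≢k)))
                                     (λ l l≢k → ≡⇒≐ (≡.sym (≔-minimal w k p l≢k)))
                                     λ x → begin
          w k x ≡⟨ ≡.cong (λ y → y x) wₖ ⟩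
          v k x ≈⟨ vₖ x ⟩
          c * q x + p x ≡⟨ ≡.cong₂ (λ y z → c * y x + z x) (≔-updates w k q) (≔-updates w k p) ⟨
          c * (w [ k ≔ q ]) k x + (w [ k ≔ p ]) k x ∎) ⟩
      (b - a) * (c * Φ (w [ k ≔ q ]) + Φ (w [ k ≔ p ]))
        ≈⟨ *-congˡ (+-cong
             (*-congˡ (alternating j≢k (≡⇒≐ (≡.trans (≔-minimal w k q j≢k) (≡.trans wⱼ (≡.sym (≔-updates w k q)))))))
             (alternating i≢k (≡⇒≐ (≡.trans (≔-minimal w k p i≢k) (≡.trans wᵢ (≡.sym (≔-updates w k p))))))) ⟩
      (b - a) * (c * 0# + 0#)   ≈⟨ solve 2 (λ c d → d :* (c :* 𝟘 :+ 𝟘) := 𝟘) refl c (b - a) ⟩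
      0#                        ∎
      where
      w : Columns m n
      w = v [ i ≔ p ] [ j ≔ q ]
      wⱼ : w j ≡ q
      wⱼ = ≔-updates (v [ i ≔ p ]) j q
      wᵢ : w i ≡ p
      wᵢ = ≡.trans (≔-minimal (v [ i ≔ p ]) j q i≢j) (≔-updates v i p)
      wₖ : w k ≡ v k
      wₖ = ≡.trans (≔-minimal (v [ i ≔ p ]) j q (j≢k ∘ ≡.sym)) (≔-minimal v i p (i≢k ∘ ≡.sym))

    reindex : (f g : Fin n → Fin n) → (∀ i → f (g i) ≡ i) → (∀ i → g (f i) ≡ i) → IsAlternating λ v → Φ (v ∘ f)
    reindex f g fg≡id gf≡id = record
      { isMultilinear = record
        { cong   = λ u≐v → cong λ i → u≐v (f i)
        ; linear = λ i c {u} {v} {w} u≐v u≐w uᵢ → linear (g i) c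
            (λ j j≢ → u≐v (f j) (λ eq → j≢ (≡.trans (≡.sym (gf≡id j)) (≡.cong g eq))))
            (λ j j≢ → u≐w (f j) (λ eq → j≢ (≡.trans (≡.sym (gf≡id j)) (≡.cong g eq))))
            λ x → ≡.subst (λ l → u l x ≈ c * v l x + w l x) (≡.sym (fg≡id i)) (uᵢ x)
        }
      ; alternating = λ {i} {j} i≢j {v} vᵢ≐vⱼ → alternating
          (λ eq → i≢j (≡.trans (≡.sym (fg≡id i)) (≡.trans (≡.cong f eq) (fg≡id j))))
          λ x → ≡.subst₂ (λ k l → v k x ≈ v l x) (≡.sym (fg≡id i)) (≡.sym (fg≡id j)) (vᵢ≐vⱼ x)
      }

  -- The typical Φ here has z among its fixed arguments; multiples of z may then be added to any
  -- column.
  Kills : ∀ {m n} → (Columns m n → Carrier) → (Fin m → Carrier) → Set (c ⊔ ℓ)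
  Kills Φ z = ∀ i {v} → v i ≐ z → Φ v ≈ 0#

  cons-cong : ∀ {m n} {y z : Fin m → Carrier} {u v : Columns m n} →
    y ≐ z → (∀ i → u i ≐ v i) → ∀ i → (y ∷ u) i ≐ (z ∷ v) i
  cons-cong y≐z u≐v zero    = y≐z
  cons-cong y≐z u≐v (suc i) = u≐v i

  module _ {m n} {Φ : Columns m (ℕ.suc n) → Carrier} where

    module _ (isMultilinear : IsMultilinear Φ) where
      open IsMultilinear isMultilinear

      head-linear : ∀ c y z v → Φ ((λ x → c * y x + z x) ∷ v) ≈ c * Φ (y ∷ v) + Φ (z ∷ v)
      head-linear c y z v = linear zero c (λ { zero z≢z _ → ⊥-elim (z≢z ≡.refl) ; (suc j) _ _ → refl })
        (λ { zero z≢z _ → ⊥-elim (z≢z ≡.refl) ; (suc j) _ _ → refl }) λ x → refl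

      fix-head : ∀ y → IsMultilinear λ v → Φ (y ∷ v)
      fix-head y = record
        { cong   = λ u≐v → cong (cons-cong (λ _ → refl) u≐v)
        ; linear = λ i c u≐v u≐w uᵢ → linear (suc i) c
            (λ { zero _ _ → refl ; (suc j) j≢ → u≐v j (j≢ ∘ ≡.cong suc) })
            (λ { zero _ _ → refl ; (suc j) j≢ → u≐w j (j≢ ∘ ≡.cong suc) }) uᵢ
        }

      cons-η : ∀ v → Φ (v zero ∷ v ∘ suc) ≈ Φ v
      cons-η v = cong λ { zero _ → refl ; (suc i) _ → refl }

    module _ (isAlternating : IsAlternating Φ) where
      open IsAlternating isAlternating

      fix-head-alternating : ∀ y → IsAlternating λ v → Φ (y ∷ v)
      fix-head-alternating y = record
        { isMultilinear = fix-head isMultilinear y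
        ; alternating   = λ i≢j vᵢ≐vⱼ → alternating (i≢j ∘ suc-injective) vᵢ≐vⱼ
        }

      fix-head-kills : ∀ y → Kills (λ v → Φ (y ∷ v)) y
      fix-head-kills y i vᵢ≐y = alternating {suc i} {zero} (λ ()) vᵢ≐y

  scale-columns : ∀ {m n} {Φ : Columns m n → Carrier} → IsMultilinear Φ → ∀ (β : Fin n → Carrier) v →
    Φ (λ i x → β i * v i x) ≈ prod β * Φ v
  scale-columns {n = ℕ.zero}  ml β v = trans (IsMultilinear.cong ml λ ()) (sym (*-identityˡ _))
  scale-columns {n = ℕ.suc n} {Φ} ml β v = begin
    Φ (λ i x → β i * v i x)
      ≈⟨ cong (cons-cong′ λ x → sym (+-identityʳ _)) ⟩
    Φ ((λ x → β zero * v zero x + 0#) ∷ βv)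
      ≈⟨ head-linear ml (β zero) (v zero) (λ _ → 0#) βv ⟩
    β zero * Φ (v zero ∷ βv) + Φ ((λ _ → 0#) ∷ βv)
      ≈⟨ +-congˡ (zero-column ml zero λ _ → refl) ⟩
    β zero * Φ (v zero ∷ βv) + 0#                                  ≈⟨ +-identityʳ _ ⟩
    β zero * Φ (v zero ∷ βv)
      ≈⟨ *-congˡ (scale-columns (fix-head ml (v zero)) (β ∘ suc) (v ∘ suc)) ⟩
    β zero * (prod (β ∘ suc) * Φ (v zero ∷ v ∘ suc))               ≈⟨ *-assoc _ _ _ ⟨
    prod β * Φ (v zero ∷ v ∘ suc)                                  ≈⟨ *-congˡ (cons-η ml v) ⟩
    prod β * Φ v                                                   ∎
    where
    open IsMultilinear ml
    βv : Columns _ n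
    βv i x = β (suc i) * v (suc i) x
    cons-cong′ : ∀ {y} → (∀ x → β zero * v zero x ≈ y x) → ∀ i → (λ x → β i * v i x) ≐ (y ∷ βv) i
    cons-cong′ eq zero    = eq
    cons-cong′ eq (suc i) = λ _ → refl

  add-killed : ∀ {m n} {Φ : Columns m n → Carrier} → IsMultilinear Φ → ∀ {z} → Kills Φ z →
    ∀ (γ : Fin n → Carrier) v → Φ (λ i x → γ i * z x + v i x) ≈ Φ v
  add-killed {n = ℕ.zero}  ml kills γ v = IsMultilinear.cong ml λ ()
  add-killed {n = ℕ.suc n} {Φ} ml {z} kills γ v = begin
    Φ (λ i x → γ i * z x + v i x)                          ≈⟨ cons-η ml _ ⟨
    Φ ((λ x → γ zero * z x + v zero x) ∷ w)                ≈⟨ head-linear ml (γ zero) z (v zero) w ⟩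
    γ zero * Φ (z ∷ w) + Φ (v zero ∷ w)
      ≈⟨ +-congʳ (trans (*-congˡ (kills zero λ _ → refl)) (zeroʳ _)) ⟩
    0# + Φ (v zero ∷ w)                                    ≈⟨ +-identityˡ _ ⟩
    Φ (v zero ∷ w)
      ≈⟨ add-killed (fix-head ml (v zero)) (λ i eq → kills (suc i) eq) (γ ∘ suc) (v ∘ suc) ⟩
    Φ (v zero ∷ v ∘ suc)                                   ≈⟨ cons-η ml v ⟩
    Φ v                                                    ∎
    where
    w : Columns _ n
    w i x = γ (suc i) * z x + v (suc i) x

  -- The sequence v₀ - z, v₁ - v₀, v₂ - v₁, …
  diffs : ∀ {m n} → (Fin m → Carrier) → Columns m n → Columns m n
  diffs z v zero    x = - 1# * z x + v zero x
  diffs z v (suc i) x = diffs (v zero) (v ∘ suc) i x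

  diffs-suc : ∀ {m n} z (v : Columns m (ℕ.suc n)) i x → diffs z v (suc i) x ≈ v (suc i) x - v (inject₁ i) x
  diffs-suc z v zero    x = trans (+-comm _ _) (+-congˡ (-1*x≈-x _))
  diffs-suc z v (suc i) x = diffs-suc (v zero) (v ∘ suc) i x

  -- The first difference v₀ - z may be replaced by v₀, as z is killed. Once v₀ stands in the first
  -- place it is killed in turn, which serves the next difference.
  Φ-diffs : ∀ {m n} {Φ : Columns m n → Carrier} → IsAlternating Φ → ∀ {z} → Kills Φ z → ∀ v → Φ (diffs z v) ≈ Φ v
  Φ-diffs {n = ℕ.zero}  alt kills v = IsAlternating.cong alt λ ()
  Φ-diffs {n = ℕ.suc n} {Φ} alt {z} kills v = begin
    Φ (diffs z v)                                          ≈⟨ cons-η isMultilinear _ ⟨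
    Φ ((λ x → - 1# * z x + v zero x) ∷ w)
      ≈⟨ head-linear isMultilinear (- 1#) z (v zero) w ⟩
    - 1# * Φ (z ∷ w) + Φ (v zero ∷ w)
      ≈⟨ +-congʳ (trans (*-congˡ (kills zero λ _ → refl)) (zeroʳ _)) ⟩
    0# + Φ (v zero ∷ w)                                    ≈⟨ +-identityˡ _ ⟩
    Φ (v zero ∷ w)
      ≈⟨ Φ-diffs (fix-head-alternating alt (v zero)) (fix-head-kills alt (v zero)) (v ∘ suc) ⟩
    Φ (v zero ∷ v ∘ suc)                                   ≈⟨ cons-η isMultilinear v ⟩
    Φ v                                                    ∎
    where
    open IsAlternating alt
    w : Columns _ n
    w = diffs (v zero) (v ∘ suc)

  -- Telescoping. It is applied to D y = Φ (y ∷ w) with the differences w as the other columns, so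
  -- that D vanishes on them by alternation.
  killed-diffs : ∀ {m n} {D : (Fin m → Carrier) → Carrier} →
    (∀ c y z → D (λ x → c * y x + z x) ≈ c * D y + D z) →
    ∀ {z} {v : Columns m n} → (∀ i → D (diffs z v i) ≈ 0#) → ∀ i → D (v i) ≈ D z
  killed-diffs {D = D} lin {z} {v} killed zero = begin
    D (v zero)
      ≈⟨ solve 2 (λ a b → a := ((:- 𝟙) :* b :+ a) :+ b) refl _ (D z) ⟩
    (- 1# * D z + D (v zero)) + D z         ≈⟨ +-congʳ (lin (- 1#) z (v zero)) ⟨
    D (diffs z v zero) + D z                ≈⟨ +-congʳ (killed zero) ⟩
    0# + D z                                ≈⟨ +-identityˡ _ ⟩
    D z                                     ∎
  killed-diffs lin {z} {v} killed (suc i) =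
    trans (killed-diffs lin (killed ∘ suc) i) (killed-diffs lin {z} {v} killed zero)

  -- Modulo the plain differences all v i are equal, so in the first column v₀ - q v_last the last
  -- column may be replaced by v₀. This gives the factor 1 - q, after which the plain differences
  -- are summed back.
  cyclic-diffs : ∀ {m n} {Φ : Columns m (ℕ.suc n) → Carrier} → IsAlternating Φ → ∀ q {u} v →
    (∀ x → u zero x ≈ v zero x - q * v (fromℕ n) x) →
    (∀ i x → u (suc i) x ≈ v (suc i) x - v (inject₁ i) x) →
    Φ u ≈ (1# - q) * Φ v
  cyclic-diffs {n = n} {Φ} alt q {u} v u₀ u₊ = begin
    Φ u                                                 ≈⟨ cong u≐ ⟩
    Φ ((λ x → - q * last x + v zero x) ∷ w)
      ≈⟨ head-linear isMultilinear (- q) last (v zero) w ⟩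
    - q * Φ (last ∷ w) + Φ (v zero ∷ w)                 ≈⟨ +-congʳ (*-congˡ (last≈ (fromℕ n))) ⟩
    - q * Φ (v zero ∷ w) + Φ (v zero ∷ w)
      ≈⟨ solve 2 (λ q f → (:- q) :* f :+ f := (𝟙 :- q) :* f) refl q _ ⟩
    (1# - q) * Φ (v zero ∷ w)
      ≈⟨ *-congˡ (Φ-diffs (fix-head-alternating alt (v zero)) (fix-head-kills alt (v zero)) (v ∘ suc)) ⟩
    (1# - q) * Φ (v zero ∷ v ∘ suc)                     ≈⟨ *-congˡ (cons-η isMultilinear v) ⟩
    (1# - q) * Φ v                                      ∎
    where
    open IsAlternating alt
    last : Fin _ → Carrier
    last = v (fromℕ n)
    w : Columns _ n
    w = diffs (v zero) (v ∘ suc)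
    u≐ : ∀ i → u i ≐ ((λ x → - q * last x + v zero x) ∷ w) i
    u≐ zero    x = trans (u₀ x) (solve 3 (λ a q b → a :- q :* b := (:- q) :* b :+ a) refl _ q _)
    u≐ (suc i) x = trans (u₊ i x) (sym (diffs-suc (v zero) v i x))
    lin : ∀ c y z → Φ ((λ x → c * y x + z x) ∷ w) ≈ c * Φ (y ∷ w) + Φ (z ∷ w)
    lin c y z = head-linear isMultilinear c y z w
    last≈ : ∀ i → Φ (v i ∷ w) ≈ Φ (v zero ∷ w)
    last≈ zero    = refl
    last≈ (suc i) = killed-diffs {D = λ y → Φ (y ∷ w)} lin {v zero} {v ∘ suc}
      (λ j → alternating {zero} {suc j} (λ ()) λ _ → refl) i

  -- Diagonal matrices and their rank one updates

  δ : ∀ {n} → Fin n → Fin n → Carrier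
  δ zero    zero    = 1#
  δ zero    (suc j) = 0#
  δ (suc i) zero    = 0#
  δ (suc i) (suc j) = δ i j

  δ-≢ : ∀ {n} {i j : Fin n} → i ≢ j → δ i j ≈ 0#
  δ-≢ {i = zero}  {zero}  i≢j = ⊥-elim (i≢j ≡.refl)
  δ-≢ {i = zero}  {suc j} i≢j = refl
  δ-≢ {i = suc i} {zero}  i≢j = refl
  δ-≢ {i = suc i} {suc j} i≢j = δ-≢ (i≢j ∘ ≡.cong suc)

  δ-refl : ∀ {n} (i : Fin n) → δ i i ≈ 1#
  δ-refl zero    = refl
  δ-refl (suc i) = δ-refl i

  colDet-first-row : ∀ {n} (v : Columns (ℕ.suc n) (ℕ.suc n)) → (∀ k → v (suc k) zero ≈ 0#) →
    colDet v ≈ v zero zero * colDet (minor zero v)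
  colDet-first-row v v≈0 = begin
    colDet v ≈⟨ sum-single (λ k → (- 1#) ^ toℕ k * v k zero * colDet (minor k v)) zero other ⟩
    1# * v zero zero * colDet (minor zero v) ≈⟨ *-congʳ (*-identityˡ _) ⟩
    v zero zero * colDet (minor zero v) ∎
    where
    other : ∀ k → k ≢ zero → (- 1#) ^ toℕ k * v k zero * colDet (minor k v) ≈ 0#
    other zero    k≢0 = ⊥-elim (k≢0 ≡.refl)
    other (suc k) _   = trans (*-congʳ (trans (*-congˡ (v≈0 k)) (zeroʳ _))) (zeroˡ _)

  colDet-first-column : ∀ {n} (v : Columns (ℕ.suc n) (ℕ.suc n)) → (∀ x → v zero (suc x) ≈ 0#) →
    colDet v ≈ v zero zero * colDet (minor zero v)
  colDet-first-column {n} v v≈0 = begin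
    colDet v ≈⟨ sum-single (λ k → (- 1#) ^ toℕ k * v k zero * colDet (minor k v)) zero (other n v v≈0) ⟩
    1# * v zero zero * colDet (minor zero v) ≈⟨ *-congʳ (*-identityˡ _) ⟩
    v zero zero * colDet (minor zero v) ∎
    where
    other : ∀ n (v : Columns (ℕ.suc n) (ℕ.suc n)) → (∀ x → v zero (suc x) ≈ 0#) →
      ∀ k → k ≢ zero → (- 1#) ^ toℕ k * v k zero * colDet (minor k v) ≈ 0#
    other n         v v≈0 zero    k≢0 = ⊥-elim (k≢0 ≡.refl)
    other (ℕ.suc n) v v≈0 (suc k) _   =
      trans (*-congˡ (zero-column colDet-isMultilinear zero {minor (suc k) v} v≈0)) (zeroʳ _)

  colDet-diagonal : ∀ {n} (d : Fin n → Carrier) → colDet (λ k j → δ j k * d k) ≈ prod d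
  colDet-diagonal {ℕ.zero}  d = refl
  colDet-diagonal {ℕ.suc n} d = trans (colDet-first-row (λ k j → δ j k * d k) (λ k → zeroˡ _))
    (*-cong (*-identityˡ _) (colDet-diagonal (d ∘ suc)))

  -- The matrix determinant lemma for the all-ones vector. The first column splits into γ₀ times
  -- ones and d₀ times a unit vector. With ones in front, the multiples of ones in the other columns
  -- are killed and a triangular matrix remains; with the unit vector in front, the induction
  -- applies.
  colDet-diagonal+rank1 : ∀ {n} (γ d d⁻¹ : Fin n → Carrier) → (∀ k → d k * d⁻¹ k ≈ 1#) →
    colDet (λ k j → γ k * 1# + δ j k * d k) ≈ prod d * (1# + sum (λ k → γ k * d⁻¹ k))
  colDet-diagonal+rank1 {ℕ.zero}  γ d d⁻¹ inverse = solve 0 (𝟙 := 𝟙 :* (𝟙 :+ 𝟘)) refl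
  colDet-diagonal+rank1 {ℕ.suc n} γ d d⁻¹ inverse = begin
    colDet (λ k j → γ k * 1# + δ j k * d k)
      ≈⟨ cons-η colDet-isMultilinear (λ k j → γ k * 1# + δ j k * d k) ⟨
    colDet ((λ x → γ zero * 1# + δ x zero * d zero) ∷ G)
      ≈⟨ head-linear colDet-isMultilinear (γ zero) (λ _ → 1#) (λ x → δ x zero * d zero) G ⟩
    γ zero * colDet ((λ _ → 1#) ∷ G) + colDet ((λ x → δ x zero * d zero) ∷ G)
      ≈⟨ +-cong (*-congˡ ones) corner ⟩
    γ zero * Πd + d zero * (Πd * (1# + S))
      -- The first summand lacks the factor d₀. It is supplied together with its inverse, so that
      -- the full product of the d can be taken out.
      ≈⟨ +-congʳ (trans (sym (*-identityʳ _)) (*-congˡ (sym (inverse zero)))) ⟩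
    γ zero * Πd * (d zero * d⁻¹ zero) + d zero * (Πd * (1# + S))
      ≈⟨ solve 5 (λ g p d d' s → g :* p :* (d :* d') :+ d :* (p :* (𝟙 :+ s))
                   := (d :* p) :* (𝟙 :+ (g :* d' :+ s))) refl (γ zero) Πd (d zero) (d⁻¹ zero) S ⟩
    (d zero * Πd) * (1# + (γ zero * d⁻¹ zero + S)) ∎
    where
    G : Columns (ℕ.suc n) n
    G k x = γ (suc k) * 1# + δ x (suc k) * d (suc k)
    Πd S : Carrier
    Πd = prod (d ∘ suc)
    S = sum (λ k → γ (suc k) * d⁻¹ (suc k))
    corner : colDet ((λ x → δ x zero * d zero) ∷ G) ≈ d zero * (Πd * (1# + S))
    corner = trans (colDet-first-column ((λ x → δ x zero * d zero) ∷ G) (λ x → zeroˡ _))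
      (*-cong (*-identityˡ _) (colDet-diagonal+rank1 (γ ∘ suc) (d ∘ suc) (d⁻¹ ∘ suc) (inverse ∘ suc)))
    ones : colDet ((λ _ → 1#) ∷ G) ≈ Πd
    ones = begin
      colDet ((λ _ → 1#) ∷ G)
        ≈⟨ add-killed (fix-head colDet-isMultilinear (λ _ → 1#)) (fix-head-kills colDet-isAlternating (λ _ → 1#))
             (γ ∘ suc) (λ k x → δ x (suc k) * d (suc k)) ⟩
      colDet ((λ _ → 1#) ∷ λ k x → δ x (suc k) * d (suc k))
        ≈⟨ colDet-first-row ((λ _ → 1#) ∷ λ k x → δ x (suc k) * d (suc k)) (λ k → zeroˡ _) ⟩
      1# * colDet (λ k x → δ x k * d (suc k))
        ≈⟨ trans (*-identityˡ _) (colDet-diagonal (d ∘ suc)) ⟩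
      Πd ∎

-- Signs of permutations

module PermutationSign where
  open import Data.Empty using (⊥-elim)
  open import Data.Fin.Base using (Fin; zero; suc)
  open import Data.List.Base using (List; []; _∷_; length)
  open import Data.List.Membership.Propositional using (_∈_; _∉_)
  open import Data.List.Membership.Propositional.Properties using (∈-∃++)
  open import Data.List.Relation.Unary.All as All using (All; []; _∷_)
  open import Data.List.Relation.Unary.Any using (here; there; any?)
  open import Data.List.Relation.Unary.Unique.Propositional using (Unique; []; _∷_)
  open import Data.List.Relation.Binary.Permutation.Propositional using (_↭_; ↭-sym; ↭⇒↭ₛ)
  open import Data.List.Relation.Binary.Permutation.Propositional.Properties using (shift; ↭-length; ∈-resp-↭)
  import Data.List.Relation.Binary.Permutation.Setoid.Properties as Permutationₛ
  open import Data.Nat.Base as ℕ using (ℕ; zero; suc)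
  import Data.Nat.Properties as ℕ
  open import Data.Product.Base using (_,_; ∃-syntax; _×_)
  open import Data.Product.Properties using (,-injectiveˡ)
  open import Data.Sign.Base as Sign using (Sign; opposite)
  import Data.Sign.Properties as Sign
  open import Function.Base using (_∘_)
  open import Relation.Binary.Definitions using (DecidableEquality)
  open import Relation.Binary.PropositionalEquality
  open import Relation.Nullary.Decidable using (yes; no)

  -- f is a product of transpositions, of which there are evenly many iff s = +.
  -- The sign is not shown to be unique: only its existence is ever needed.
  data HasSign {A : Set} : (A → A) → Sign → Set where
    identity   : ∀ {f} → (∀ x → f x ≡ x) → HasSign f Sign.+
    transposed : ∀ {f g s} x y → x ≢ y → f x ≡ g y → f y ≡ g x →
                 (∀ z → z ≢ x → z ≢ y → f z ≡ g z) → HasSign g s → HasSign f (opposite s)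

  module _ {A : Set} where

    HasSign-resp-≗ : ∀ {f g : A → A} {s} → (∀ x → f x ≡ g x) → HasSign g s → HasSign f s
    HasSign-resp-≗ f≗g (identity g≗id) = identity λ x → trans (f≗g x) (g≗id x)
    HasSign-resp-≗ f≗g (transposed x y x≢y gx gy gz h) =
      transposed x y x≢y (trans (f≗g x) gx) (trans (f≗g y) gy) (λ z z≢x z≢y → trans (f≗g z) (gz z z≢x z≢y)) h

    HasSign-∘ : ∀ {f g : A → A} {s t} → HasSign f s → HasSign g t → HasSign (f ∘ g) (t Sign.* s)
    HasSign-∘ {f} {g} hf (identity g≗id) = HasSign-resp-≗ (λ x → cong f (g≗id x)) hf
    HasSign-∘ {f} {s = s} hf (transposed {s = t} x y x≢y gx gy gz hg) =
      subst (HasSign _) (opposite-* t s)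
        (transposed x y x≢y (cong f gx) (cong f gy) (λ z z≢x z≢y → cong f (gz z z≢x z≢y)) (HasSign-∘ hf hg))
      where
      opposite-* : ∀ s t → opposite (s Sign.* t) ≡ opposite s Sign.* t
      opposite-* Sign.+ t      = refl
      opposite-* Sign.- Sign.+ = refl
      opposite-* Sign.- Sign.- = refl

  -- Conjugation by a bijection carries each transposition to a transposition.
  HasSign-transport : ∀ {A B : Set} {f : A → A} {s} (to : A → B) (from : B → A) →
    (∀ a → from (to a) ≡ a) → (∀ b → to (from b) ≡ b) →
    ∀ {g : B → B} → (∀ a → g (to a) ≡ to (f a)) → HasSign f s → HasSign g s
  HasSign-transport to from from-to to-from {g} g-to (identity f≗id) = identity λ b → begin
    g b              ≡⟨ cong g (to-from b) ⟨
    g (to (from b))  ≡⟨ g-to (from b) ⟩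
    to _             ≡⟨ cong to (f≗id (from b)) ⟩
    to (from b)      ≡⟨ to-from b ⟩
    b                ∎
    where open ≡-Reasoning
  HasSign-transport {f = f} to from from-to to-from {g} g-to (transposed {g = f′} x y x≢y fx fy fz h) =
    transposed {g = to ∘ f′ ∘ from} (to x) (to y) (x≢y ∘ to-injective)
      (trans (g-to x) (cong to (trans fx (cong f′ (sym (from-to y))))))
      (trans (g-to y) (cong to (trans fy (cong f′ (sym (from-to x))))))
      (λ z z≢x z≢y → trans (cong g (sym (to-from z))) (trans (g-to (from z)) (cong to
        (fz (from z) (λ eq → z≢x (trans (sym (to-from z)) (cong to eq)))
          λ eq → z≢y (trans (sym (to-from z)) (cong to eq))))))
      (HasSign-transport to from from-to to-from (λ a → cong (to ∘ f′) (from-to a)) h)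
    where
    to-injective : ∀ {a b} → to a ≡ to b → a ≡ b
    to-injective {a} {b} eq = trans (sym (from-to a)) (trans (cong from eq) (from-to b))

  infixr 8 _^^_
  _^^_ : Sign → ℕ → Sign
  s ^^ zero  = Sign.+
  s ^^ suc k = s Sign.* s ^^ k

  ^^-odd : ∀ s h → s ^^ suc (h ℕ.+ h) ≡ s
  ^^-odd s zero    = Sign.*-identityʳ s
  ^^-odd s (suc h) rewrite ℕ.+-suc h h = trans (sym (Sign.*-assoc s s _))
    (trans (cong (Sign._* s ^^ suc (h ℕ.+ h)) (Sign.s*s≡+ s)) (^^-odd s h))

  onFirstFibre : ∀ {A : Set} {m} → (A → A) → A × Fin (suc m) → A × Fin (suc m)
  onFirstFibre f (a , zero)  = f a , zero
  onFirstFibre f (a , suc b) = a , suc b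

  offFirstFibre : ∀ {A : Set} {m} → (A × Fin m → A × Fin m) → A × Fin (suc m) → A × Fin (suc m)
  offFirstFibre f (a , zero)  = a , zero
  offFirstFibre f (a , suc b) with c , d ← f (a , b) = c , suc d

  onFirstFibre-HasSign : ∀ {A : Set} {m} {f : A → A} {s} → HasSign f s → HasSign (onFirstFibre {m = m} f) s
  onFirstFibre-HasSign (identity f≗id) = identity λ { (a , zero) → cong (_, zero) (f≗id a) ; (a , suc b) → refl }
  onFirstFibre-HasSign (transposed x y x≢y fx fy fz h) =
    transposed (x , zero) (y , zero) (x≢y ∘ ,-injectiveˡ) (cong (_, zero) fx) (cong (_, zero) fy)
      (λ { (z , zero) z≢x z≢y → cong (_, zero) (fz z (z≢x ∘ cong (_, zero)) (z≢y ∘ cong (_, zero)))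
         ; (z , suc b) _ _ → refl })
      (onFirstFibre-HasSign h)

  offFirstFibre-HasSign : ∀ {A : Set} {m} {f : A × Fin m → A × Fin m} {s} →
    HasSign f s → HasSign (offFirstFibre f) s
  offFirstFibre-HasSign (identity f≗id) = identity λ { (a , zero) → refl ; (a , suc b) → cong shift⁺ (f≗id (a , b)) }
    where
    shift⁺ : ∀ {A : Set} {m} → A × Fin m → A × Fin (suc m)
    shift⁺ (a , b) = a , suc b
  offFirstFibre-HasSign (transposed (x , b) (y , c) x≢y fx fy fz h) =
    transposed (x , suc b) (y , suc c) (λ { refl → x≢y refl }) (cong shift⁺ fx) (cong shift⁺ fy)
      (λ { (z , zero) _ _ → refl
         ; (z , suc d) z≢x z≢y → cong shift⁺ (fz (z , d) (λ { refl → z≢x refl }) λ { refl → z≢y refl }) })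
      (offFirstFibre-HasSign h)
    where
    shift⁺ : ∀ {A : Set} {m} → A × Fin m → A × Fin (suc m)
    shift⁺ (a , b) = a , suc b

  -- The maps on different fibres may differ as long as their sign is common; later each fibre
  -- carries its own translation.
  fibrewise-HasSign : ∀ {A : Set} {m} (f : Fin m → A → A) {s} → (∀ b → HasSign (f b) s) →
    HasSign {A × Fin m} (λ (a , b) → f b a , b) (s ^^ m)
  fibrewise-HasSign {m = zero}  f h = identity λ ()
  fibrewise-HasSign {m = suc m} f {s} h = subst (HasSign _) (Sign.*-comm (s ^^ m) s)
    (HasSign-resp-≗ (λ { (a , zero) → refl ; (a , suc b) → refl })
      (HasSign-∘ (onFirstFibre-HasSign (h zero)) (offFirstFibre-HasSign (fibrewise-HasSign (f ∘ suc) (h ∘ suc)))))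

  Unique-resp-↭ : ∀ {A : Set} {xs ys : List A} → xs ↭ ys → Unique xs → Unique ys
  Unique-resp-↭ {A} xs↭ys = Permutationₛ.Unique-resp-↭ (setoid A) (↭⇒↭ₛ xs↭ys)

  ∈⇒↭ : ∀ {A : Set} {x : A} {xs} → x ∈ xs → ∃[ ys ] xs ↭ x ∷ ys
  ∈⇒↭ {x = x} x∈xs with ys , zs , refl ← ∈-∃++ x∈xs = _ , shift x ys zs

  module _ {A : Set} (_≟_ : DecidableEquality A) where

    -- The moved points split into k pairs x, f x. Peeling off the transposition of one pair leaves
    -- an involution `g` that fixes this pair and agrees with f elsewhere.
    involution-HasSign : ∀ k (f : A → A) → (∀ x → f (f x) ≡ x) →
      ∀ xs → Unique xs → length xs ≡ k ℕ.+ k → (∀ {x} → x ∈ xs → f x ≢ x) → (∀ {x} → x ∉ xs → f x ≡ x) →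
      HasSign f (Sign.- ^^ k)
    involution-HasSign zero    f inv []       _ _  moved fixed = identity λ x → fixed λ ()
    involution-HasSign (suc k) f inv (x ∷ xs) (x∉xs ∷ unique) len moved fixed
      with any? (f x ≟_) xs
    -- If f x were outside the list it would be fixed, and then f x = f (f x) = x although x is
    -- moved.
    ... | no fx∉ = ⊥-elim (moved (here refl) (sym (trans (sym (inv x)) (fixed λ
            { (here fx≡x) → moved (here refl) fx≡x ; (there fx∈) → fx∉ fx∈ }))))
    ... | yes fx∈ with ys , xs↭ ← ∈⇒↭ fx∈ with fx∉ys ∷ unique′ ← Unique-resp-↭ xs↭ unique =
      transposed x (f x) x≢fx (sym g-fx) (trans (inv x) (sym g-x)) (λ z z≢x z≢fx → sym (g-other z z≢x z≢fx))
        (involution-HasSign k g g-involutive ys unique′ len′ g-moved g-fixed)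
      where
      x≢fx : x ≢ f x
      x≢fx eq = moved (here refl) (sym eq)

      g : A → A
      g z with z ≟ x
      ... | yes _ = z
      ... | no  _ with z ≟ f x
      ...   | yes _ = z
      ...   | no  _ = f z

      g-x : g x ≡ x
      g-x with x ≟ x
      ... | yes _   = refl
      ... | no  x≢x = ⊥-elim (x≢x refl)

      g-fx : g (f x) ≡ f x
      g-fx with f x ≟ x
      ... | yes _ = refl
      ... | no  _ with f x ≟ f x
      ...   | yes _     = refl
      ...   | no  fx≢fx = ⊥-elim (fx≢fx refl)

      g-other : ∀ z → z ≢ x → z ≢ f x → g z ≡ f z
      g-other z z≢x z≢fx with z ≟ x
      ... | yes z≡x = ⊥-elim (z≢x z≡x)
      ... | no  _ with z ≟ f x
      ...   | yes z≡fx = ⊥-elim (z≢fx z≡fx)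
      ...   | no  _    = refl

      g-involutive : ∀ z → g (g z) ≡ z
      g-involutive z with z ≟ x
      ... | yes z≡x = trans (cong g z≡x) (trans g-x (sym z≡x))
      ... | no  z≢x with z ≟ f x
      ...   | yes z≡fx = trans (cong g z≡fx) (trans g-fx (sym z≡fx))
      ...   | no  z≢fx = trans (g-other (f z)
                (λ fz≡x → z≢fx (trans (sym (inv z)) (cong f fz≡x)))
                (λ fz≡fx → z≢x (trans (sym (inv z)) (trans (cong f fz≡fx) (inv x))))) (inv z)

      len′ : length ys ≡ k ℕ.+ k
      len′ = ℕ.suc-injective (trans (sym (↭-length xs↭)) (ℕ.suc-injective (trans len (cong suc (ℕ.+-suc k k)))))

      g-moved : ∀ {z} → z ∈ ys → g z ≢ z
      g-moved {z} z∈ys gz≡z = moved (there z∈xs) (trans (sym (g-other z z≢x z≢fx)) gz≡z)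
        where
        z∈xs : z ∈ xs
        z∈xs = ∈-resp-↭ (↭-sym xs↭) (there z∈ys)
        z≢x : z ≢ x
        z≢x refl = All.lookup x∉xs z∈xs refl
        z≢fx : z ≢ f x
        z≢fx refl = All.lookup fx∉ys z∈ys refl

      g-fixed : ∀ {z} → z ∉ ys → g z ≡ z
      g-fixed {z} z∉ys with z ≟ x
      ... | yes _ = refl
      ... | no  z≢x with z ≟ f x
      ...   | yes _    = refl
      ...   | no  z≢fx = fixed λ
              { (here z≡x) → z≢x z≡x
              ; (there z∈xs) → case-∷ (∈-resp-↭ xs↭ z∈xs) }
        where
        case-∷ : z ∉ f x ∷ ys
        case-∷ (here z≡fx)  = z≢fx z≡fx
        case-∷ (there z∈ys) = z∉ys z∈ys

-- Residues, affine maps modulo n, and division modulo a prime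

module Residues where
  open PermutationSign
  open import Data.Empty using (⊥-elim)
  open import Data.Fin.Base using (Fin; zero; suc; toℕ; fromℕ<)
  open import Data.Fin.Properties using (_≟_; toℕ-injective; toℕ<n; toℕ-fromℕ<)
  open import Data.Integer.Base as ℤ using (ℤ; +_; 0ℤ; 1ℤ; -1ℤ; _+_; _*_; _-_; -_; _/ℕ_; _%ℕ_)
  open import Data.Integer.DivMod using (n%ℕd<d; a≡a%ℕn+[a/ℕn]*n)
  open import Data.Integer.Divisibility.Signed using (_∣_; divides; _∣?_; ∣⇒∣ᵤ; ∣ᵤ⇒∣; ∣m∣n⇒∣m+n; ∣n⇒∣m*n)
  import Data.Integer.Properties as ℤ
  open import Data.Integer.Tactic.RingSolver using (solve-∀)
  open import Data.List.Base using (List; []; _∷_; _++_; length)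
  open import Data.List.Membership.Propositional using (_∈_; _∉_)
  open import Data.List.Membership.Propositional.Properties using (∈-allFin; ∈-++⁺ʳ; ∈-++⁻)
  open import Data.List.Properties using (length-++; length-tabulate)
  open import Data.List.Relation.Binary.Permutation.Propositional using (_↭_; ↭-refl; ↭-trans; prep)
  open import Data.List.Relation.Binary.Permutation.Propositional.Properties using (↭-length; ∈-resp-↭)
  open import Data.List.Relation.Unary.All as All using (All; []; _∷_)
  open import Data.List.Relation.Unary.Any using (here; there; tail)
  open import Data.List.Relation.Unary.Unique.Propositional using (Unique; []; _∷_)
  open import Data.List.Relation.Unary.Unique.Propositional.Properties using (allFin⁺)
  open import Data.Nat.Base as ℕ using (ℕ; zero; suc; NonZero)
  open import Data.Nat.Coprimality using (prime⇒coprime; coprime-Bézout)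
  import Data.Nat.Divisibility as ℕ
  open import Data.Nat.GCD using (module Bézout)
  open import Data.Nat.Primality using (Prime; euclidsLemma; prime⇒nonZero; prime⇒nonTrivial)
  import Data.Nat.Properties as ℕ
  open import Data.Product.Base using (_,_; ∃-syntax; proj₁; proj₂)
  open import Data.Sign.Base as Sign using (Sign)
  import Data.Sign.Properties as Sign
  open import Data.Sum.Base using (_⊎_; inj₁; inj₂; [_,_]′)
  open import Function.Base using (_∘_; id)
  open import Relation.Binary.PropositionalEquality
  open import Relation.Nullary.Decidable using (Dec; yes; no)
  open import Relation.Nullary.Negation using (¬_)

  -- Congruences are certified by writing the divided term as a combination of known multiples of n,
  -- so that only a polynomial identity is left for the solver.
  ∣-combination : ∀ {n A B} u v {C} → n ∣ A → n ∣ B → C ≡ u * A + v * B → n ∣ C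
  ∣-combination {n} u v n∣A n∣B eq = subst (n ∣_) (sym eq) (∣m∣n⇒∣m+n (∣n⇒∣m*n u n∣A) (∣n⇒∣m*n v n∣B))

  ∣-multiple : ∀ {n A} u {C} → n ∣ A → C ≡ u * A → n ∣ C
  ∣-multiple {n} u n∣A eq = subst (n ∣_) (sym eq) (∣n⇒∣m*n u n∣A)

  module _ (n : ℕ) .{{_ : NonZero n}} where

    abstract
      resid : ℤ → Fin n
      resid z = fromℕ< (n%ℕd<d z n)

      toℕ-resid : ∀ z → toℕ (resid z) ≡ z %ℕ n
      toℕ-resid z = toℕ-fromℕ< (n%ℕd<d z n)

    resid-/ℕ : ∀ z → z ≡ + toℕ (resid z) + (z /ℕ n) * + n
    resid-/ℕ z = trans (a≡a%ℕn+[a/ℕn]*n z n) (cong (λ r → + r + (z /ℕ n) * + n) (sym (toℕ-resid z)))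

    resid-∣ : ∀ z → + n ∣ + toℕ (resid z) - z
    resid-∣ z = divides (- (z /ℕ n)) (trans (cong (λ y → + toℕ (resid z) - y) (resid-/ℕ z))
      (lem (+ toℕ (resid z)) (z /ℕ n) (+ n)))
      where
      lem : ∀ r q n → r - (r + q * n) ≡ (- q) * n
      lem = solve-∀

    aff : ℤ → ℤ → Fin n → Fin n
    aff α τ i = resid (α * + toℕ i + τ)

  ∣∧<⇒≡0 : ∀ {n k} → n ℕ.∣ k → k ℕ.< n → k ≡ 0
  ∣∧<⇒≡0 {k = zero}  n∣k k<n = refl
  ∣∧<⇒≡0 {k = suc k} n∣k k<n = ⊥-elim (ℕ.<⇒≱ k<n (ℕ.∣⇒≤ n∣k))

  module _ {n : ℕ} where

    small-∣⇒≡ : ∀ {i j} → i ℕ.< n → j ℕ.< n → + n ∣ + i - + j → i ≡ j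
    small-∣⇒≡ {i} {j} i<n j<n n∣i-j = ℤ.+-injective (ℤ.i-j≡0⇒i≡j (+ i) (+ j) (ℤ.∣i∣≡0⇒i≡0
      (∣∧<⇒≡0 (∣⇒∣ᵤ n∣i-j) (ℕ.≤-<-trans
        (subst (λ z → ℤ.∣ z ∣ ℕ.≤ i ℕ.⊔ j) (sym (ℤ.[+m]-[+n]≡m⊖n i j)) (ℤ.∣m⊝n∣≤m⊔n i j))
        (ℕ.⊔-lub i<n j<n)))))

    fin-≡ : ∀ {i j : Fin n} → + n ∣ + toℕ i - + toℕ j → i ≡ j
    fin-≡ {i} {j} n∣i-j = toℕ-injective (small-∣⇒≡ (toℕ<n i) (toℕ<n j) n∣i-j)

  module _ {n : ℕ} .{{_ : NonZero n}} where

    resid-unique : ∀ {z} {i : Fin n} → + n ∣ z - + toℕ i → resid n z ≡ i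
    resid-unique {z} {i} n∣ = fin-≡ (∣-combination 1ℤ 1ℤ (resid-∣ n z) n∣ (lem (+ toℕ (resid n z)) z (+ toℕ i)))
      where
      lem : ∀ r z i → r - i ≡ 1ℤ * (r - z) + 1ℤ * (z - i)
      lem = solve-∀

    resid-cong : ∀ {y z} → + n ∣ y - z → resid n y ≡ resid n z
    resid-cong {y} {z} n∣ = resid-unique (∣-combination 1ℤ -1ℤ n∣ (resid-∣ n z) (lem y z (+ toℕ (resid n z))))
      where
      lem : ∀ y z r → y - r ≡ 1ℤ * (y - z) + -1ℤ * (r - z)
      lem = solve-∀

    -- The coefficients of the composite are prescribed only modulo n, so that inverses cancel in
    -- the same step.
    aff-∘ : ∀ α τ β σ γ ρ → + n ∣ α * β - γ → + n ∣ (α * σ + τ) - ρ → ∀ i → aff n α τ (aff n β σ i) ≡ aff n γ ρ i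
    aff-∘ α τ β σ γ ρ γ≡ ρ≡ i = resid-cong (∣-combination α 1ℤ (resid-∣ n (β * + toℕ i + σ))
      (∣-combination (+ toℕ i) 1ℤ γ≡ ρ≡ refl) (lem α τ β σ γ ρ (+ toℕ i) (+ toℕ (aff n β σ i))))
      where
      lem : ∀ α τ β σ γ ρ i r → (α * r + τ) - (γ * i + ρ) ≡
        α * (r - (β * i + σ)) + 1ℤ * (i * (α * β - γ) + 1ℤ * ((α * σ + τ) - ρ))
      lem = solve-∀

    aff-id : ∀ {α τ} → + n ∣ α - 1ℤ → + n ∣ τ → ∀ i → aff n α τ i ≡ i
    aff-id {α} {τ} α≡1 τ≡0 i = resid-unique (∣-combination (+ toℕ i) 1ℤ α≡1 τ≡0 (lem α τ (+ toℕ i)))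
      where
      lem : ∀ α τ i → (α * i + τ) - i ≡ i * (α - 1ℤ) + 1ℤ * τ
      lem = solve-∀

    aff-inverse : ∀ α τ β σ → + n ∣ α * β - 1ℤ → + n ∣ (α * σ + τ) - 0ℤ → ∀ i → aff n α τ (aff n β σ i) ≡ i
    aff-inverse α τ β σ αβ≡1 ασ+τ≡0 i = trans (aff-∘ α τ β σ 1ℤ 0ℤ αβ≡1 ασ+τ≡0 i)
      (aff-id {α = 1ℤ} {0ℤ} (divides 0ℤ refl) (divides 0ℤ refl) i)

  ⊆⇒↭ : ∀ {A : Set} {xs ys : List A} → Unique xs → (∀ {x} → x ∈ xs → x ∈ ys) → ∃[ zs ] ys ↭ xs ++ zs
  ⊆⇒↭ {xs = []}     _              _  = _ , ↭-refl
  ⊆⇒↭ {xs = x ∷ xs} (x∉xs ∷ unique) ⊆ with ws , ys↭ ← ∈⇒↭ (⊆ (here refl))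
    with zs , ws↭ ← ⊆⇒↭ unique (λ y∈xs → tail (λ { refl → All.lookup x∉xs y∈xs refl }) (∈-resp-↭ ys↭ (⊆ (there y∈xs))))
    = zs , ↭-trans ys↭ (prep x ws↭)

  -- The fixed points are few and explicit, so they are the ones listed; the moved points are what
  -- remains of all elements.
  Fin-involution-HasSign : ∀ {n} k (f : Fin n → Fin n) → (∀ x → f (f x) ≡ x) →
    ∀ xs → Unique xs → n ≡ length xs ℕ.+ (k ℕ.+ k) → (∀ {x} → x ∈ xs → f x ≡ x) → (∀ {x} → f x ≡ x → x ∈ xs) →
    HasSign f (Sign.- ^^ k)
  Fin-involution-HasSign {n} k f inv xs unique len fixed⁺ fixed⁻
    with zs , all↭ ← ⊆⇒↭ unique (λ {x} _ → ∈-allFin x) =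
    involution-HasSign _≟_ k f inv zs (unique-zs xs all-unique) len′
      (λ x∈zs fx≡x → disjoint xs all-unique (fixed⁻ fx≡x) x∈zs)
      λ {x} x∉zs → [ fixed⁺ , ⊥-elim ∘ x∉zs ]′ (∈-++⁻ xs (∈-resp-↭ all↭ (∈-allFin x)))
    where
    all-unique : Unique (xs ++ zs)
    all-unique = Unique-resp-↭ all↭ (allFin⁺ n)
    unique-zs : ∀ {A : Set} xs {zs : List A} → Unique (xs ++ zs) → Unique zs
    unique-zs []       u       = u
    unique-zs (x ∷ xs) (_ ∷ u) = unique-zs xs u
    disjoint : ∀ {A : Set} xs {zs : List A} {x} → Unique (xs ++ zs) → x ∈ xs → x ∉ zs
    disjoint (x ∷ xs) (x∉ ∷ _) (here refl) x∈zs = All.lookup x∉ (∈-++⁺ʳ xs x∈zs) refl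
    disjoint (x ∷ xs) (_ ∷ u)  (there x∈)  x∈zs = disjoint xs u x∈ x∈zs
    len′ : length zs ≡ k ℕ.+ k
    len′ = ℕ.+-cancelˡ-≡ (length xs) _ _ (trans (sym (length-++ xs))
      (trans (sym (↭-length all↭)) (trans (length-tabulate id) len)))

  Odd : ℕ → Set
  Odd n = ∃[ h ] n ≡ suc (h ℕ.+ h)

  odd⇒ℤ : ∀ {n} (odd : Odd n) → + n ≡ 1ℤ + (+ proj₁ odd + + proj₁ odd)
  odd⇒ℤ (h , refl) = refl

  module _ {n : ℕ} .{{_ : NonZero n}} (n-odd : Odd n) where
    private
      h = proj₁ n-odd

    -- The only fixed point is t/2, and 1/2 is -h modulo n = 2h + 1. Hence the sign does not depend
    -- on t.
    reflection-HasSign : ∀ t → HasSign (aff n -1ℤ t) (Sign.- ^^ h)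
    reflection-HasSign t = Fin-involution-HasSign h (aff n -1ℤ t)
      (aff-inverse -1ℤ t -1ℤ t (divides 0ℤ refl) (divides 0ℤ (lem₀ t)))
      (centre ∷ []) ([] ∷ []) (proj₂ n-odd)
      (λ { (here refl) → resid-unique (∣-combination (- (+ 2)) t centre-∣ n∣1+2h (lem₁ (+ toℕ centre) t (+ h))) })
      (λ {x} fx≡x → here (sym (resid-unique (∣-combination (+ h) (- (+ toℕ x)) (fixed-∣ x fx≡x) n∣1+2h
        (lem₂ (+ toℕ x) t (+ h))))))
      where
      centre : Fin n
      centre = resid n (- + h * t)
      centre-∣ : + n ∣ + toℕ centre - (- + h * t)
      centre-∣ = resid-∣ n (- + h * t)
      n∣1+2h : + n ∣ 1ℤ + (+ h + + h)
      n∣1+2h = divides 1ℤ (trans (sym (odd⇒ℤ n-odd)) (sym (ℤ.*-identityˡ (+ n))))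
      fixed-∣ : ∀ x → aff n -1ℤ t x ≡ x → + n ∣ + toℕ x - (-1ℤ * + toℕ x + t)
      fixed-∣ x fx≡x = subst (λ y → + n ∣ + toℕ y - (-1ℤ * + toℕ x + t)) fx≡x (resid-∣ n (-1ℤ * + toℕ x + t))
      lem₀ : ∀ t → (-1ℤ * t + t) - 0ℤ ≡ 0ℤ * + n
      lem₀ t = trans (lem t) (sym (ℤ.*-zeroˡ (+ n)))
        where
        lem : ∀ t → (-1ℤ * t + t) - 0ℤ ≡ 0ℤ
        lem = solve-∀
      lem₁ : ∀ c t h → (-1ℤ * c + t) - c ≡ (- (+ 2)) * (c - (- h * t)) + t * (1ℤ + (h + h))
      lem₁ = solve-∀
      lem₂ : ∀ x t h → - h * t - x ≡ h * (x - (-1ℤ * x + t)) + (- x) * (1ℤ + (h + h))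
      lem₂ = solve-∀

    -- A translation is the composite of two reflections, and these have equal signs.
    translation-HasSign : ∀ t → HasSign (aff n 1ℤ t) Sign.+
    translation-HasSign t = subst (HasSign _) (Sign.s*s≡+ (Sign.- ^^ h))
      (HasSign-resp-≗ (λ i → sym (aff-∘ -1ℤ t -1ℤ 0ℤ 1ℤ t (divides 0ℤ refl) (divides 0ℤ (lem t)) i))
        (HasSign-∘ (reflection-HasSign t) (reflection-HasSign 0ℤ)))
      where
      lem : ∀ t → (-1ℤ * 0ℤ + t) - t ≡ 0ℤ
      lem = solve-∀

  toℤ : Sign → ℤ
  toℤ Sign.+ = 1ℤ
  toℤ Sign.- = -1ℤ

  euclidsLemmaℤ : ∀ {p} → Prime p → ∀ x y → + p ∣ x * y → + p ∣ x ⊎ + p ∣ y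
  euclidsLemmaℤ {p} pr x y p∣xy
    with euclidsLemma ℤ.∣ x ∣ ℤ.∣ y ∣ pr (subst (p ℕ.∣_) (ℤ.abs-* x y) (∣⇒∣ᵤ p∣xy))
  ... | inj₁ p∣x = inj₁ (∣ᵤ⇒∣ p∣x)
  ... | inj₂ p∣y = inj₂ (∣ᵤ⇒∣ p∣y)

  Invertible : ℕ → ℤ → Set
  Invertible n α = ∃[ β ] + n ∣ α * β - 1ℤ

  module _ {p : ℕ} (pr : Prime p) where
    private
      instance
        p-nonZero : NonZero p
        p-nonZero = prime⇒nonZero pr

    small-invertible : ∀ k → k ≢ 0 → k ℕ.< p → Invertible p (+ k)
    small-invertible k k≢0 k<p with coprime-Bézout (prime⇒coprime pr {{ℕ.≢-nonZero k≢0}} k<p)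
    ... | Bézout.+- x y eq = - (+ y) , divides (- (+ x)) (begin
      + k * - (+ y) - 1ℤ             ≡⟨ lem (+ k) (+ y) ⟩
      - (1ℤ + + y * + k)             ≡⟨ cong (λ z → - (1ℤ + z)) (ℤ.pos-* y k) ⟨
      - (+ (1 ℕ.+ y ℕ.* k))          ≡⟨ cong (λ z → - (+ z)) eq ⟩
      - (+ (x ℕ.* p))                ≡⟨ cong -_ (ℤ.pos-* x p) ⟩
      - (+ x * + p)                  ≡⟨ ℤ.neg-distribˡ-* (+ x) (+ p) ⟩
      - (+ x) * + p                  ∎)
      where
      open ≡-Reasoning
      lem : ∀ k y → k * - y - 1ℤ ≡ - (1ℤ + y * k)
      lem = solve-∀
    ... | Bézout.-+ x y eq = + y , divides (+ x) (begin
      + k * + y - 1ℤ                 ≡⟨ cong (_- 1ℤ) (ℤ.*-comm (+ k) (+ y)) ⟩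
      + y * + k - 1ℤ                 ≡⟨ cong (_- 1ℤ) (ℤ.pos-* y k) ⟨
      + (y ℕ.* k) - 1ℤ               ≡⟨ cong (λ z → + z - 1ℤ) eq ⟨
      1ℤ + + (x ℕ.* p) - 1ℤ          ≡⟨ lem (+ (x ℕ.* p)) ⟩
      + (x ℕ.* p)                    ≡⟨ ℤ.pos-* x p ⟩
      + x * + p                      ∎)
      where
      open ≡-Reasoning
      lem : ∀ z → 1ℤ + z - 1ℤ ≡ z
      lem = solve-∀

    0ₚ : Fin p
    0ₚ = resid p 0ℤ

    0ₚ-∣ : + p ∣ + toℕ 0ₚ
    0ₚ-∣ = subst (+ p ∣_) (ℤ.+-identityʳ _) (resid-∣ p 0ℤ)

    ∣⇒≡0ₚ : ∀ {i : Fin p} → + p ∣ + toℕ i → i ≡ 0ₚ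
    ∣⇒≡0ₚ {i} p∣i = sym (resid-unique (∣-multiple -1ℤ p∣i (lem (+ toℕ i))))
      where
      lem : ∀ i → 0ℤ - i ≡ -1ℤ * i
      lem = solve-∀

    ∤⇒invertible : ∀ {α} → ¬ (+ p ∣ α) → Invertible p α
    ∤⇒invertible {α} p∤α with toℕ (resid p α) ℕ.≟ 0
    ... | yes eq = ⊥-elim (p∤α (∣-multiple -1ℤ (subst (λ k → + p ∣ + k - α) eq (resid-∣ p α)) (lem α)))
      where
      lem : ∀ α → α ≡ -1ℤ * (0ℤ - α)
      lem = solve-∀
    ... | no  ≢0 with β , p∣ ← small-invertible _ ≢0 (toℕ<n (resid p α)) =
      β , ∣-combination 1ℤ (- β) p∣ (resid-∣ p α) (lem α β (+ toℕ (resid p α)))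
      where
      lem : ∀ α β r → α * β - 1ℤ ≡ 1ℤ * (r * β - 1ℤ) + (- β) * (r - α)
      lem = solve-∀

    abstract
      -- The default 0 at the residue 0 makes y ↦ α / y fix 0, so that for α prime to p it is an
      -- involution of all residues.
      modInverse : Fin p → ℤ
      modInverse y with + p ∣? + toℕ y
      ... | yes _   = 0ℤ
      ... | no  p∤y = proj₁ (∤⇒invertible p∤y)

      modInverse-0ₚ : modInverse 0ₚ ≡ 0ℤ
      modInverse-0ₚ with + p ∣? + toℕ 0ₚ
      ... | yes _  = refl
      ... | no  p∤ = ⊥-elim (p∤ 0ₚ-∣)

      modInverse-∣ : ∀ y → ¬ (+ p ∣ + toℕ y) → + p ∣ + toℕ y * modInverse y - 1ℤ
      modInverse-∣ y p∤y with + p ∣? + toℕ y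
      ... | yes p∣y  = ⊥-elim (p∤y p∣y)
      ... | no  p∤y′ = proj₂ (∤⇒invertible p∤y′)

    abstract
      -- The involution y ↦ α / y of the nonzero residues, extended by 0 ↦ 0.
      divideBy : ℤ → Fin p → Fin p
      divideBy α y = resid p (α * modInverse y)

      divideBy-0ₚ : ∀ α → divideBy α 0ₚ ≡ 0ₚ
      divideBy-0ₚ α = cong (resid p) (trans (cong (α *_) modInverse-0ₚ) (ℤ.*-zeroʳ α))

      divideBy-∣ : ∀ α {y} → ¬ (+ p ∣ + toℕ y) → + p ∣ + toℕ y * + toℕ (divideBy α y) - α
      divideBy-∣ α {y} p∤y = ∣-combination (+ toℕ y) α (resid-∣ p (α * modInverse y)) (modInverse-∣ y p∤y)
        (lem (+ toℕ y) α (modInverse y) (+ toℕ (divideBy α y)))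
        where
        lem : ∀ y α i r → y * r - α ≡ y * (r - α * i) + α * (y * i - 1ℤ)
        lem = solve-∀

    cancel : ∀ {x y z} → ¬ (+ p ∣ x) → + p ∣ x * y - x * z → + p ∣ y - z
    cancel {x} {y} {z} p∤x p∣ with euclidsLemmaℤ pr x (y - z) (subst (+ p ∣_) (lem x y z) p∣)
      where
      lem : ∀ x y z → x * y - x * z ≡ x * (y - z)
      lem = solve-∀
    ... | inj₁ p∣x   = ⊥-elim (p∤x p∣x)
    ... | inj₂ p∣y-z = p∣y-z

    module _ {α} (p∤α : ¬ (+ p ∣ α)) where

      divideBy-∤ : ∀ {y} → ¬ (+ p ∣ + toℕ y) → ¬ (+ p ∣ + toℕ (divideBy α y))
      divideBy-∤ {y} p∤y p∣ = p∤α (∣-combination (+ toℕ y) -1ℤ p∣ (divideBy-∣ α p∤y)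
        (lem (+ toℕ y) (+ toℕ (divideBy α y)) α))
        where
        lem : ∀ y r α → α ≡ y * r + -1ℤ * (y * r - α)
        lem = solve-∀

      -- Multiplied by α / y, both y and the twofold quotient give α; the nonzero factor α / y can
      -- be cancelled.
      divideBy-involutive : ∀ y → divideBy α (divideBy α y) ≡ y
      divideBy-involutive y = go (+ p ∣? + toℕ y)
        where
        lem : ∀ y r s α → r * s - r * y ≡ 1ℤ * (r * s - α) + -1ℤ * (y * r - α)
        lem = solve-∀
        go : Dec (+ p ∣ + toℕ y) → divideBy α (divideBy α y) ≡ y
        go (yes p∣y) = subst (λ y → divideBy α (divideBy α y) ≡ y) (sym (∣⇒≡0ₚ p∣y))
          (trans (cong (divideBy α) (divideBy-0ₚ α)) (divideBy-0ₚ α))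
        go (no  p∤y) = fin-≡ (cancel (divideBy-∤ p∤y)
          (∣-combination 1ℤ -1ℤ (divideBy-∣ α (divideBy-∤ p∤y)) (divideBy-∣ α p∤y)
            (lem (+ toℕ y) (+ toℕ (divideBy α y)) (+ toℕ (divideBy α (divideBy α y))) α)))

      divideBy-fixed : ∀ {y} → ¬ (+ p ∣ + toℕ y) → divideBy α y ≡ y → + p ∣ + toℕ y * + toℕ y - α
      divideBy-fixed {y} p∤y eq = subst (λ z → + p ∣ + toℕ y * + toℕ z - α) eq (divideBy-∣ α p∤y)

      root⇒divideBy-fixed : ∀ {y} → + p ∣ + toℕ y * + toℕ y - α → divideBy α y ≡ y
      root⇒divideBy-fixed {y} p∣ = fin-≡ (cancel p∤y (∣-combination 1ℤ -1ℤ (divideBy-∣ α p∤y) p∣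
        (lem (+ toℕ y) (+ toℕ (divideBy α y)) α)))
        where
        p∤y : ¬ (+ p ∣ + toℕ y)
        p∤y p∣y = p∤α (∣-combination (+ toℕ y) -1ℤ p∣y p∣ (lem′ (+ toℕ y) α))
          where
          lem′ : ∀ y α → α ≡ y * y + -1ℤ * (y * y - α)
          lem′ = solve-∀
        lem : ∀ y r α → y * r - y * y ≡ 1ℤ * (y * r - α) + -1ℤ * (y * y - α)
        lem = solve-∀

      -- A fixed point y ≠ 0 would be a square root of α, so only 0 is fixed and the other p - 1
      -- residues form h pairs.
      divideBy-HasSign-nonresidue : ∀ h → p ≡ 1 ℕ.+ (h ℕ.+ h) → ¬ QuadraticResidue α p →
        HasSign (divideBy α) (Sign.- ^^ h)
      divideBy-HasSign-nonresidue h p≡ ¬residue = Fin-involution-HasSign h (divideBy α) divideBy-involutive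
        (0ₚ ∷ []) ([] ∷ []) p≡ (λ { (here refl) → divideBy-0ₚ α }) (λ {y} → fixed {y} (+ p ∣? + toℕ y))
        where
        fixed : ∀ {y} → Dec (+ p ∣ + toℕ y) → divideBy α y ≡ y → y ∈ 0ₚ ∷ []
        fixed (yes p∣y) _  = here (∣⇒≡0ₚ p∣y)
        fixed {y} (no p∤y) eq = ⊥-elim (¬residue (y , divideBy-fixed p∤y eq))

      -- Besides 0 the two roots x and -x are fixed, and the other p - 3 residues form h pairs. For
      -- the same p this h is one less than for a nonresidue.
      divideBy-HasSign-residue : ∀ h → p ≡ 3 ℕ.+ (h ℕ.+ h) → QuadraticResidue α p →
        HasSign (divideBy α) (Sign.- ^^ h)
      divideBy-HasSign-residue h p≡ (x , p∣x²-α) = Fin-involution-HasSign h (divideBy α) divideBy-involutive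
        (0ₚ ∷ x ∷ -x ∷ []) (((x≢0 ∘ sym) ∷ (-x≢0 ∘ sym) ∷ []) ∷ (x≢-x ∷ []) ∷ [] ∷ []) p≡
        (λ { (here refl) → divideBy-0ₚ α
           ; (there (here refl)) → root⇒divideBy-fixed p∣x²-α
           ; (there (there (here refl))) → root⇒divideBy-fixed p∣-x²-α })
        (λ {y} → fixed {y} (+ p ∣? + toℕ y))
        where
        -x : Fin p
        -x = resid p (- + toℕ x)
        p∣-x²-α : + p ∣ + toℕ -x * + toℕ -x - α
        p∣-x²-α = ∣-combination (+ toℕ -x - + toℕ x) 1ℤ (resid-∣ p (- + toℕ x)) p∣x²-α (lem (+ toℕ x) (+ toℕ -x) α)
          where
          lem : ∀ x y α → y * y - α ≡ (y - x) * (y - - x) + 1ℤ * (x * x - α)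
          lem = solve-∀
        root≢0 : ∀ {y} → + p ∣ + toℕ y * + toℕ y - α → ¬ (+ p ∣ + toℕ y)
        root≢0 {y} p∣ p∣y = p∤α (∣-combination (+ toℕ y) -1ℤ p∣y p∣ (lem (+ toℕ y) α))
          where
          lem : ∀ y α → α ≡ y * y + -1ℤ * (y * y - α)
          lem = solve-∀
        x≢0 : x ≢ 0ₚ
        x≢0 eq = root≢0 p∣x²-α (subst (λ y → + p ∣ + toℕ y) (sym eq) 0ₚ-∣)
        -x≢0 : -x ≢ 0ₚ
        -x≢0 eq = root≢0 p∣-x²-α (subst (λ y → + p ∣ + toℕ y) (sym eq) 0ₚ-∣)
        -- Since 2(h + 1)x = (p - 1)x, a residue with x = -x is zero.
        x≢-x : x ≢ -x
        x≢-x eq = root≢0 p∣x²-α (∣-combination (+ toℕ x) (- (1ℤ + + h)) p∣3+2h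
          (subst (λ y → + p ∣ + toℕ y - - + toℕ x) (sym eq) (resid-∣ p (- + toℕ x))) (lem (+ toℕ x) (+ h)))
          where
          p∣3+2h : + p ∣ + 3 + (+ h + + h)
          p∣3+2h = divides 1ℤ (trans (cong +_ (sym p≡)) (sym (ℤ.*-identityˡ (+ p))))
          lem : ∀ x h → x ≡ x * (+ 3 + (h + h)) + (- (1ℤ + h)) * (x - - x)
          lem = solve-∀
        fixed : ∀ {y} → Dec (+ p ∣ + toℕ y) → divideBy α y ≡ y → y ∈ 0ₚ ∷ x ∷ -x ∷ []
        fixed (yes p∣y) _ = here (∣⇒≡0ₚ p∣y)
        fixed {y} (no p∤y) eq with euclidsLemmaℤ pr (+ toℕ y - + toℕ x) (+ toℕ y + + toℕ x)
          (∣-combination 1ℤ -1ℤ (divideBy-fixed p∤y eq) p∣x²-α (lem (+ toℕ x) (+ toℕ y) α))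
          where
          lem : ∀ x y α → (y - x) * (y + x) ≡ 1ℤ * (y * y - α) + -1ℤ * (x * x - α)
          lem = solve-∀
        ... | inj₁ p∣y-x = there (here (fin-≡ p∣y-x))
        ... | inj₂ p∣y+x = there (there (here (sym (resid-unique (∣-multiple -1ℤ p∣y+x (lem (+ toℕ x) (+ toℕ y)))))))
          where
          lem : ∀ x y → - x - y ≡ -1ℤ * (y + x)
          lem = solve-∀

    p∤1 : ¬ (+ p ∣ 1ℤ)
    p∤1 p∣1 = ℕ.nonTrivial⇒≢1 {{prime⇒nonTrivial pr}} (ℕ.∣1⇒≡1 (∣⇒∣ᵤ p∣1))

    -- The convention 0 ↦ 0 makes the factorisation valid at the residue 0 as well.
    divideBy-∘ : ∀ α y → aff p α 0ℤ y ≡ divideBy α (divideBy 1ℤ y)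
    divideBy-∘ α y = go (+ p ∣? + toℕ y)
      where
      y⁻¹ z : Fin p
      y⁻¹ = divideBy 1ℤ y
      z = divideBy α y⁻¹
      lem : ∀ y r s α → (α * y + 0ℤ) - s ≡ (- y) * (r * s - α) + s * (y * r - 1ℤ)
      lem = solve-∀
      lem′ : ∀ y α → (α * y + 0ℤ) - y ≡ (α - 1ℤ) * y
      lem′ = solve-∀
      go : Dec (+ p ∣ + toℕ y) → aff p α 0ℤ y ≡ z
      go (no p∤y) = resid-unique (∣-combination (- + toℕ y) (+ toℕ z)
        (divideBy-∣ α (divideBy-∤ p∤1 p∤y)) (divideBy-∣ 1ℤ p∤y) (lem (+ toℕ y) (+ toℕ y⁻¹) (+ toℕ z) α))
      go (yes p∣y) = subst (λ y → aff p α 0ℤ y ≡ divideBy α (divideBy 1ℤ y)) (sym (∣⇒≡0ₚ p∣y))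
        (trans (resid-unique (∣-multiple (α - 1ℤ) 0ₚ-∣ (lem′ (+ toℕ 0ₚ) α)))
          (sym (trans (cong (divideBy α) (divideBy-0ₚ 1ℤ)) (divideBy-0ₚ α))))

-- Zolotarev's lemma for primes and for products of primes

module Zolotarev where
  open Residues
  open PermutationSign
  open import Data.Empty using (⊥-elim)
  open import Data.Fin.Base using (Fin; zero; suc; toℕ; combine; remQuot)
  open import Data.Fin.Properties using (toℕ-combine; remQuot-combine; combine-remQuot)
  open import Data.Integer.Base as ℤ using (ℤ; +_; 0ℤ; 1ℤ; -1ℤ; _+_; _*_; _-_; -_; _/ℕ_)
  open import Data.Integer.Divisibility.Signed using (_∣_; divides; _∣?_)
  import Data.Integer.Properties as ℤ
  open import Data.Integer.Tactic.RingSolver using (solve-∀)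
  open import Data.List.Base using ([]; _∷_; foldr; map)
  open import Data.List.Membership.Propositional using (_∈_)
  open import Data.List.Relation.Unary.All as All using (All; []; _∷_)
  open import Data.List.Relation.Unary.Any using (here; there)
  open import Data.List.Relation.Unary.Unique.Propositional using ([]; _∷_)
  open import Data.Nat.Base as ℕ using (ℕ; zero; suc; NonZero)
  import Data.Nat.Divisibility as ℕ
  open import Data.Nat.ListAction using (product)
  open import Data.Nat.Primality using (Prime; prime⇒nonZero; prime⇒nonTrivial)
  import Data.Nat.Properties as ℕ
  open import Data.Product.Base using (_,_; ∃-syntax; _×_; proj₁; proj₂; swap)
  open import Data.Sign.Base as Sign using (Sign)
  import Data.Sign.Properties as Sign
  open import Data.Sum.Base using (_⊎_; inj₁; inj₂)
  open import Relation.Binary.PropositionalEquality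
  open import Relation.Nullary.Decidable using (Dec; yes; no)
  open import Relation.Nullary.Negation using (¬_)

  legendre-residue : ∀ {α p} → ¬ (+ p ∣ α) → QuadraticResidue α p → legendre α p ≡ 1ℤ
  legendre-residue {α} {p} p∤α residue with + p ∣? α
  ... | yes p∣α = ⊥-elim (p∤α p∣α)
  ... | no  _ with quadraticResidue? α p
  ...   | yes _        = refl
  ...   | no  ¬residue = ⊥-elim (¬residue residue)

  legendre-nonresidue : ∀ {α p} → ¬ (+ p ∣ α) → ¬ QuadraticResidue α p → legendre α p ≡ -1ℤ
  legendre-nonresidue {α} {p} p∤α ¬residue with + p ∣? α
  ... | yes p∣α = ⊥-elim (p∤α p∣α)
  ... | no  _ with quadraticResidue? α p
  ...   | yes residue = ⊥-elim (¬residue residue)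
  ...   | no  _       = refl

  legendre-∣ : ∀ {α p} → + p ∣ α → legendre α p ≡ 0ℤ
  legendre-∣ {α} {p} p∣α with + p ∣? α
  ... | yes _   = refl
  ... | no  p∤α = ⊥-elim (p∤α p∣α)

  -- aff n α τ has the sign of x ↦ α x because translations are even for odd n.
  scaling⇒aff-HasSign : ∀ {n} .{{_ : NonZero n}} → Odd n →
    ∀ {α s} → HasSign (aff n α 0ℤ) s → ∀ τ → HasSign (aff n α τ) s
  scaling⇒aff-HasSign {n} odd {α} {s} h τ = subst (HasSign _) (Sign.*-identityʳ s)
    (HasSign-resp-≗ (λ i → sym (aff-∘ 1ℤ τ α 0ℤ α τ (divides 0ℤ (lem₁ α)) (divides 0ℤ (lem₂ τ)) i))
      (HasSign-∘ (translation-HasSign odd τ) h))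
    where
    lem₁ : ∀ α → 1ℤ * α - α ≡ 0ℤ
    lem₁ = solve-∀
    lem₂ : ∀ τ → (1ℤ * 0ℤ + τ) - τ ≡ 0ℤ
    lem₂ = solve-∀

  odd-prime≥3 : ∀ {p} → Prime p → Odd p → ∃[ h ] p ≡ 3 ℕ.+ (h ℕ.+ h)
  odd-prime≥3 pr (zero  , refl) = ⊥-elim (ℕ.nonTrivial⇒≢1 {{prime⇒nonTrivial pr}} refl)
  odd-prime≥3 pr (suc h , refl) = h , cong (2 ℕ.+_) (ℕ.+-suc h h)

  -- Reciprocation consists of (p - 3)/2 transpositions, since 1 is a square. The map x ↦ α / x has
  -- equally many if α is a square and one more otherwise, so the quadratic character is what
  -- survives. Every translation τ is included because carries will act as translations.
  zolotarev-prime : ∀ {p} (pr : Prime p) → Odd p → ∀ {α} → ¬ (+ p ∣ α) →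
    ∃[ s ] legendre α p ≡ toℤ s × (∀ τ → HasSign (aff p {{prime⇒nonZero pr}} α τ) s)
  zolotarev-prime {p} pr odd {α} p∤α with h , p≡3+2h ← odd-prime≥3 pr odd = go (quadraticResidue? α p)
    where
    instance
      p-nonZero : NonZero p
      p-nonZero = prime⇒nonZero pr

    reciprocal : HasSign (divideBy pr 1ℤ) (Sign.- ^^ h)
    reciprocal = divideBy-HasSign-residue pr (p∤1 pr) h p≡3+2h
      (resid p 1ℤ , ∣-multiple (+ toℕ (resid p 1ℤ) + 1ℤ) (resid-∣ p 1ℤ) (lem (+ toℕ (resid p 1ℤ))))
      where
      lem : ∀ r → r * r - 1ℤ ≡ (r + 1ℤ) * (r - 1ℤ)
      lem = solve-∀

    scaling : ∀ {s} → HasSign (divideBy pr α) s → ∀ τ → HasSign (aff p α τ) (Sign.- ^^ h Sign.* s)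
    scaling hα = scaling⇒aff-HasSign odd {α} (HasSign-resp-≗ (divideBy-∘ pr α) (HasSign-∘ hα reciprocal))

    go : Dec (QuadraticResidue α p) → ∃[ s ] legendre α p ≡ toℤ s × (∀ τ → HasSign (aff p α τ) s)
    go (yes residue) = Sign.+ , legendre-residue p∤α residue ,
      subst (λ s → ∀ τ → HasSign (aff p α τ) s) (Sign.s*s≡+ (Sign.- ^^ h))
        (scaling (divideBy-HasSign-residue pr p∤α h p≡3+2h residue))
    go (no ¬residue) = Sign.- , legendre-nonresidue p∤α ¬residue ,
      subst (λ s → ∀ τ → HasSign (aff p α τ) s) (s*opposite[s] (Sign.- ^^ h))
        (scaling (divideBy-HasSign-nonresidue pr p∤α (suc h) (trans p≡3+2h (cong (2 ℕ.+_) (sym (ℕ.+-suc h h)))) ¬residue))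
      where
      s*opposite[s] : ∀ s → s Sign.* Sign.opposite s ≡ Sign.-
      s*opposite[s] Sign.+ = refl
      s*opposite[s] Sign.- = refl

  module _ {p m : ℕ} .{{_ : NonZero p}} .{{_ : NonZero m}} .{{_ : NonZero (p ℕ.* m)}} (α τ : ℤ) where
    private
      carry : Fin m → ℤ
      carry i = (α * + toℕ i + τ) /ℕ m

    -- In the mixed radix notation m j + i the low digit is mapped modulo m, and the quotient
    -- `carry i` is added to the high digit. Digits, unlike the Chinese remainder theorem, also
    -- split off repeated prime factors.
    aff-combine : ∀ j i → aff (p ℕ.* m) α τ (combine j i) ≡ combine (aff p α (carry i) j) (aff m α τ i)
    aff-combine j i = resid-unique (subst₂ (λ N x → N ∣ (α * x + τ) - + toℕ (combine j′ i′))
      (sym (ℤ.pos-* p m)) (sym (toℤ-combine j i))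
      (subst (λ x → + p * + m ∣ (α * (+ m * + toℕ j + + toℕ i) + τ) - x) (sym (toℤ-combine j′ i′)) divisible))
      where
      j′ : Fin p
      j′ = aff p α (carry i) j
      i′ : Fin m
      i′ = aff m α τ i
      toℤ-combine : ∀ (j : Fin p) (i : Fin m) → + toℕ (combine j i) ≡ + m * + toℕ j + + toℕ i
      toℤ-combine j i = trans (cong +_ (toℕ-combine j i)) (trans (ℤ.pos-+ (m ℕ.* toℕ j) (toℕ i))
        (cong (_+ + toℕ i) (ℤ.pos-* m (toℕ j))))
      divisible : + p * + m ∣ (α * (+ m * + toℕ j + + toℕ i) + τ) - (+ m * + toℕ j′ + + toℕ i′)
      divisible with divides e eq ← resid-∣ p (α * + toℕ j + carry i) = divides (- e) (begin
        (α * (+ m * + toℕ j + + toℕ i) + τ) - (+ m * + toℕ j′ + + toℕ i′)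
          ≡⟨ lem₁ α τ (+ m) (+ toℕ j) (+ toℕ i) (+ toℕ j′) (+ toℕ i′) ⟩
        α * (+ m * + toℕ j) + (α * + toℕ i + τ) - (+ m * + toℕ j′ + + toℕ i′)
          ≡⟨ cong (λ x → α * (+ m * + toℕ j) + x - (+ m * + toℕ j′ + + toℕ i′)) (resid-/ℕ m (α * + toℕ i + τ)) ⟩
        α * (+ m * + toℕ j) + (+ toℕ i′ + carry i * + m) - (+ m * + toℕ j′ + + toℕ i′)
          ≡⟨ lem₂ α (+ m) (+ toℕ j) (+ toℕ j′) (+ toℕ i′) (carry i) ⟩
        - ((+ toℕ j′ - (α * + toℕ j + carry i)) * + m)
          ≡⟨ cong (λ x → - (x * + m)) eq ⟩
        - (e * + p * + m)
          ≡⟨ lem₃ e (+ p) (+ m) ⟩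
        - e * (+ p * + m) ∎)
        where
        open ≡-Reasoning
        lem₁ : ∀ α τ m j i j′ i′ → (α * (m * j + i) + τ) - (m * j′ + i′) ≡ α * (m * j) + (α * i + τ) - (m * j′ + i′)
        lem₁ = solve-∀
        lem₂ : ∀ α m j j′ i′ c → α * (m * j) + (i′ + c * m) - (m * j′ + i′) ≡ - ((j′ - (α * j + c)) * m)
        lem₂ = solve-∀
        lem₃ : ∀ e p m → - (e * p * m) ≡ - e * (p * m)
        lem₃ = solve-∀

    -- Each digit map acts on as many fibres as the other digit has values. Both numbers are odd, so
    -- s and t pass to the product unchanged.
    aff-*-HasSign : Odd p → Odd m → ∀ {s t} → (∀ τ → HasSign (aff p α τ) s) → HasSign (aff m α τ) t →
      HasSign (aff (p ℕ.* m) α τ) (s Sign.* t)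
    aff-*-HasSign (h , refl) (k , refl) {s} {t} hp hm =
      HasSign-transport (λ (j , i) → combine j i) (remQuot {p} m)
        (λ (j , i) → remQuot-combine j i) (combine-remQuot {p} m) (λ (j , i) → aff-combine j i)
        -- The high digit is mapped first, because its carry is computed from the old low digit.
        (HasSign-∘ {f = λ (j , i) → j , aff m α τ i} {g = λ (j , i) → aff p α (carry i) j , i}
          (subst (HasSign _) (^^-odd t h)
            (HasSign-transport swap swap (λ _ → refl) (λ _ → refl) (λ _ → refl)
              (fibrewise-HasSign {A = Fin m} {p} (λ _ → aff m α τ) (λ _ → hm))))
          (subst (HasSign _) (^^-odd s k) (fibrewise-HasSign (λ i → aff p α (carry i)) λ i → hp (carry i))))

  odd∨even : ∀ n → Odd n ⊎ ∃[ h ] n ≡ h ℕ.+ h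
  odd∨even zero    = inj₂ (0 , refl)
  odd∨even (suc n) with odd∨even n
  ... | inj₁ (h , refl) = inj₂ (suc h , cong suc (sym (ℕ.+-suc h h)))
  ... | inj₂ (h , refl) = inj₁ (h , refl)

  ¬odd∧even : ∀ {n} → Odd n → ∀ h → n ≢ h ℕ.+ h
  ¬odd∧even (zero  , refl) (suc h) eq rewrite ℕ.+-suc h h with () ← eq
  ¬odd∧even (suc k , refl) (suc h) eq rewrite ℕ.+-suc h h | ℕ.+-suc k k =
    ¬odd∧even (k , refl) h (ℕ.suc-injective (ℕ.suc-injective eq))

  odd-*⁻ : ∀ m n → Odd (m ℕ.* n) → Odd m × Odd n
  odd-*⁻ m n odd with odd∨even m | odd∨even n
  ... | inj₂ (h , refl) | _ = ⊥-elim (¬odd∧even odd (h ℕ.* n) (ℕ.*-distribʳ-+ n h h))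
  ... | inj₁ _ | inj₂ (h , refl) = ⊥-elim (¬odd∧even odd (m ℕ.* h) (ℕ.*-distribˡ-+ m h h))
  ... | inj₁ m-odd | inj₁ n-odd = m-odd , n-odd

  toℤ-* : ∀ s t → toℤ s * toℤ t ≡ toℤ (s Sign.* t)
  toℤ-* Sign.+ Sign.+ = refl
  toℤ-* Sign.+ Sign.- = refl
  toℤ-* Sign.- Sign.+ = refl
  toℤ-* Sign.- Sign.- = refl

  zolotarev : ∀ {n} .{{_ : NonZero n}} ps → n ≡ product ps → All Prime ps → Odd n →
    ∀ {α} → All (λ p → ¬ (+ p ∣ α)) ps →
    ∃[ s ] foldr _*_ 1ℤ (map (legendre α) ps) ≡ toℤ s × (∀ τ → HasSign (aff n α τ) s)
  zolotarev []       refl _          _   _             = Sign.+ , refl , λ τ → identity λ { zero → resid-unique (∣1 _) }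
    where
    ∣1 : ∀ z → + 1 ∣ z
    ∣1 z = divides z (sym (ℤ.*-identityʳ z))
  zolotarev (p ∷ ps) refl (pr ∷ prs) odd {α} (p∤α ∷ ps∤α) =
    combineFactors (zolotarev-prime pr p-odd p∤α) (zolotarev ps refl prs m-odd ps∤α)
    where
    m = product ps
    instance
      p-nonZero : NonZero p
      p-nonZero = prime⇒nonZero pr
      m-nonZero : NonZero m
      m-nonZero = ℕ.m*n≢0⇒n≢0 p
    p-odd : Odd p
    p-odd = proj₁ (odd-*⁻ p m odd)
    m-odd : Odd m
    m-odd = proj₂ (odd-*⁻ p m odd)
    combineFactors :
      ∃[ s ] legendre α p ≡ toℤ s × (∀ τ → HasSign (aff p α τ) s) →
      ∃[ t ] foldr _*_ 1ℤ (map (legendre α) ps) ≡ toℤ t × (∀ τ → HasSign (aff m α τ) t) →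
      ∃[ s ] legendre α p * foldr _*_ 1ℤ (map (legendre α) ps) ≡ toℤ s × (∀ τ → HasSign (aff (p ℕ.* m) α τ) s)
    combineFactors (s , eq , hp) (t , eq′ , hm) = s Sign.* t , trans (cong₂ _*_ eq eq′) (toℤ-* s t) ,
      λ τ → aff-*-HasSign α τ p-odd m-odd hp (hm τ)

  legendre-product-∣ : ∀ {α p} ps → p ∈ ps → + p ∣ α → foldr _*_ 1ℤ (map (legendre α) ps) ≡ 0ℤ
  legendre-product-∣ {α} (p ∷ ps) (here refl) p∣α = cong (_* foldr _*_ 1ℤ (map (legendre α) ps)) (legendre-∣ p∣α)
  legendre-product-∣ {α} (p ∷ ps) (there p∈) p∣α =
    trans (cong (legendre α p *_) (legendre-product-∣ ps p∈ p∣α)) (ℤ.*-zeroʳ (legendre α p))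

  -- From αx = 1 mod p and αy = 1 mod m follows (1 - αx)(1 - αy) = 0 mod pm.
  ∤⇒invertible-product : ∀ ps → All Prime ps → ∀ {α} → All (λ p → ¬ (+ p ∣ α)) ps → Invertible (product ps) α
  ∤⇒invertible-product [] _ {α} _ = 0ℤ , divides (α * 0ℤ - 1ℤ) (sym (ℤ.*-identityʳ (α * 0ℤ - 1ℤ)))
  ∤⇒invertible-product (p ∷ ps) (pr ∷ prs) {α} (p∤α ∷ ps∤α)
    with x , divides e eq ← ∤⇒invertible pr p∤α
    with y , divides e′ eq′ ← ∤⇒invertible-product ps prs ps∤α
    = x + y - α * x * y , divides (- (e * e′)) (begin
      α * (x + y - α * x * y) - 1ℤ                  ≡⟨ lem₁ α x y ⟩
      - ((α * x - 1ℤ) * (α * y - 1ℤ))               ≡⟨ cong₂ (λ u v → - (u * v)) eq eq′ ⟩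
      - ((e * + p) * (e′ * + product ps))           ≡⟨ lem₂ e (+ p) e′ (+ product ps) ⟩
      - (e * e′) * (+ p * + product ps)             ≡⟨ cong (- (e * e′) *_) (ℤ.pos-* p (product ps)) ⟨
      - (e * e′) * + (p ℕ.* product ps)             ∎)
    where
    open ≡-Reasoning
    lem₁ : ∀ α x y → α * (x + y - α * x * y) - 1ℤ ≡ - ((α * x - 1ℤ) * (α * y - 1ℤ))
    lem₁ = solve-∀
    lem₂ : ∀ e p e′ m → - ((e * p) * (e′ * m)) ≡ - (e * e′) * (p * m)
    lem₂ = solve-∀

-- Ceilings of fractions and integer powers of q

module Powers where
  open Residues
  open import Algebra.Apartness.Bundles using (HeytingField)
  open import Algebra.Bundles using (CommutativeRing)
  open import Data.Integer.Base as ℤ using (ℤ; +_; -[1+_]; 0ℤ; 1ℤ; -1ℤ; _+_; _*_; _-_; -_; _/ℕ_; _%ℕ_)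
  open import Data.Integer.DivMod using (n%ℕd<d; a≡a%ℕn+[a/ℕn]*n; div-pos-is-/ℕ)
  open import Data.Integer.Divisibility.Signed using (_∣_; divides)
  import Data.Integer.GCD as ℤ
  import Data.Integer.Properties as ℤ
  open import Data.Integer.Tactic.RingSolver using (solve-∀)
  open import Data.Nat.Base as ℕ using (ℕ; zero; suc; NonZero)
  import Data.Nat.Properties as ℕ
  open import Data.Fin.Base using (Fin; zero; suc)
  open import Data.Nat.GCD using (gcd; gcd[m,n]≢0)
  open import Data.Product.Base using (proj₂)
  open import Data.Sum.Base using (inj₂)
  open import Data.Rational.Base as ℚ using (ℚ; mkℚ; ceiling; ↥_; ↧ₙ_)
  import Data.Rational.Properties as ℚ
  open import Relation.Binary.PropositionalEquality

  ceiling≡ : ∀ p → ceiling p ≡ - ((- ↥ p) /ℕ ↧ₙ p)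
  ceiling≡ (mkℚ (+ zero)  d _) = cong -_ (div-pos-is-/ℕ 0ℤ (suc d))
  ceiling≡ (mkℚ (+ suc n) d _) = cong -_ (div-pos-is-/ℕ -[1+ n ] (suc d))
  ceiling≡ (mkℚ -[1+ n ]  d _) = cong -_ (div-pos-is-/ℕ (+ suc n) (suc d))

  -- The ceiling is computed from the reduced fraction N / D. Its remainder ρ < D times the gcd g is
  -- a number below n that leads from z up to a multiple of n, as r does; such a number is unique.
  ceiling-unique : ∀ z n .{{_ : NonZero n}} c r → r ℕ.< n → z + + r ≡ c * + n → ceiling (z ℚ./ n) ≡ c
  ceiling-unique z n c r r<n z+r≡cn = trans (ceiling≡ (z ℚ./ n)) (ℤ.*-cancelʳ-≡ c′ c (+ n) (begin
    c′ * + n               ≡⟨ z+ρg≡c′n ⟨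
    z + + (ρ ℕ.* g)        ≡⟨ cong (λ k → z + + k) (small-∣⇒≡ ρg<n r<n (divides (c′ - c) difference)) ⟩
    z + + r                ≡⟨ z+r≡cn ⟩
    c * + n                ∎))
    where
    open ≡-Reasoning
    N : ℤ
    N = ↥ (z ℚ./ n)
    D g ρ : ℕ
    D = ↧ₙ (z ℚ./ n)
    g = gcd ℤ.∣ z ∣ n
    ρ = (- N) %ℕ D
    c′ : ℤ
    c′ = - ((- N) /ℕ D)
    z≡ : N * + g ≡ z
    z≡ = ℚ.↥-/ z n
    n≡ : D ℕ.* g ≡ n
    n≡ = ℤ.+-injective (trans (ℤ.pos-* D g) (ℚ.↧-/ z n))
    instance
      g-nonZero : NonZero g
      g-nonZero = ℕ.≢-nonZero (gcd[m,n]≢0 ℤ.∣ z ∣ n (inj₂ (ℕ.≢-nonZero⁻¹ n)))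
    ρg<n : ρ ℕ.* g ℕ.< n
    ρg<n = subst (ρ ℕ.* g ℕ.<_) n≡ (ℕ.*-monoˡ-< g (n%ℕd<d (- N) D))
    z+ρg≡c′n : z + + (ρ ℕ.* g) ≡ c′ * + n
    z+ρg≡c′n = begin
      z + + (ρ ℕ.* g)                                         ≡⟨ cong₂ _+_ (sym z≡) (ℤ.pos-* ρ g) ⟩
      N * + g + + ρ * + g                                     ≡⟨ lem₁ N (+ g) (+ ρ) ⟩
      (+ ρ - (- N)) * + g
        ≡⟨ cong (λ x → (+ ρ - x) * + g) (a≡a%ℕn+[a/ℕn]*n (- N) D) ⟩
      (+ ρ - (+ ρ + (- N) /ℕ D * + D)) * + g                  ≡⟨ lem₂ (+ ρ) ((- N) /ℕ D) (+ D) (+ g) ⟩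
      c′ * (+ D * + g)                                        ≡⟨ cong (c′ *_) (ℤ.pos-* D g) ⟨
      c′ * + (D ℕ.* g)                                        ≡⟨ cong (λ k → c′ * + k) n≡ ⟩
      c′ * + n                                                ∎
      where
      lem₁ : ∀ N g ρ → N * g + ρ * g ≡ (ρ - (- N)) * g
      lem₁ = solve-∀
      lem₂ : ∀ ρ f D g → (ρ - (ρ + f * D)) * g ≡ (- f) * (D * g)
      lem₂ = solve-∀
    difference : + (ρ ℕ.* g) - + r ≡ (c′ - c) * + n
    difference = begin
      + (ρ ℕ.* g) - + r                      ≡⟨ lem₁ z (+ (ρ ℕ.* g)) (+ r) ⟩
      (z + + (ρ ℕ.* g)) - (z + + r)          ≡⟨ cong₂ _-_ z+ρg≡c′n z+r≡cn ⟩
      c′ * + n - c * + n                     ≡⟨ lem₂ c′ c (+ n) ⟩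
      (c′ - c) * + n                         ∎
      where
      lem₁ : ∀ z x r → x - r ≡ (z + x) - (z + r)
      lem₁ = solve-∀
      lem₂ : ∀ c′ c n → c′ * n - c * n ≡ (c′ - c) * n
      lem₂ = solve-∀

  module Zpow {c ℓ₁ ℓ₂} (F : HeytingField c ℓ₁ ℓ₂) (q : HeytingField.Carrier F)
              (q#0 : HeytingField._#_ F q (HeytingField.0# F)) where
    private
      R = fieldRing F
      pow = zpow F q q#0
      q⁻¹ = recipDiff F q (HeytingField.0# F) q#0
    module R = CommutativeRing R
    open CommutativeRing R using (_≈_; 1#) renaming (_*_ to _·_)
    open RingSolver R using (solve; _:=_; _:+_; _:*_; _:-_; :-_; 𝟘; 𝟙)
    open import Relation.Binary.Reasoning.Setoid R.setoid
    import Algebra.Properties.CommutativeMonoid.Sum as Sum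
    open Sum R.*-commutativeMonoid using () renaming (sum to prod)
    open Sum ℤ.+-0-commutativeMonoid using () renaming (sum to sumℤ)

    -- The inverse stems from the apartness of q and 0 and thus belongs to the difference q - 0.
    q·q⁻¹≈1 : q · q⁻¹ ≈ 1#
    q·q⁻¹≈1 = R.trans (R.*-congʳ (solve 1 (λ q → q := q :- 𝟘) R.refl q))
      (proj₂ (proj₂ (HeytingField.#⇒invertible F q#0)))

    zpow-suc : ∀ z → pow (1ℤ + z) ≈ q · pow z
    zpow-suc (+ m)          = R.refl
    zpow-suc -[1+ zero ]    = R.sym (R.trans (R.*-congˡ (R.*-identityʳ _)) q·q⁻¹≈1)
    zpow-suc -[1+ suc m ]   = begin
      pow -[1+ m ]               ≈⟨ R.*-identityˡ _ ⟨
      1# · pow -[1+ m ]          ≈⟨ R.*-congʳ q·q⁻¹≈1 ⟨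
      q · q⁻¹ · pow -[1+ m ]     ≈⟨ R.*-assoc _ _ _ ⟩
      q · pow -[1+ suc m ]       ∎

    zpow-pred : ∀ z → pow (-1ℤ + z) ≈ q⁻¹ · pow z
    zpow-pred z = begin
      pow (-1ℤ + z)                    ≈⟨ R.*-identityˡ _ ⟨
      1# · pow (-1ℤ + z)               ≈⟨ R.*-congʳ (R.trans (R.*-comm _ _) q·q⁻¹≈1) ⟨
      q⁻¹ · q · pow (-1ℤ + z)          ≈⟨ R.*-assoc _ _ _ ⟩
      q⁻¹ · (q · pow (-1ℤ + z))        ≈⟨ R.*-congˡ (zpow-suc (-1ℤ + z)) ⟨
      q⁻¹ · pow (1ℤ + (-1ℤ + z))       ≡⟨ cong (λ y → q⁻¹ · pow y) (lem z) ⟩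
      q⁻¹ · pow z                      ∎
      where
      lem : ∀ z → 1ℤ + (-1ℤ + z) ≡ z
      lem = solve-∀

    zpow-+ : ∀ y z → pow (y + z) ≈ pow y · pow z
    zpow-+ (+ zero) z = begin
      pow (0ℤ + z)      ≡⟨ cong pow (ℤ.+-identityˡ z) ⟩
      pow z             ≈⟨ R.*-identityˡ _ ⟨
      1# · pow z        ∎
    zpow-+ (+ suc m) z = begin
      pow (+ suc m + z)             ≡⟨ cong pow (ℤ.+-assoc 1ℤ (+ m) z) ⟩
      pow (1ℤ + (+ m + z))          ≈⟨ zpow-suc (+ m + z) ⟩
      q · pow (+ m + z)             ≈⟨ R.*-congˡ (zpow-+ (+ m) z) ⟩
      q · (pow (+ m) · pow z)       ≈⟨ R.*-assoc _ _ _ ⟨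
      pow (+ suc m) · pow z         ∎
    zpow-+ -[1+ zero ] z = R.trans (zpow-pred z) (R.*-congʳ (R.sym (R.*-identityʳ _)))
    zpow-+ -[1+ suc m ] z = begin
      pow (-[1+ suc m ] + z)          ≡⟨ cong pow (ℤ.+-assoc -1ℤ -[1+ m ] z) ⟩
      pow (-1ℤ + (-[1+ m ] + z))      ≈⟨ zpow-pred (-[1+ m ] + z) ⟩
      q⁻¹ · pow (-[1+ m ] + z)        ≈⟨ R.*-congˡ (zpow-+ -[1+ m ] z) ⟩
      q⁻¹ · (pow -[1+ m ] · pow z)    ≈⟨ R.*-assoc _ _ _ ⟨
      pow -[1+ suc m ] · pow z        ∎

    zpow-sum : ∀ {n} (f : Fin n → ℤ) → pow (sumℤ f) ≈ prod (λ k → pow (f k))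
    zpow-sum {zero}  f = R.refl
    zpow-sum {suc n} f = R.trans (zpow-+ (f zero) _) (R.*-congˡ (zpow-sum λ k → f (suc k)))

-- Residues and quotients of the matrix indices, and the exponents of q

module Arithmetic where
  open Powers
  open Residues
  open import Algebra.Bundles using (CommutativeMonoid; CommutativeRing)
  import Algebra.Properties.CommutativeMonoid.Sum as Sum
  import Algebra.Properties.Semiring.Sum as SemiringSum
  open import Data.Empty using (⊥-elim)
  open import Data.Fin.Base using (Fin; zero; suc; toℕ; fromℕ; inject₁)
  open import Data.Fin.Permutation using (Permutation; permutation)
  open import Data.Fin.Properties using (toℕ-injective; toℕ<n; toℕ-fromℕ; toℕ-inject₁)
  open import Data.Integer.Base as ℤ using (ℤ; +_; -[1+_]; 0ℤ; 1ℤ; -1ℤ; _+_; _*_; _-_; -_; _/ℕ_)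
  open import Data.Integer.Divisibility.Signed using (_∣_; divides)
  import Data.Integer.Properties as ℤ
  open import Data.Integer.Tactic.RingSolver using (solve-∀)
  open import Data.Nat.Base as ℕ using (ℕ; zero; suc; NonZero)
  import Data.Nat.Properties as ℕ
  open import Data.Product.Base using (_,_; proj₁; proj₂)
  open import Data.Rational.Base as ℚ using (ceiling)
  open import Function.Base using (_∘_)
  open import Relation.Binary.Definitions using (tri<; tri≈; tri>)
  open import Relation.Binary.PropositionalEquality
  open import Relation.Nullary.Decidable using (yes; no)
  open import Relation.Nullary.Negation using (¬_)

  pos-∸ : ∀ {m n} → n ℕ.≤ m → + (m ℕ.∸ n) ≡ + m - + n
  pos-∸ {m} {n} n≤m = sym (trans (ℤ.m-n≡m⊖n m n) (ℤ.⊖-≥ n≤m))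

  affPermutation : ∀ {n} .{{_ : NonZero n}} α τ → Invertible n α → Permutation n n
  affPermutation {n} α τ (β , n∣αβ-1) = permutation (aff n α τ) (aff n β (- (β * τ)))
    (aff-inverse α τ β (- (β * τ)) n∣αβ-1 (∣-multiple (- τ) n∣αβ-1 (lem₁ α β τ)))
    (aff-inverse β (- (β * τ)) α τ (subst (λ x → + n ∣ x - 1ℤ) (ℤ.*-comm α β) n∣αβ-1) (divides 0ℤ (lem₂ β τ)))
    where
    lem₁ : ∀ α β τ → (α * - (β * τ) + τ) - 0ℤ ≡ (- τ) * (α * β - 1ℤ)
    lem₁ = solve-∀
    lem₂ : ∀ β τ → (β * τ + - (β * τ)) - 0ℤ ≡ 0ℤ
    lem₂ = solve-∀

  module _ {c ℓ} (M : CommutativeMonoid c ℓ) where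
    open CommutativeMonoid M using (_≈_; Carrier)
    open Sum M using (sum; sum-permute)

    sum-aff : ∀ {n} .{{_ : NonZero n}} α τ → Invertible n α → ∀ (f : Fin n → Carrier) → sum f ≈ sum (f ∘ aff n α τ)
    sum-aff α τ inv f = sum-permute f (affPermutation α τ inv)

  jump : ℕ → ℕ → ℤ
  jump r s with s ℕ.<? r
  ... | yes _ = 1ℤ
  ... | no  _ = 0ℤ

  jump-< : ∀ {r s} → s ℕ.< r → jump r s ≡ 1ℤ
  jump-< {r} {s} s<r with s ℕ.<? r
  ... | yes _   = refl
  ... | no  s≮r = ⊥-elim (s≮r s<r)

  jump-≮ : ∀ {r s} → ¬ (s ℕ.< r) → jump r s ≡ 0ℤ
  jump-≮ {r} {s} s≮r with s ℕ.<? r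
  ... | yes s<r = ⊥-elim (s≮r s<r)
  ... | no  _   = refl

  module _ {n′ : ℕ} where

    cyclicPred : Fin (suc n′) → Fin (suc n′)
    cyclicPred zero    = fromℕ n′
    cyclicPred (suc i) = inject₁ i

    -- The borrow that occurs when residue 0 steps back to n - 1. As an exponent of q it is also the
    -- weight of the last column in the difference that closes the cycle.
    wrap : Fin (suc n′) → ℤ
    wrap zero    = 1ℤ
    wrap (suc i) = 0ℤ

    cyclicPred-wrap : ∀ i → + toℕ (cyclicPred i) ≡ + toℕ i - 1ℤ + wrap i * + suc n′
    cyclicPred-wrap zero    = trans (cong +_ (toℕ-fromℕ n′)) (lem (+ n′))
      where
      lem : ∀ n → n ≡ 0ℤ - 1ℤ + 1ℤ * (1ℤ + n)
      lem = solve-∀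
    cyclicPred-wrap (suc i) = trans (cong +_ (toℕ-inject₁ i)) (lem (+ toℕ i) (+ suc n′))
      where
      lem : ∀ i n → i ≡ (1ℤ + i) - 1ℤ + 0ℤ * n
      lem = solve-∀

    -- Stepping i back changes [r > i] only for i = r. At i = 0 the step to the largest index
    -- switches the bracket off for every r > 0, and `wrap` restores it.
    jump-cyclicPred : ∀ {r i : Fin (suc n′)} → r ≢ i → wrap i + jump (toℕ r) (toℕ (cyclicPred i)) ≡ jump (toℕ r) (toℕ i)
    jump-cyclicPred {zero}  {zero} r≢i = ⊥-elim (r≢i refl)
    jump-cyclicPred {suc r} {zero} r≢i = trans (cong (λ z → 1ℤ + z) (jump-≮ {suc (toℕ r)} {toℕ (fromℕ n′)} λ n′<r →
        ℕ.<⇒≱ (subst (ℕ._< suc (toℕ r)) (toℕ-fromℕ n′) n′<r) (toℕ<n r)))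
      (sym (jump-< {suc (toℕ r)} {0} (ℕ.s≤s ℕ.z≤n)))
    jump-cyclicPred {r} {suc i} r≢i rewrite toℕ-inject₁ i with ℕ.<-cmp (toℕ i) (toℕ r)
    ... | tri< i<r _ _ = trans (ℤ.+-identityˡ _) (trans (jump-< i<r) (sym (jump-< (ℕ.≤∧≢⇒< i<r (r≢i ∘ sym ∘ toℕ-injective)))))
    ... | tri≈ i≮r _ _ = trans (ℤ.+-identityˡ _) (trans (jump-≮ i≮r) (sym (jump-≮ (i≮r ∘ ℕ.<-trans (ℕ.n<1+n _)))))
    ... | tri> i≮r _ _ = trans (ℤ.+-identityˡ _) (trans (jump-≮ i≮r) (sym (jump-≮ (i≮r ∘ ℕ.<-trans (ℕ.n<1+n _)))))

    jump-cyclicPred-diagonal : ∀ (i : Fin (suc n′)) → wrap i + jump (toℕ i) (toℕ (cyclicPred i)) ≡ 1ℤ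
    jump-cyclicPred-diagonal zero    = cong (λ z → 1ℤ + z) (jump-≮ {0} {toℕ (fromℕ n′)} λ ())
    jump-cyclicPred-diagonal (suc i) rewrite toℕ-inject₁ i = trans (ℤ.+-identityˡ _) (jump-< (ℕ.n<1+n (toℕ i)))

  open SemiringSum (CommutativeRing.semiring ℤ.+-*-commutativeRing)
    using (*-distribˡ-sum; *-distribʳ-sum; ∑-distrib-+) renaming (sum to sumℤ; sum-cong-≗ to sumℤ-cong)

  -- The offset c carries the induction, since removing the first term shifts the others; doubling
  -- avoids a division.
  gauss : ∀ m c → + 2 * sumℤ {m} (λ k → c + + toℕ k) ≡ + m * (+ 2 * c + + m - 1ℤ)
  gauss zero    c = refl
  gauss (suc m) c = begin
    + 2 * (c + 0ℤ + sumℤ {m} (λ k → c + + suc (toℕ k)))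
      ≡⟨ cong (λ x → + 2 * (c + 0ℤ + x)) (sumℤ-cong {m} λ k → sym (ℤ.+-assoc c 1ℤ (+ toℕ k))) ⟩
    + 2 * (c + 0ℤ + sumℤ {m} (λ k → (c + 1ℤ) + + toℕ k))
      ≡⟨ ℤ.*-distribˡ-+ (+ 2) (c + 0ℤ) (sumℤ {m} λ k → (c + 1ℤ) + + toℕ k) ⟩
    + 2 * (c + 0ℤ) + + 2 * sumℤ {m} (λ k → (c + 1ℤ) + + toℕ k)
      ≡⟨ cong (λ x → + 2 * (c + 0ℤ) + x) (gauss m (c + 1ℤ)) ⟩
    + 2 * (c + 0ℤ) + + m * (+ 2 * (c + 1ℤ) + + m - 1ℤ)
      ≡⟨ lem c (+ m) ⟩
    (1ℤ + + m) * (+ 2 * c + (1ℤ + + m) - 1ℤ) ∎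
    where
    open ≡-Reasoning
    lem : ∀ c m → + 2 * (c + 0ℤ) + m * (+ 2 * (c + 1ℤ) + m - 1ℤ) ≡ (1ℤ + m) * (+ 2 * c + (1ℤ + m) - 1ℤ)
    lem = solve-∀

  module Exponents (a : ℤ) (n′ : ℕ) where

    n : ℕ
    n = suc n′

    b : ℤ
    b = a + 1ℤ

    -- Matrix indices start at 1 and `Fin` at 0, so multiplying the index by b is the affine map
    -- with translation b.
    rowResidue colResidue : Fin n → Fin n
    rowResidue = aff n b b
    colResidue = aff n a a

    rowQuotient colQuotient : Fin n → ℤ
    rowQuotient j = (b * + toℕ j + b) /ℕ n
    colQuotient k = (a * + toℕ k + a) /ℕ n

    row-division : ∀ j → b * + suc (toℕ j) ≡ + toℕ (rowResidue j) + rowQuotient j * + n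
    row-division j = trans (lem b (+ toℕ j)) (resid-/ℕ n (b * + toℕ j + b))
      where
      lem : ∀ b j → b * (1ℤ + j) ≡ b * j + b
      lem = solve-∀

    col-division : ∀ k → a * + suc (toℕ k) ≡ + toℕ (colResidue k) + colQuotient k * + n
    col-division k = trans (lem a (+ toℕ k)) (resid-/ℕ n (a * + toℕ k + a))
      where
      lem : ∀ b j → b * (1ℤ + j) ≡ b * j + b
      lem = solve-∀

    -- Since |r_j - s_k| < n, the fraction (r_j - s_k) / n has ceiling 1 or 0 according to the
    -- comparison.
    exponent : ∀ j k → ceiling ((b * + suc (toℕ j) - a * + suc (toℕ k)) ℚ./ n) ≡
      (rowQuotient j - colQuotient k) + jump (toℕ (rowResidue j)) (toℕ (colResidue k))
    exponent j k with toℕ (colResidue k) ℕ.<? toℕ (rowResidue j)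
    -- The distance from the numerator up to the next multiple of n is s + n - r here and s - r in
    -- the other case.
    ... | yes s<r = ceiling-unique (b * + suc (toℕ j) - a * + suc (toℕ k)) n _ ((s ℕ.+ n) ℕ.∸ r)
        (ℕ.+-cancelˡ-< r _ _ (subst (ℕ._< r ℕ.+ n)
        (sym (ℕ.m+[n∸m]≡n r≤s+n)) (ℕ.+-monoˡ-< n s<r))) (begin
      (b * + suc (toℕ j) - a * + suc (toℕ k)) + + ((s ℕ.+ n) ℕ.∸ r)
        ≡⟨ cong₂ _+_ (cong₂ _-_ (row-division j) (col-division k)) (pos-∸ r≤s+n) ⟩
      ((+ r + rowQuotient j * + n) - (+ s + colQuotient k * + n)) + ((+ s + + n) - + r)
        ≡⟨ lem (+ r) (+ s) (rowQuotient j) (colQuotient k) (+ n) ⟩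
      ((rowQuotient j - colQuotient k) + 1ℤ) * + n ∎)
      where
      open ≡-Reasoning
      r = toℕ (rowResidue j)
      s = toℕ (colResidue k)
      r≤s+n : r ℕ.≤ s ℕ.+ n
      r≤s+n = ℕ.≤-trans (ℕ.<⇒≤ (toℕ<n (rowResidue j))) (ℕ.m≤n+m n s)
      lem : ∀ r s u v n → ((r + u * n) - (s + v * n)) + ((s + n) - r) ≡ ((u - v) + 1ℤ) * n
      lem = solve-∀
    ... | no s≮r = ceiling-unique (b * + suc (toℕ j) - a * + suc (toℕ k)) n _ (s ℕ.∸ r)
        (ℕ.≤-<-trans (ℕ.m∸n≤m s r) (toℕ<n (colResidue k))) (begin
      (b * + suc (toℕ j) - a * + suc (toℕ k)) + + (s ℕ.∸ r)
        ≡⟨ cong₂ _+_ (cong₂ _-_ (row-division j) (col-division k)) (pos-∸ (ℕ.≮⇒≥ s≮r)) ⟩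
      ((+ r + rowQuotient j * + n) - (+ s + colQuotient k * + n)) + (+ s - + r)
        ≡⟨ lem (+ r) (+ s) (rowQuotient j) (colQuotient k) (+ n) ⟩
      ((rowQuotient j - colQuotient k) + 0ℤ) * + n ∎)
      where
      open ≡-Reasoning
      r = toℕ (rowResidue j)
      s = toℕ (colResidue k)
      lem : ∀ r s u v n → ((r + u * n) - (s + v * n)) + (s - r) ≡ ((u - v) + 0ℤ) * n
      lem = solve-∀

  -- Away from the residue 0, stepping back involves no borrow.
  resid-pred : ∀ {n} .{{_ : NonZero n}} z → ¬ (+ n ∣ z) → + toℕ (resid n z) ≡ 1ℤ + + toℕ (resid n (z - 1ℤ))
  resid-pred {n} z n∤z = cong +_ (go (toℕ (resid n z)) refl)
    where
    go : ∀ k → toℕ (resid n z) ≡ k → k ≡ suc (toℕ (resid n (z - 1ℤ)))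
    go zero    eq = ⊥-elim (n∤z (∣-multiple -1ℤ (subst (λ k → + n ∣ + k - z) eq (resid-∣ n z)) (lem z)))
      where
      lem : ∀ z → z ≡ -1ℤ * (0ℤ - z)
      lem = solve-∀
    go (suc k) eq = cong suc (small-∣⇒≡ (ℕ.<-trans (ℕ.n<1+n k) (subst (ℕ._< n) eq (toℕ<n (resid n z))))
      (toℕ<n (resid n (z - 1ℤ)))
      (∣-combination 1ℤ -1ℤ (subst (λ k → + n ∣ + k - z) eq (resid-∣ n z)) (resid-∣ n (z - 1ℤ))
        (lem (+ k) z (+ toℕ (resid n (z - 1ℤ))))))
      where
      lem : ∀ k z r → k - r ≡ 1ℤ * ((1ℤ + k) - z) + -1ℤ * (r - (z - 1ℤ))
      lem = solve-∀

  module Coprime (a : ℤ) (n′ : ℕ)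
    (a-invertible : Invertible (suc n′) a) (b-invertible : Invertible (suc n′) (a + 1ℤ)) where
    open Exponents a n′ public

    a⁻¹ b⁻¹ : ℤ
    a⁻¹ = proj₁ a-invertible
    b⁻¹ = proj₁ b-invertible

    n∣aa⁻¹-1 : + n ∣ a * a⁻¹ - 1ℤ
    n∣aa⁻¹-1 = proj₂ a-invertible

    n∣bb⁻¹-1 : + n ∣ b * b⁻¹ - 1ℤ
    n∣bb⁻¹-1 = proj₂ b-invertible

    -- The row with residue i has the index b⁻¹ i counted from 1; the translation -1 counts it from
    -- 0.
    rowResidue⁻¹ : Fin n → Fin n
    rowResidue⁻¹ = aff n b⁻¹ -1ℤ

    rowResidue-rowResidue⁻¹ : ∀ i → rowResidue (rowResidue⁻¹ i) ≡ i
    rowResidue-rowResidue⁻¹ = aff-inverse b b b⁻¹ -1ℤ n∣bb⁻¹-1 (divides 0ℤ (lem b))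
      where
      lem : ∀ b → (b * -1ℤ + b) - 0ℤ ≡ 0ℤ
      lem = solve-∀

    rowResidue⁻¹-rowResidue : ∀ i → rowResidue⁻¹ (rowResidue i) ≡ i
    rowResidue⁻¹-rowResidue = aff-inverse b⁻¹ -1ℤ b b n∣b⁻¹b-1 (∣-multiple 1ℤ n∣b⁻¹b-1 (lem b b⁻¹))
      where
      n∣b⁻¹b-1 : + n ∣ b⁻¹ * b - 1ℤ
      n∣b⁻¹b-1 = subst (λ z → + n ∣ z - 1ℤ) (ℤ.*-comm b b⁻¹) n∣bb⁻¹-1
      lem : ∀ b c → (c * b + -1ℤ) - 0ℤ ≡ 1ℤ * (c * b - 1ℤ)
      lem = solve-∀

    rowResidue-injective : ∀ {i j} → rowResidue i ≡ rowResidue j → i ≡ j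
    rowResidue-injective {i} {j} eq = trans (sym (rowResidue⁻¹-rowResidue i))
      (trans (cong rowResidue⁻¹ eq) (rowResidue⁻¹-rowResidue j))

    previous : Fin n → Fin n
    previous k = rowResidue⁻¹ (cyclicPred (rowResidue k))

    -- On indices counted from 1 this is multiplication by a⁻¹ b.
    match : Fin n → Fin n
    match = aff n (a⁻¹ * b) (a⁻¹ * b - 1ℤ)

    match-invertible : Invertible n (a⁻¹ * b)
    match-invertible = a * b⁻¹ , ∣-combination (b * b⁻¹) 1ℤ n∣aa⁻¹-1 n∣bb⁻¹-1 (lem a a⁻¹ b b⁻¹)
      where
      lem : ∀ a a′ b b′ → (a′ * b) * (a * b′) - 1ℤ ≡ (b * b′) * (a * a′ - 1ℤ) + 1ℤ * (b * b′ - 1ℤ)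
      lem = solve-∀

    colResidue-match : ∀ k → colResidue (match k) ≡ rowResidue k
    colResidue-match = aff-∘ a a (a⁻¹ * b) (a⁻¹ * b - 1ℤ) b b
      (∣-multiple b n∣aa⁻¹-1 (lem₁ a a⁻¹ b)) (∣-multiple b n∣aa⁻¹-1 (lem₂ a a⁻¹ b))
      where
      lem₁ : ∀ a a′ b → a * (a′ * b) - b ≡ b * (a * a′ - 1ℤ)
      lem₁ = solve-∀
      lem₂ : ∀ a a′ b → (a * (a′ * b - 1ℤ) + a) - b ≡ b * (a * a′ - 1ℤ)
      lem₂ = solve-∀

    -- The exponents of the two sums in the rank one update.  Reindexed by m, with
    -- rows a m and columns (a + 1) m modulo n, they agree except at m = 0.
    e f : Fin n → ℤ
    e k = colQuotient (match k) - rowQuotient k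
    f k = (wrap (rowResidue k) + colQuotient (match (previous k))) - rowQuotient k

    -- Row k and its matched column have the same residue, which cancels and leaves an exact
    -- multiple of n.
    e-division : ∀ k → e k * + n ≡ a * + suc (toℕ (match k)) - b * + suc (toℕ k)
    e-division k = begin
      (cq - rq) * + n                                     ≡⟨ lem cq rq (+ n) (+ toℕ (rowResidue k)) ⟩
      (+ toℕ (rowResidue k) + cq * + n) - (+ toℕ (rowResidue k) + rq * + n)
        ≡⟨ cong₂ (λ x y → (+ toℕ x + cq * + n) - y) (colResidue-match k) (row-division k) ⟨
      (+ toℕ (colResidue (match k)) + cq * + n) - b * + suc (toℕ k)
        ≡⟨ cong (_- b * + suc (toℕ k)) (col-division (match k)) ⟨
      a * + suc (toℕ (match k)) - b * + suc (toℕ k)       ∎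
      where
      open ≡-Reasoning
      cq = colQuotient (match k)
      rq = rowQuotient k
      lem : ∀ c r n x → (c - r) * n ≡ (x + c * n) - (x + r * n)
      lem = solve-∀

    -- The previous column has residue one less. The borrow of n at residue 0 is absorbed by `wrap`,
    -- and the difference 1 remains.
    f-division : ∀ k → f k * + n ≡ a * + suc (toℕ (match (previous k))) - b * + suc (toℕ k) + 1ℤ
    f-division k = begin
      ((wrap i + cq) - rq) * + n
        ≡⟨ lem (wrap i) cq rq (+ n) (+ toℕ i) ⟩
      ((+ toℕ i - 1ℤ + wrap i * + n) + cq * + n) - (+ toℕ i + rq * + n) + 1ℤ
        ≡⟨ cong₂ (λ x y → (x + cq * + n) - y + 1ℤ) (sym (cyclicPred-wrap i)) (sym (row-division k)) ⟩
      (+ toℕ (cyclicPred i) + cq * + n) - b * + suc (toℕ k) + 1ℤ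
        ≡⟨ cong (λ x → (+ toℕ x + cq * + n) - b * + suc (toℕ k) + 1ℤ)
             (trans (colResidue-match (rowResidue⁻¹ (cyclicPred i))) (rowResidue-rowResidue⁻¹ (cyclicPred i))) ⟨
      (+ toℕ (colResidue l) + cq * + n) - b * + suc (toℕ k) + 1ℤ
        ≡⟨ cong (λ x → x - b * + suc (toℕ k) + 1ℤ) (col-division l) ⟨
      a * + suc (toℕ l) - b * + suc (toℕ k) + 1ℤ ∎
      where
      open ≡-Reasoning
      i = rowResidue k
      l = match (rowResidue⁻¹ (cyclicPred i))
      cq = colQuotient l
      rq = rowQuotient k
      lem : ∀ w c r n i → ((w + c) - r) * n ≡ ((i - 1ℤ + w * n) + c * n) - (i + r * n) + 1ℤ
      lem = solve-∀

    match-e : ∀ m → match (aff n a -1ℤ m) ≡ aff n b -1ℤ m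
    match-e = aff-∘ (a⁻¹ * b) (a⁻¹ * b - 1ℤ) a -1ℤ b -1ℤ
      (∣-multiple b n∣aa⁻¹-1 (lem₁ a a⁻¹ b)) (divides 0ℤ (lem₂ (a⁻¹ * b)))
      where
      lem₁ : ∀ a a′ b → (a′ * b) * a - b ≡ b * (a * a′ - 1ℤ)
      lem₁ = solve-∀
      lem₂ : ∀ c → (c * -1ℤ + (c - 1ℤ)) - -1ℤ ≡ 0ℤ
      lem₂ = solve-∀

    match-f : ∀ m → match (previous (aff n a 0ℤ m)) ≡ aff n b 0ℤ m
    match-f m = begin
      match (rowResidue⁻¹ (cyclicPred (rowResidue k)))
        ≡⟨ cong (match ∘ rowResidue⁻¹) (pred-aff (rowResidue k)) ⟩
      match (rowResidue⁻¹ (aff n 1ℤ -1ℤ (aff n b b k)))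
        -- Here b - 1 = a enters: stepping back from b k + b gives b k + a, and the later factor a⁻¹
        -- b b⁻¹ turns this a into 1.
        ≡⟨ cong (match ∘ rowResidue⁻¹) (aff-∘ 1ℤ -1ℤ b b b a (divides 0ℤ (lem₁ b)) (divides 0ℤ (lem₂ a)) k) ⟩
      match (rowResidue⁻¹ (aff n b a k))
        ≡⟨ cong match (aff-∘ b⁻¹ -1ℤ b a 1ℤ (b⁻¹ * a - 1ℤ)
             (subst (λ z → + n ∣ z - 1ℤ) (ℤ.*-comm b b⁻¹) n∣bb⁻¹-1) (divides 0ℤ (lem₃ (b⁻¹ * a))) k) ⟩
      match (aff n 1ℤ (b⁻¹ * a - 1ℤ) (aff n a 0ℤ m))
        ≡⟨ cong match (aff-∘ 1ℤ (b⁻¹ * a - 1ℤ) a 0ℤ a (b⁻¹ * a - 1ℤ)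
             (divides 0ℤ (lem₁ a)) (divides 0ℤ (lem₄ (b⁻¹ * a - 1ℤ))) m) ⟩
      match (aff n a (b⁻¹ * a - 1ℤ) m)
        ≡⟨ aff-∘ (a⁻¹ * b) (a⁻¹ * b - 1ℤ) a (b⁻¹ * a - 1ℤ) b 0ℤ
             (∣-multiple b n∣aa⁻¹-1 (lem₅ a a⁻¹ b)) (∣-combination (b * b⁻¹) 1ℤ n∣aa⁻¹-1 n∣bb⁻¹-1 (lem₆ a a⁻¹ b b⁻¹)) m ⟩
      aff n b 0ℤ m ∎
      where
      open ≡-Reasoning
      k = aff n a 0ℤ m
      pred-aff : ∀ i → cyclicPred i ≡ aff n 1ℤ -1ℤ i
      pred-aff i = sym (resid-unique (divides (- wrap i) (trans (cong (λ x → (1ℤ * + toℕ i + -1ℤ) - x) (cyclicPred-wrap i))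
        (lem (+ toℕ i) (wrap i) (+ n)))))
        where
        lem : ∀ i w n → (1ℤ * i + -1ℤ) - (i - 1ℤ + w * n) ≡ - w * n
        lem = solve-∀
      lem₁ : ∀ b → 1ℤ * b - b ≡ 0ℤ
      lem₁ = solve-∀
      lem₂ : ∀ a → (1ℤ * (a + 1ℤ) + -1ℤ) - a ≡ 0ℤ
      lem₂ = solve-∀
      lem₃ : ∀ c → (c + -1ℤ) - (c - 1ℤ) ≡ 0ℤ
      lem₃ = solve-∀
      lem₄ : ∀ c → (1ℤ * 0ℤ + c) - c ≡ 0ℤ
      lem₄ = solve-∀
      lem₅ : ∀ a a′ b → (a′ * b) * a - b ≡ b * (a * a′ - 1ℤ)
      lem₅ = solve-∀
      lem₆ : ∀ a a′ b b′ → ((a′ * b) * (b′ * a - 1ℤ) + (a′ * b - 1ℤ)) - 0ℤ ≡ (b * b′) * (a * a′ - 1ℤ) + 1ℤ * (b * b′ - 1ℤ)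
      lem₆ = solve-∀

    -- The left exponent uses the representatives of a m and b m in 1, ..., n, the right one those
    -- in 0, ..., n - 1. For indices other than 0 neither residue vanishes, so the representatives
    -- agree, and the offsets on the right cancel by a - b + 1 = 0.
    e≡f : ∀ m → e (aff n a -1ℤ (suc m)) ≡ f (aff n a 0ℤ (suc m))
    e≡f m = ℤ.*-cancelʳ-≡ _ _ (+ n) (begin
      e (aff n a -1ℤ (suc m)) * + n                       ≡⟨ e-division (aff n a -1ℤ (suc m)) ⟩
      a * + suc (toℕ (match (aff n a -1ℤ (suc m)))) - b * + suc (toℕ (aff n a -1ℤ (suc m)))
        ≡⟨ cong (λ x → a * + suc (toℕ x) - b * + suc (toℕ (aff n a -1ℤ (suc m)))) (match-e (suc m)) ⟩
      a * + suc (toℕ (aff n b -1ℤ (suc m))) - b * + suc (toℕ (aff n a -1ℤ (suc m)))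
        ≡⟨ cong₂ (λ x y → a * x - b * y) (shift b b-invertible) (shift a a-invertible) ⟨
      a * + toℕ (aff n b 0ℤ (suc m)) - b * + toℕ (aff n a 0ℤ (suc m))
        ≡⟨ lem a (+ toℕ (aff n b 0ℤ (suc m))) (+ toℕ (aff n a 0ℤ (suc m))) ⟩
      a * + suc (toℕ (aff n b 0ℤ (suc m))) - b * + suc (toℕ (aff n a 0ℤ (suc m))) + 1ℤ
        ≡⟨ cong (λ x → a * + suc (toℕ x) - b * + suc (toℕ (aff n a 0ℤ (suc m))) + 1ℤ) (match-f (suc m)) ⟨
      a * + suc (toℕ (match (previous (aff n a 0ℤ (suc m))))) - b * + suc (toℕ (aff n a 0ℤ (suc m))) + 1ℤ
        ≡⟨ f-division (aff n a 0ℤ (suc m)) ⟨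
      f (aff n a 0ℤ (suc m)) * + n ∎)
      where
      open ≡-Reasoning
      lem : ∀ a x y → a * x - (a + 1ℤ) * y ≡ a * (1ℤ + x) - (a + 1ℤ) * (1ℤ + y) + 1ℤ
      lem = solve-∀
      shift : ∀ c → Invertible n c → + toℕ (aff n c 0ℤ (suc m)) ≡ + suc (toℕ (aff n c -1ℤ (suc m)))
      shift c (d , n∣cd-1) = trans (resid-pred (c * + suc (toℕ m) + 0ℤ) n∤)
        (cong (λ z → + suc (toℕ (resid n z))) (lem₁ (c * + suc (toℕ m))))
        where
        lem₁ : ∀ z → (z + 0ℤ) - 1ℤ ≡ z + -1ℤ
        lem₁ = solve-∀
        lem₂ : ∀ c d m → m - 0ℤ ≡ d * (c * m + 0ℤ) + (- m) * (c * d - 1ℤ)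
        lem₂ = solve-∀
        n∤ : ¬ (+ n ∣ c * + suc (toℕ m) + 0ℤ)
        n∤ n∣ with () ← small-∣⇒≡ {n} {suc (toℕ m)} {0} (toℕ<n (suc m)) (ℕ.s≤s ℕ.z≤n)
          (∣-combination d (- + suc (toℕ m)) n∣ n∣cd-1 (lem₂ c d (+ suc (toℕ m))))

    -- At m = 0 the representatives in 1, ..., n are both n, and (a - b) n = -n. For `f-zero` they
    -- are both 0; this discrepancy is all that survives of the two sums.
    e-zero : e (aff n a -1ℤ zero) ≡ -1ℤ
    e-zero = ℤ.*-cancelʳ-≡ _ _ (+ n) (begin
      e (aff n a -1ℤ zero) * + n    ≡⟨ e-division (aff n a -1ℤ zero) ⟩
      a * + suc (toℕ (match (aff n a -1ℤ zero))) - b * + suc (toℕ (aff n a -1ℤ zero))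
        ≡⟨ cong₂ (λ x y → a * + suc (toℕ x) - b * + suc (toℕ y)) (trans (match-e zero) (last b)) (last a) ⟩
      a * + suc (toℕ (fromℕ n′)) - b * + suc (toℕ (fromℕ n′))
        ≡⟨ cong (λ k → a * + suc k - b * + suc k) (toℕ-fromℕ n′) ⟩
      a * + n - b * + n             ≡⟨ lem a (+ n) ⟩
      -1ℤ * + n                     ∎)
      where
      open ≡-Reasoning
      lem : ∀ a n → a * n - (a + 1ℤ) * n ≡ -1ℤ * n
      lem = solve-∀
      last : ∀ c → aff n c -1ℤ zero ≡ fromℕ n′
      last c = resid-unique (divides -1ℤ (trans (cong (λ k → (c * 0ℤ + -1ℤ) - + k) (toℕ-fromℕ n′)) (lem′ c (+ n′))))
        where
        lem′ : ∀ c n → (c * 0ℤ + -1ℤ) - n ≡ -1ℤ * (1ℤ + n)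
        lem′ = solve-∀

    f-zero : f (aff n a 0ℤ zero) ≡ 0ℤ
    f-zero = ℤ.*-cancelʳ-≡ _ _ (+ n) (begin
      f (aff n a 0ℤ zero) * + n    ≡⟨ f-division (aff n a 0ℤ zero) ⟩
      a * + suc (toℕ (match (previous (aff n a 0ℤ zero)))) - b * + suc (toℕ (aff n a 0ℤ zero)) + 1ℤ
        ≡⟨ cong₂ (λ x y → a * + suc (toℕ x) - b * + suc (toℕ y) + 1ℤ) (trans (match-f zero) (first b)) (first a) ⟩
      a * 1ℤ - b * 1ℤ + 1ℤ         ≡⟨ lem a (+ n) ⟩
      0ℤ * + n                     ∎)
      where
      open ≡-Reasoning
      lem : ∀ a n → a * 1ℤ - (a + 1ℤ) * 1ℤ + 1ℤ ≡ 0ℤ * n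
      lem = solve-∀
      first : ∀ c → aff n c 0ℤ zero ≡ zero
      first c = resid-unique (divides 0ℤ (lem′ c))
        where
        lem′ : ∀ c → (c * 0ℤ + 0ℤ) - 0ℤ ≡ 0ℤ
        lem′ = solve-∀

    -- As `match` permutes the indices, n times the sum is (a - b)(1 + ... + n) = -n (n + 1)/2, and
    -- (n + 1)/2 = h + 1.
    sum-e : ∀ h → n ≡ suc (h ℕ.+ h) → sumℤ e ≡ -[1+ h ]
    sum-e h n≡ = ℤ.*-cancelʳ-≡ _ _ (+ 2) (ℤ.*-cancelʳ-≡ _ _ (+ n) (begin
      sumℤ e * + 2 * + n                            ≡⟨ lem₁ (sumℤ e) (+ n) ⟩
      + 2 * (sumℤ e * + n)                          ≡⟨ cong (+ 2 *_) n·sum-e ⟩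
      + 2 * (a * S + - b * S)                       ≡⟨ lem₂ a S ⟩
      - (+ 2 * S)                                   ≡⟨ cong -_ (gauss n 1ℤ) ⟩
      - (+ n * (+ 2 * 1ℤ + + n - 1ℤ))
        ≡⟨ cong (λ x → - (+ n * (+ 2 * 1ℤ + x - 1ℤ))) (cong +_ n≡) ⟩
      - (+ n * (+ 2 * 1ℤ + (1ℤ + (+ h + + h)) - 1ℤ)) ≡⟨ lem₃ (+ n) (+ h) ⟩
      - (1ℤ + + h) * + 2 * + n                      ∎))
      where
      open ≡-Reasoning
      S : ℤ
      S = sumℤ {n} λ k → + suc (toℕ k)
      lem₁ : ∀ s n → s * + 2 * n ≡ + 2 * (s * n)
      lem₁ = solve-∀
      lem₂ : ∀ a s → + 2 * (a * s + - (a + 1ℤ) * s) ≡ - (+ 2 * s)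
      lem₂ = solve-∀
      lem₃ : ∀ n h → - (n * (+ 2 * 1ℤ + (1ℤ + (h + h)) - 1ℤ)) ≡ - (1ℤ + h) * + 2 * n
      lem₃ = solve-∀
      n·sum-e : sumℤ e * + n ≡ a * S + - b * S
      n·sum-e = begin
        sumℤ e * + n
          ≡⟨ *-distribʳ-sum (+ n) e ⟩
        sumℤ (λ k → e k * + n)
          ≡⟨ sumℤ-cong {n} (λ k → trans (e-division k)
               (cong (λ x → a * + suc (toℕ (match k)) + x) (ℤ.neg-distribˡ-* b (+ suc (toℕ k))))) ⟩
        sumℤ (λ k → a * + suc (toℕ (match k)) + - b * + suc (toℕ k))
          ≡⟨ ∑-distrib-+ {n} (λ k → a * + suc (toℕ (match k))) (λ k → - b * + suc (toℕ k)) ⟩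
        sumℤ (λ k → a * + suc (toℕ (match k))) + sumℤ {n} (λ k → - b * + suc (toℕ k))
          ≡⟨ cong₂ _+_ (sum-aff ℤ.+-0-commutativeMonoid (a⁻¹ * b) (a⁻¹ * b - 1ℤ) match-invertible (λ k → a * + suc (toℕ k)))
               (*-distribˡ-sum {n} (- b) λ k → + suc (toℕ k)) ⟨
        sumℤ {n} (λ k → a * + suc (toℕ k)) + - b * S
          ≡⟨ cong (_+ - b * S) (*-distribˡ-sum {n} a λ k → + suc (toℕ k)) ⟨
        a * S + - b * S ∎

-- The matrix of q-analogues and its determinant in the coprime case

module QMatrix where
  open PermutationSign
  open Residues
  open Zolotarev
  open Powers
  open Arithmetic
  open import Algebra.Apartness.Bundles using (HeytingField)
  open import Algebra.Bundles using (CommutativeRing)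
  import Algebra.Properties.CommutativeMonoid.Sum as CommutativeMonoidSum
  import Algebra.Properties.Semiring.Exp as Exp
  import Algebra.Properties.Semiring.Sum as SemiringSum
  open import Data.Fin.Base using (Fin; zero; suc; toℕ)
  open import Data.Fin.Properties using (_≟_)
  open import Data.Integer.Base as ℤ using (ℤ; +_; 0ℤ; 1ℤ; -1ℤ)
  import Data.Integer.Properties as ℤ
  open import Data.Nat.Base as ℕ using (ℕ; zero; suc)
  import Data.Nat.Properties as ℕ
  open import Data.Product.Base using (proj₂)
  open import Data.Rational.Base as ℚ using (ceiling)
  open import Data.Sign.Base as Sign using (Sign)
  open import Function.Base using (_∘_)
  open import Relation.Binary.PropositionalEquality as ≡ using (_≡_; _≢_)
  open import Relation.Nullary.Decidable using (yes; no)

  open CommutativeMonoidSum ℤ.+-0-commutativeMonoid using () renaming (sum to sumℤ)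

  module SignedPermutation {c ℓ} (R : CommutativeRing c ℓ) where
    open CommutativeRing R hiding (zero)
    open Determinant R
    open RingSolver R using (solve; _:=_; _:+_; _:*_; _:-_; :-_; 𝟘; 𝟙)
    open import Relation.Binary.Reasoning.Setoid setoid

    fromSign : Sign → Carrier
    fromSign s = fromℤ R (toℤ s)

    permute-columns : ∀ {m n} {Φ : Columns m n → Carrier} → IsAlternating Φ →
      ∀ {f s} → HasSign f s → ∀ v → Φ (v ∘ f) ≈ fromSign s * Φ v
    permute-columns {Φ = Φ} alt (identity f≗id) v = trans
      (IsAlternating.cong alt λ i → ≡⇒≐ (≡.cong v (f≗id i)))
      (solve 1 (λ x → x := (𝟙 :+ 𝟘) :* x) refl (Φ v))
    permute-columns {Φ = Φ} alt {f} (transposed {g = g} {s} x y x≢y fx fy fz h) v = begin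
      Φ (v ∘ f)             ≈⟨ MultilinearProperties.exchange (IsAlternating.isMultilinear alt) x≢y
                                 (λ {v} → IsAlternating.alternating alt x≢y {v})
                                 (≡⇒≐ (≡.cong v fx)) (≡⇒≐ (≡.cong v fy))
                                 (λ k k≢x k≢y → ≡⇒≐ (≡.cong v (fz k k≢x k≢y))) ⟩
      - Φ (v ∘ g)           ≈⟨ -‿cong (permute-columns alt h v) ⟩
      - (fromSign s * Φ v)  ≈⟨ opposite s ⟩
      fromSign (Sign.opposite s) * Φ v ∎
      where
      opposite : ∀ s → - (fromSign s * Φ v) ≈ fromSign (Sign.opposite s) * Φ v
      opposite Sign.+ = solve 1 (λ x → :- ((𝟙 :+ 𝟘) :* x) := (:- (𝟙 :+ 𝟘)) :* x) refl (Φ v)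
      opposite Sign.- = solve 1 (λ x → :- ((:- (𝟙 :+ 𝟘)) :* x) := (𝟙 :+ 𝟘) :* x) refl (Φ v)

    fromSign² : ∀ s → fromSign s * fromSign s ≈ 1#
    fromSign² Sign.+ = solve 0 ((𝟙 :+ 𝟘) :* (𝟙 :+ 𝟘) := 𝟙) refl
    fromSign² Sign.- = solve 0 ((:- (𝟙 :+ 𝟘)) :* (:- (𝟙 :+ 𝟘)) := 𝟙) refl

  module Matrix {c ℓ₁ ℓ₂} (F : HeytingField c ℓ₁ ℓ₂) (q : HeytingField.Carrier F)
    (q#0 : HeytingField._#_ F q (HeytingField.0# F)) (q#1 : HeytingField._#_ F q (HeytingField.1# F))
    (a : ℤ) (n′ : ℕ) where

    R : CommutativeRing c ℓ₁
    R = fieldRing F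

    open CommutativeRing R hiding (zero)
    open Exp semiring using (_^_)
    open Determinant R
    open RingSolver R using (solve; _:=_; _:+_; _:*_; _:-_; :-_; 𝟘; 𝟙)
    open Zpow F q q#0
    open SignedPermutation R
    open SemiringSum semiring using (sum; sum-cong-≋; ∑-distrib-+; *-distribˡ-sum)
    open CommutativeMonoidSum *-commutativeMonoid using ()
      renaming (sum to prod; ∑-distrib-+ to prod-distrib-*; sum-cong-≋ to prod-cong)
    open import Relation.Binary.Reasoning.Setoid setoid

    pow : ℤ → Carrier
    pow = zpow F q q#0

    ε⁻¹ : Carrier
    ε⁻¹ = recipDiff F 1# q (HeytingField.#-sym F q#1)

    εε⁻¹≈1 : (1# - q) * ε⁻¹ ≈ 1#
    εε⁻¹≈1 = proj₂ (proj₂ (HeytingField.#⇒invertible F (HeytingField.#-sym F q#1)))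

    pow-cong : ∀ {y z} → y ≡ z → pow y ≈ pow z
    pow-cong y≡z = reflexive (≡.cong pow y≡z)

    open Exponents a n′

    columns : Columns n n
    columns k j = qAnalogue F q q#0 q#1 (ceiling ((b ℤ.* + suc (toℕ j) ℤ.- a ℤ.* + suc (toℕ k)) ℚ./ n))

    columns≈ : ∀ k j → columns k j ≈
      (1# - pow (rowQuotient j) * pow (ℤ.- colQuotient k) * pow (jump (toℕ (rowResidue j)) (toℕ (colResidue k)))) * ε⁻¹
    columns≈ k j = *-congʳ (+-congˡ (-‿cong (begin
      pow (ceiling ((b ℤ.* + suc (toℕ j) ℤ.- a ℤ.* + suc (toℕ k)) ℚ./ n))
        ≈⟨ pow-cong (exponent j k) ⟩
      pow ((rowQuotient j ℤ.- colQuotient k) ℤ.+ J)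
        ≈⟨ zpow-+ (rowQuotient j ℤ.- colQuotient k) J ⟩
      pow (rowQuotient j ℤ.- colQuotient k) * pow J
        ≈⟨ *-congʳ (zpow-+ (rowQuotient j) (ℤ.- colQuotient k)) ⟩
      pow (rowQuotient j) * pow (ℤ.- colQuotient k) * pow J        ∎)))
      where
      J = jump (toℕ (rowResidue j)) (toℕ (colResidue k))

    -- For a fixed pattern J the column index enters only through the scalar q^(-v_k) in front of a
    -- common vector, to which a constant vector is added.
    three-similar-columns : ∀ {k₁ k₂ k₃} → k₁ ≢ k₂ → k₁ ≢ k₃ → k₂ ≢ k₃ → (J : Fin n → ℤ) →
      (∀ j → jump (toℕ (rowResidue j)) (toℕ (colResidue k₁)) ≡ J j) →
      (∀ j → jump (toℕ (rowResidue j)) (toℕ (colResidue k₂)) ≡ J j) →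
      (∀ j → jump (toℕ (rowResidue j)) (toℕ (colResidue k₃)) ≡ J j) →
      colDet columns ≈ 0#
    three-similar-columns {k₁} {k₂} {k₃} k₁≢k₂ k₁≢k₃ k₂≢k₃ J J₁ J₂ J₃ =
      AlternatingProperties.three-columns-in-a-plane colDet-isAlternating k₁≢k₂ k₁≢k₃ k₂≢k₃
        {columns} {λ _ → ε⁻¹} {λ j → - (pow (rowQuotient j) * pow (J j) * ε⁻¹)}
        (pow (ℤ.- colQuotient k₁)) (pow (ℤ.- colQuotient k₂)) (pow (ℤ.- colQuotient k₃))
        (column k₁ J₁) (column k₂ J₂) (column k₃ J₃)
      where
      column : ∀ k → (∀ j → jump (toℕ (rowResidue j)) (toℕ (colResidue k)) ≡ J j) →
        ∀ j → columns k j ≈ pow (ℤ.- colQuotient k) * - (pow (rowQuotient j) * pow (J j) * ε⁻¹) + ε⁻¹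
      column k Jₖ j = begin
        columns k j ≈⟨ columns≈ k j ⟩
        (1# - pow (rowQuotient j) * pow (ℤ.- colQuotient k) * pow (jump (toℕ (rowResidue j)) (toℕ (colResidue k)))) * ε⁻¹
          ≈⟨ *-congʳ (+-congˡ (-‿cong (*-congˡ (pow-cong (Jₖ j))))) ⟩
        (1# - pow (rowQuotient j) * pow (ℤ.- colQuotient k) * pow (J j)) * ε⁻¹
          ≈⟨ solve 4 (λ x y t i → (𝟙 :- x :* y :* t) :* i := y :* (:- (x :* t :* i)) :+ i) refl
               (pow (rowQuotient j)) (pow (ℤ.- colQuotient k)) (pow (J j)) ε⁻¹ ⟩
        pow (ℤ.- colQuotient k) * - (pow (rowQuotient j) * pow (J j) * ε⁻¹) + ε⁻¹ ∎

    pow-inverse : ∀ z → pow z * pow (ℤ.- z) ≈ 1#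
    pow-inverse z = trans (sym (zpow-+ z (ℤ.- z))) (pow-cong (ℤ.+-inverseʳ z))

    module _ (a-invertible : Invertible n a) (b-invertible : Invertible n b) where
      open Coprime a n′ a-invertible b-invertible
        hiding (n; b; rowResidue; colResidue; rowQuotient; colQuotient; row-division; col-division; exponent)

      -- β k cancels the column factor of the column matched to k. γ k is the coefficient of the
      -- all-ones vector after subtracting the previous column.
      x β γ : Fin n → Carrier
      x j = pow (rowQuotient j)
      β k = pow (colQuotient (match k))
      γ k = (β k - pow (wrap (rowResidue k)) * β (previous k)) * ε⁻¹

      t : Fin n → Fin n → Carrier
      t r s = pow (jump (toℕ r) (toℕ s))

      -- The scaling moves the column factor from the power of q to the constant term, so that in
      -- differences of columns only the comparison factor `t` is affected beside the constant.
      scaled : Columns n n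
      scaled k j = (β k - x j * t (rowResidue j) (rowResidue k)) * ε⁻¹

      scaled≈ : ∀ k j → β k * columns (match k) j ≈ scaled k j
      scaled≈ k j = begin
        β k * columns (match k) j ≈⟨ *-congˡ (columns≈ (match k) j) ⟩
        β k * ((1# - x j * β⁻¹ * t (rowResidue j) (colResidue (match k))) * ε⁻¹)
          ≡⟨ ≡.cong (λ i → β k * ((1# - x j * β⁻¹ * t (rowResidue j) i) * ε⁻¹)) (colResidue-match k) ⟩
        β k * ((1# - x j * β⁻¹ * t (rowResidue j) (rowResidue k)) * ε⁻¹)
          ≈⟨ solve 5 (λ b x b' t i → b :* ((𝟙 :- x :* b' :* t) :* i) := (b :- (b :* b') :* (x :* t)) :* i) refl
               (β k) (x j) β⁻¹ (t (rowResidue j) (rowResidue k)) ε⁻¹ ⟩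
        (β k - (β k * β⁻¹) * (x j * t (rowResidue j) (rowResidue k))) * ε⁻¹
          ≈⟨ *-congʳ (+-congˡ (-‿cong (trans (*-congʳ (pow-inverse (colQuotient (match k)))) (*-identityˡ _)))) ⟩
        scaled k j ∎
        where
        β⁻¹ = pow (ℤ.- colQuotient (match k))

      sorted : Columns n n
      sorted = scaled ∘ rowResidue⁻¹

      -- The determinant as a function of the columns listed in the order of their residues. The
      -- sorting is undone inside the functional, so that no sign of `rowResidue` has to be tracked.
      Φ : Columns n n → Carrier
      Φ v = colDet (v ∘ rowResidue)

      Φ-isAlternating : IsAlternating Φ
      Φ-isAlternating = AlternatingProperties.reindex colDet-isAlternating rowResidue rowResidue⁻¹
        rowResidue-rowResidue⁻¹ rowResidue⁻¹-rowResidue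

      differences : Columns n n
      differences i j = sorted i j - pow (wrap i) * sorted (cyclicPred i) j

      Φ-differences : Φ differences ≈ (1# - q) * colDet scaled
      Φ-differences = trans
        (cyclic-diffs Φ-isAlternating q {differences} sorted
          (λ j → +-congˡ (-‿cong (*-congʳ (*-identityʳ q))))
          (λ i j → +-congˡ (-‿cong (*-identityˡ _))))
        (*-congˡ (colDet-cong λ k → ≡⇒≐ (≡.cong scaled (rowResidue⁻¹-rowResidue k))))

      -- Off the diagonal the weighted step back leaves the exponent unchanged. On the diagonal the
      -- exponents are 0 and 1, which leaves 1 - q.
      t-cyclic : ∀ j k → t (rowResidue j) (rowResidue k)
          - pow (wrap (rowResidue k)) * t (rowResidue j) (cyclicPred (rowResidue k))
        ≈ δ j k * (1# - q)
      t-cyclic j k with j ≟ k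
      ... | yes ≡.refl = begin
        t r r - pow (wrap r) * t r (cyclicPred r)
          ≈⟨ +-cong (pow-cong (jump-≮ {toℕ r} (ℕ.<-irrefl ≡.refl)))
               (-‿cong (trans (sym (zpow-+ (wrap r) _)) (pow-cong (jump-cyclicPred-diagonal r)))) ⟩
        1# - q * 1#
          ≈⟨ solve 1 (λ q → 𝟙 :- q :* 𝟙 := 𝟙 :* (𝟙 :- q)) refl q ⟩
        1# * (1# - q)                                  ≈⟨ *-congʳ (δ-refl j) ⟨
        δ j j * (1# - q)                               ∎
        where r = rowResidue j
      ... | no j≢k = begin
        t r i - pow (wrap i) * t r (cyclicPred i)
          ≈⟨ +-congˡ (-‿cong (trans (sym (zpow-+ (wrap i) _)) (pow-cong (jump-cyclicPred (j≢k ∘ rowResidue-injective))))) ⟩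
        t r i - t r i                                  ≈⟨ -‿inverseʳ _ ⟩
        0#                                             ≈⟨ zeroˡ _ ⟨
        0# * (1# - q)                                  ≈⟨ *-congʳ (δ-≢ j≢k) ⟨
        δ j k * (1# - q)                               ∎
        where
        r = rowResidue j
        i = rowResidue k

      differences≈ : ∀ k j → differences (rowResidue k) j ≈ γ k * 1# + δ j k * - x k
      differences≈ k j = begin
        differences i j
          ≡⟨ ≡.cong₂ (λ l m → (β l - x j * t (rowResidue j) m) * ε⁻¹ - w * sorted (cyclicPred i) j)
               (rowResidue⁻¹-rowResidue k) (rowResidue-rowResidue⁻¹ i) ⟩
        (β k - x j * T) * ε⁻¹ - w * ((β′ - x j * t (rowResidue j) (rowResidue (rowResidue⁻¹ (cyclicPred i)))) * ε⁻¹)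
          ≡⟨ ≡.cong (λ l → (β k - x j * T) * ε⁻¹ - w * ((β′ - x j * t (rowResidue j) l) * ε⁻¹))
               (rowResidue-rowResidue⁻¹ (cyclicPred i)) ⟩
        (β k - x j * T) * ε⁻¹ - w * ((β′ - x j * T′) * ε⁻¹)
          ≈⟨ solve 7 (λ b x t i w b' t' → (b :- x :* t) :* i :- w :* ((b' :- x :* t') :* i)
               := (b :- w :* b') :* i :* 𝟙 :+ x :* (:- ((t :- w :* t') :* i))) refl (β k) (x j) T ε⁻¹ w β′ T′ ⟩
        γ k * 1# + x j * - ((T - w * T′) * ε⁻¹)
          ≈⟨ +-congˡ (*-congˡ (-‿cong (trans (*-congʳ (t-cyclic j k)) (*-assoc _ _ _)))) ⟩
        γ k * 1# + x j * - (δ j k * ((1# - q) * ε⁻¹))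
          ≈⟨ +-congˡ (*-congˡ (-‿cong (*-congˡ εε⁻¹≈1))) ⟩
        γ k * 1# + x j * - (δ j k * 1#)
          ≈⟨ +-congˡ δ-swap ⟩
        γ k * 1# + δ j k * - x k ∎
        where
        i = rowResidue k
        w = pow (wrap i)
        β′ = β (previous k)
        T = t (rowResidue j) i
        T′ = t (rowResidue j) (cyclicPred i)
        δ-swap : x j * - (δ j k * 1#) ≈ δ j k * - x k
        δ-swap with j ≟ k
        ... | yes ≡.refl = solve 2 (λ x d → x :* (:- (d :* 𝟙)) := d :* (:- x)) refl (x j) (δ j j)
        ... | no j≢k = begin
          x j * - (δ j k * 1#)  ≈⟨ *-congˡ (-‿cong (*-congʳ (δ-≢ j≢k))) ⟩
          x j * - (0# * 1#)     ≈⟨ solve 2 (λ x y → x :* (:- (𝟘 :* 𝟙)) := 𝟘 :* (:- y)) refl (x j) (x k) ⟩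
          0# * - x k            ≈⟨ *-congʳ (δ-≢ j≢k) ⟨
          δ j k * - x k         ∎

      x⁻¹ : Fin n → Carrier
      x⁻¹ j = pow (ℤ.- rowQuotient j)

      -- The two sums are reindexed by different bijections, chosen so that their terms agree for
      -- all m except 0.
      sum-e-f : sum (pow ∘ e) - sum (pow ∘ f) ≈ pow -1ℤ - 1#
      sum-e-f = begin
        sum (pow ∘ e) - sum (pow ∘ f)
          ≈⟨ +-cong (sum-aff +-commutativeMonoid a -1ℤ a-invertible (pow ∘ e))
               (-‿cong (sum-aff +-commutativeMonoid a 0ℤ a-invertible (pow ∘ f))) ⟩
        (pow (e (aff n a -1ℤ zero)) + sum (λ m → pow (e (aff n a -1ℤ (suc m))))) - (pow (f (aff n a 0ℤ zero)) + S)
          ≈⟨ +-cong (+-cong (pow-cong e-zero) (sum-cong-≋ {n′} λ m → pow-cong (e≡f m))) (-‿cong (+-congʳ (pow-cong f-zero))) ⟩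
        (pow -1ℤ + S) - (1# + S)
          ≈⟨ solve 2 (λ p s → (p :+ s) :- (𝟙 :+ s) := p :- 𝟙) refl (pow -1ℤ) S ⟩
        pow -1ℤ - 1# ∎
        where
        S = sum (λ m → pow (f (aff n a 0ℤ (suc m))))

      sum-γ/x : sum (λ k → γ k * - x⁻¹ k) ≈ - pow -1ℤ
      sum-γ/x = begin
        sum (λ k → γ k * - x⁻¹ k)                                        ≈⟨ sum-cong-≋ term ⟩
        sum (λ k → - ε⁻¹ * pow (e k) + ε⁻¹ * pow (f k))
          ≈⟨ ∑-distrib-+ (λ k → - ε⁻¹ * pow (e k)) (λ k → ε⁻¹ * pow (f k)) ⟩
        sum (λ k → - ε⁻¹ * pow (e k)) + sum (λ k → ε⁻¹ * pow (f k))
          ≈⟨ +-cong (*-distribˡ-sum (- ε⁻¹) (pow ∘ e)) (*-distribˡ-sum ε⁻¹ (pow ∘ f)) ⟨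
        - ε⁻¹ * sum (pow ∘ e) + ε⁻¹ * sum (pow ∘ f)
          ≈⟨ solve 3 (λ i a b → (:- i) :* a :+ i :* b := (:- i) :* (a :- b)) refl ε⁻¹ (sum (pow ∘ e)) (sum (pow ∘ f)) ⟩
        -- With 1 = q⁻¹ q the bracket becomes q⁻¹ (1 - q), whose second factor cancels against ε⁻¹.
        - ε⁻¹ * (sum (pow ∘ e) - sum (pow ∘ f))                          ≈⟨ *-congˡ sum-e-f ⟩
        - ε⁻¹ * (pow -1ℤ - 1#)
          ≈⟨ *-congˡ (+-congˡ (-‿cong (sym (pow-inverse -1ℤ)))) ⟩
        - ε⁻¹ * (pow -1ℤ - pow -1ℤ * pow 1ℤ)
          ≈⟨ *-congˡ (+-congˡ (-‿cong (*-congˡ (*-identityʳ q)))) ⟩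
        - ε⁻¹ * (pow -1ℤ - pow -1ℤ * q)
          ≈⟨ solve 3 (λ i p q → (:- i) :* (p :- p :* q) := :- (p :* ((𝟙 :- q) :* i))) refl ε⁻¹ (pow -1ℤ) q ⟩
        - (pow -1ℤ * ((1# - q) * ε⁻¹))
          ≈⟨ -‿cong (trans (*-congˡ εε⁻¹≈1) (*-identityʳ _)) ⟩
        - pow -1ℤ ∎
        where
        term : ∀ k → γ k * - x⁻¹ k ≈ - ε⁻¹ * pow (e k) + ε⁻¹ * pow (f k)
        term k = begin
          (β k - w * β′) * ε⁻¹ * - x⁻¹ k
            ≈⟨ solve 5 (λ b w b' i y → (b :- w :* b') :* i :* (:- y) := (:- i) :* (b :* y) :+ i :* (w :* b' :* y)) refl
                 (β k) w β′ ε⁻¹ (x⁻¹ k) ⟩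
          - ε⁻¹ * (β k * x⁻¹ k) + ε⁻¹ * (w * β′ * x⁻¹ k)
            ≈⟨ +-cong (*-congˡ (sym (zpow-+ (colQuotient (match k)) (ℤ.- rowQuotient k))))
                 (*-congˡ (sym (trans (zpow-+ (wrap (rowResidue k) ℤ.+ colQuotient (match (previous k))) (ℤ.- rowQuotient k))
                   (*-congʳ (zpow-+ (wrap (rowResidue k)) (colQuotient (match (previous k)))))))) ⟩
          - ε⁻¹ * pow (e k) + ε⁻¹ * pow (f k) ∎
          where
          w = pow (wrap (rowResidue k))
          β′ = β (previous k)

      prod-neg : ∀ {m} (y : Fin m → Carrier) h → m ≡ suc (h ℕ.+ h) → prod (λ k → - y k) ≈ - prod y
      prod-neg y zero ≡.refl = solve 1 (λ y → (:- y) :* 𝟙 := :- (y :* 𝟙)) refl (y zero)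
      prod-neg y (suc h) m≡ rewrite m≡ | ℕ.+-suc h h = begin
        - y zero * (- y (suc zero) * prod (λ k → - y (suc (suc k))))
          ≈⟨ *-congˡ (*-congˡ (prod-neg (λ k → y (suc (suc k))) h ≡.refl)) ⟩
        - y zero * (- y (suc zero) * - prod (λ k → y (suc (suc k))))
          ≈⟨ solve 3 (λ a b p → (:- a) :* ((:- b) :* (:- p)) := :- (a :* (b :* p))) refl (y zero) (y (suc zero)) _ ⟩
        - prod y ∎

      colDet-scaled : ∀ h → n ≡ suc (h ℕ.+ h) → colDet scaled ≈ prod x * pow -1ℤ
      colDet-scaled h n≡ = begin
        colDet scaled
          ≈⟨ trans (sym (*-identityʳ _)) (*-congˡ (sym εε⁻¹≈1)) ⟩
        -- The cyclic differences give the determinant only up to the factor 1 - q, which is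
        -- therefore inserted with its inverse.
        colDet scaled * ((1# - q) * ε⁻¹)
          ≈⟨ solve 3 (λ d e i → d :* (e :* i) := (e :* d) :* i) refl (colDet scaled) (1# - q) ε⁻¹ ⟩
        (1# - q) * colDet scaled * ε⁻¹               ≈⟨ *-congʳ Φ-differences ⟨
        Φ differences * ε⁻¹                          ≈⟨ *-congʳ (colDet-cong differences≈) ⟩
        colDet (λ k j → γ k * 1# + δ j k * - x k) * ε⁻¹
          ≈⟨ *-congʳ (colDet-diagonal+rank1 γ (λ k → - x k) (λ k → - x⁻¹ k) inverses) ⟩
        prod (λ k → - x k) * (1# + sum (λ k → γ k * - x⁻¹ k)) * ε⁻¹
          -- The rank one factor is 1 - q⁻¹ = -(1 - q) q⁻¹, and its sign cancels with the one from
          -- the odd number of entries -x k.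
          ≈⟨ *-congʳ (*-cong (prod-neg x h n≡) (+-cong (sym (pow-inverse -1ℤ)) sum-γ/x)) ⟩
        - prod x * (pow -1ℤ * pow 1ℤ - pow -1ℤ) * ε⁻¹
          ≈⟨ *-congʳ (*-congˡ (+-congʳ (*-congˡ (*-identityʳ q)))) ⟩
        - prod x * (pow -1ℤ * q - pow -1ℤ) * ε⁻¹
          ≈⟨ solve 4 (λ X p q i → (:- X) :* (p :* q :- p) :* i := X :* p :* ((𝟙 :- q) :* i)) refl (prod x) (pow -1ℤ) q ε⁻¹ ⟩
        prod x * pow -1ℤ * ((1# - q) * ε⁻¹)          ≈⟨ trans (*-congˡ εε⁻¹≈1) (*-identityʳ _) ⟩
        prod x * pow -1ℤ                             ∎
        where
        inverses : ∀ k → - x k * - x⁻¹ k ≈ 1#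
        inverses k = trans (solve 2 (λ x y → (:- x) :* (:- y) := x :* y) refl (x k) (x⁻¹ k)) (pow-inverse (rowQuotient k))

      colDet-matched : ∀ h → n ≡ suc (h ℕ.+ h) → colDet (columns ∘ match) ≈ q ^ h
      colDet-matched h n≡ = begin
        -- The factor 1 is inserted as q^(h + 1) q^(Σ e). Here q^(Σ e) is the product of all β k and
        -- x⁻¹ k: the β k scale the columns, and the x⁻¹ k cancel the diagonal.
        D                                            ≈⟨ trans (sym (*-identityˡ D)) (*-congʳ (sym E⁻¹)) ⟩
        pow (+ suc h) * pow (sumℤ e) * D
          ≈⟨ *-congʳ (*-congˡ (trans (zpow-sum e) (prod-cong λ k → zpow-+ (colQuotient (match k)) (ℤ.- rowQuotient k)))) ⟩
        pow (+ suc h) * prod (λ k → β k * x⁻¹ k) * D  ≈⟨ *-congʳ (*-congˡ (prod-distrib-* β x⁻¹)) ⟩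
        pow (+ suc h) * (prod β * prod x⁻¹) * D
          ≈⟨ solve 4 (λ p b y d → p :* (b :* y) :* d := p :* y :* (b :* d)) refl _ (prod β) (prod x⁻¹) D ⟩
        pow (+ suc h) * prod x⁻¹ * (prod β * D)
          ≈⟨ *-congˡ (scale-columns colDet-isMultilinear β (columns ∘ match)) ⟨
        pow (+ suc h) * prod x⁻¹ * colDet (λ k j → β k * columns (match k) j)
          ≈⟨ *-congˡ (colDet-cong scaled≈) ⟩
        pow (+ suc h) * prod x⁻¹ * colDet scaled      ≈⟨ *-congˡ (colDet-scaled h n≡) ⟩
        pow (+ suc h) * prod x⁻¹ * (prod x * pow -1ℤ)
          ≈⟨ solve 4 (λ p y x i → p :* y :* (x :* i) := (p :* i) :* (x :* y)) refl _ (prod x⁻¹) (prod x) _ ⟩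
        pow (+ suc h) * pow -1ℤ * (prod x * prod x⁻¹) ≈⟨ *-cong (sym (zpow-+ (+ suc h) -1ℤ)) X ⟩
        pow (+ h) * 1#                                ≈⟨ *-identityʳ _ ⟩
        q ^ h                                         ∎
        where
        D = colDet (columns ∘ match)
        E⁻¹ : pow (+ suc h) * pow (sumℤ e) ≈ 1#
        E⁻¹ = trans (*-congˡ (pow-cong (sum-e h n≡))) (pow-inverse (+ suc h))
        X : prod x * prod x⁻¹ ≈ 1#
        X = trans (sym (prod-distrib-* x x⁻¹)) (trans (prod-cong {n} λ k → pow-inverse (rowQuotient k)) (prod-one n))
          where
          prod-one : ∀ m → prod {m} (λ _ → 1#) ≈ 1#
          prod-one zero    = refl
          prod-one (suc m) = trans (*-identityˡ _) (prod-one m)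

      colDet-columns : ∀ h → n ≡ suc (h ℕ.+ h) → ∀ {s} → HasSign match s → colDet columns ≈ fromSign s * q ^ h
      colDet-columns h n≡ {s} sign = begin
        colDet columns
          ≈⟨ trans (sym (*-identityˡ _)) (*-congʳ (sym (fromSign² s))) ⟩
        fromSign s * fromSign s * colDet columns     ≈⟨ *-assoc _ _ _ ⟩
        fromSign s * (fromSign s * colDet columns)
          ≈⟨ *-congˡ (permute-columns colDet-isAlternating sign columns) ⟨
        fromSign s * colDet (columns ∘ match)        ≈⟨ *-congˡ (colDet-matched h n≡) ⟩
        fromSign s * q ^ h                           ∎

-- Common prime factors, and the assembly of all cases

module Conclusion where
  open PermutationSign
  open Residues
  open Zolotarev
  open Powers
  open Arithmetic
  open QMatrix
  open import Algebra.Apartness.Bundles using (HeytingField)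
  open import Algebra.Bundles using (CommutativeRing)
  open import Algebra.Properties.Semiring.Exp using (_^_)
  open import Data.Fin.Base using (Fin; zero; suc; toℕ; fromℕ<)
  open import Data.Fin.Properties using (toℕ-fromℕ<)
  open import Data.Integer.Base as ℤ using (ℤ; +_; 0ℤ; 1ℤ; -1ℤ)
  open import Data.Integer.Divisibility.Signed using (_∣_; divides; _∣?_; ∣⇒∣ᵤ; ∣ᵤ⇒∣; ∣-trans; ∣n⇒∣m*n; ∣m⇒∣m*n)
  import Data.Integer.Properties as ℤ
  open import Data.Integer.Tactic.RingSolver using (solve-∀)
  open import Data.List.Membership.Propositional using (_∈_; find)
  open import Data.List.Relation.Unary.All as All using (All)
  open import Data.List.Relation.Unary.All.Properties using (¬Any⇒All¬)
  open import Data.List.Relation.Unary.Any using (any?)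
  open import Data.Nat.Base as ℕ using (ℕ; zero; suc; NonZero)
  import Data.Nat.Divisibility as ℕ
  open import Data.Nat.ListAction using (product)
  open import Data.Nat.ListAction.Properties using (∈⇒∣product)
  open import Data.Nat.Primality using (Prime)
  open import Data.Nat.Primality.Factorisation using (PrimeFactorisation; factorise)
  import Data.Nat.Properties as ℕ
  open import Data.Product.Base using (_,_; proj₁; proj₂; ∃-syntax; _×_)
  open import Data.Rational.Base as ℚ using (ceiling)
  open import Data.Sign.Base as Sign using (Sign)
  import Data.Sign.Properties as Sign
  open import Data.Sum.Base using ([_,_]′)
  open import Function.Base using (_∘_)
  open import Relation.Binary.PropositionalEquality
  open import Relation.Nullary.Decidable using (Dec; yes; no)
  open import Relation.Nullary.Negation using (¬_)

  module _ (a : ℤ) (n′ : ℕ) where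
    open Exponents a n′

    -- If p divides a and n = p m, the columns m, 2m, 3m all have residue 0.
    module CommonFactor {p m′ h} (p≡ : p ≡ 3 ℕ.+ h) (n≡ : n ≡ suc m′ ℕ.* p) (p∣a : + p ∣ a) where

      -- Counted from 1, the index is (i + 1) m with m = suc m′; it is at most n because p ≥ 3.
      multiple : ∀ i → i ℕ.< 3 → Fin n
      multiple i i<3 = fromℕ< {m′ ℕ.+ i ℕ.* suc m′} (subst (suc i ℕ.* suc m′ ℕ.≤_)
        (trans (ℕ.*-comm p (suc m′)) (sym n≡)) 
        (ℕ.*-monoˡ-≤ (suc m′) (ℕ.≤-trans i<3 (subst (3 ℕ.≤_) (sym p≡) (ℕ.m≤m+n 3 h)))))

      toℕ-multiple : ∀ i i<3 → toℕ (multiple i i<3) ≡ m′ ℕ.+ i ℕ.* suc m′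
      toℕ-multiple i i<3 = toℕ-fromℕ< _

      multiple-injective : ∀ {i j} i<3 j<3 → multiple i i<3 ≡ multiple j j<3 → i ≡ j
      multiple-injective {i} {j} i<3 j<3 eq = ℕ.*-cancelʳ-≡ i j (suc m′) (ℕ.+-cancelˡ-≡ m′ _ _
        (trans (sym (toℕ-multiple i i<3)) (trans (cong toℕ eq) (toℕ-multiple j j<3))))

      colResidue-multiple : ∀ i i<3 → colResidue (multiple i i<3) ≡ zero
      colResidue-multiple i i<3 = resid-unique (divides (e ℤ.* + suc i) (begin
        (a ℤ.* + toℕ k ℤ.+ a) ℤ.- 0ℤ              ≡⟨ lem₁ a (+ toℕ k) ⟩
        a ℤ.* + suc (toℕ k)                       ≡⟨ cong (λ l → a ℤ.* + suc l) (toℕ-multiple i i<3) ⟩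
        a ℤ.* + (suc i ℕ.* suc m′)                ≡⟨ cong₂ ℤ._*_ eq (ℤ.pos-* (suc i) (suc m′)) ⟩
        e ℤ.* + p ℤ.* (+ suc i ℤ.* + suc m′)      ≡⟨ lem₂ e (+ p) (+ suc i) (+ suc m′) ⟩
        e ℤ.* + suc i ℤ.* (+ suc m′ ℤ.* + p)
          ≡⟨ cong (e ℤ.* + suc i ℤ.*_) (trans (sym (ℤ.pos-* (suc m′) p)) (cong +_ (sym n≡))) ⟩
        e ℤ.* + suc i ℤ.* + n                     ∎))
        where
        open ≡-Reasoning
        open _∣_ p∣a renaming (quotient to e; equality to eq)
        k = multiple i i<3
        lem₁ : ∀ a k → (a ℤ.* k ℤ.+ a) ℤ.- 0ℤ ≡ a ℤ.* (1ℤ ℤ.+ k)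
        lem₁ = solve-∀
        lem₂ : ∀ e p i m → e ℤ.* p ℤ.* (i ℤ.* m) ≡ e ℤ.* i ℤ.* (m ℤ.* p)
        lem₂ = solve-∀

    -- If p divides n and a + 1, then p divides all row residues, so that they
    -- compare in the same way with 0, 1 and 2.
    module CommonFactor⁺ {p h} (p≡ : p ≡ 3 ℕ.+ h) (p∣n : p ℕ.∣ n) (p∣b : + p ∣ b)
      (a-invertible : Invertible n a) where

      3≤p : 3 ℕ.≤ p
      3≤p = subst (3 ℕ.≤_) (sym p≡) (ℕ.m≤m+n 3 h)

      -- Invertibility of a provides an index whose multiple by a has the residue i; that i is a
      -- residue at all follows from i < 3 ≤ p ≤ n.
      withResidue : ∀ i → i ℕ.< 3 → Fin n
      withResidue i i<3 = aff n (proj₁ a-invertible) -1ℤ (fromℕ< {i} (ℕ.≤-trans i<3 (ℕ.≤-trans 3≤p (ℕ.∣⇒≤ p∣n))))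

      colResidue-withResidue : ∀ i i<3 → toℕ (colResidue (withResidue i i<3)) ≡ i
      colResidue-withResidue i i<3 = trans (cong toℕ (
        aff-inverse a a (proj₁ a-invertible) -1ℤ (proj₂ a-invertible) (divides 0ℤ (lem a)) _)) (toℕ-fromℕ< _)
        where
        lem : ∀ a → (a ℤ.* -1ℤ ℤ.+ a) ℤ.- 0ℤ ≡ 0ℤ
        lem = solve-∀

      withResidue-injective : ∀ {i j} i<3 j<3 → withResidue i i<3 ≡ withResidue j j<3 → i ≡ j
      withResidue-injective {i} {j} i<3 j<3 eq =
        trans (sym (colResidue-withResidue i i<3)) (trans (cong (toℕ ∘ colResidue) eq) (colResidue-withResidue j j<3))

      p∣rowResidue : ∀ j → + p ∣ + toℕ (rowResidue j)
      p∣rowResidue j = ∣-combination 1ℤ (+ suc (toℕ j)) (∣-trans (∣ᵤ⇒∣ p∣n) (resid-∣ n (b ℤ.* + toℕ j ℤ.+ b))) p∣b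
        (lem (+ toℕ (rowResidue j)) b (+ toℕ j))
        where
        lem : ∀ r b j → r ≡ 1ℤ ℤ.* (r ℤ.- (b ℤ.* j ℤ.+ b)) ℤ.+ (1ℤ ℤ.+ j) ℤ.* b
        lem = solve-∀

      -- A multiple of p is 0 or at least p ≥ 3, so the thresholds 0, 1 and 2 do not distinguish
      -- such numbers.
      jump-multiple : ∀ r → p ℕ.∣ r → ∀ {i} → i ℕ.< 3 → jump r i ≡ jump r 0
      jump-multiple zero    _ {i} _ = trans (jump-≮ {0} {i} λ ()) (sym (jump-≮ {0} {0} λ ()))
      jump-multiple (suc r) p∣r i<3 = trans (jump-< (ℕ.≤-trans i<3 (ℕ.≤-trans 3≤p (ℕ.∣⇒≤ p∣r))))
        (sym (jump-< {suc r} {0} (ℕ.s≤s ℕ.z≤n)))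

      jump-withResidue : ∀ i i<3 j →
        jump (toℕ (rowResidue j)) (toℕ (colResidue (withResidue i i<3))) ≡ jump (toℕ (rowResidue j)) 0
      jump-withResidue i i<3 j = trans (cong (jump (toℕ (rowResidue j))) (colResidue-withResidue i i<3))
        (jump-multiple _ (∣⇒∣ᵤ (p∣rowResidue j)) i<3)

    -- The multiplier of `match` is a⁻¹ b = (a b) (a⁻¹)², and the square contributes s′² = +.
    -- Zolotarev's lemma is applied to a⁻¹ merely to have some sign s′.
    match-HasSign : (a-invertible : Invertible n a) (b-invertible : Invertible n b) →
      ∀ ps → n ≡ product ps → All Prime ps → Odd n →
      ∀ {s} → (∀ τ → HasSign (aff n (a ℤ.* b) τ) s) →
      HasSign (Coprime.match a n′ a-invertible b-invertible) s
    match-HasSign a-invertible b-invertible ps n≡ primes odd {s} hab = go (zolotarev ps n≡ primes odd ∤a⁻¹)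
      where
      open Coprime a n′ a-invertible b-invertible using (match; a⁻¹; n∣aa⁻¹-1)
      τ = a⁻¹ ℤ.* b ℤ.- 1ℤ
      lem₀ : ∀ x → x ℤ.- x ≡ 0ℤ
      lem₀ = solve-∀
      lem₁ : ∀ x → (x ℤ.* 0ℤ ℤ.+ 0ℤ) ℤ.- 0ℤ ≡ 0ℤ
      lem₁ = solve-∀
      lem₂ : ∀ a a′ b → (a ℤ.* b) ℤ.* (a′ ℤ.* a′) ℤ.- a′ ℤ.* b ≡ (a′ ℤ.* b) ℤ.* (a ℤ.* a′ ℤ.- 1ℤ)
      lem₂ = solve-∀
      lem₃ : ∀ x τ → (x ℤ.* 0ℤ ℤ.+ τ) ℤ.- τ ≡ 0ℤ
      lem₃ = solve-∀
      ∤a⁻¹ : All (λ p → ¬ (+ p ∣ a⁻¹)) ps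
      ∤a⁻¹ = All.tabulate λ {p} p∈ps p∣a⁻¹ → p∤1 (All.lookup primes p∈ps)
        (∣-combination a -1ℤ p∣a⁻¹ (∣-trans (∣ᵤ⇒∣ (subst (p ℕ.∣_) (sym n≡) (∈⇒∣product p∈ps))) n∣aa⁻¹-1) (lem a a⁻¹))
        where
        lem : ∀ a a′ → 1ℤ ≡ a ℤ.* a′ ℤ.+ -1ℤ ℤ.* (a ℤ.* a′ ℤ.- 1ℤ)
        lem = solve-∀
      go : ∃[ s′ ] (_ × (∀ τ → HasSign (aff n a⁻¹ τ) s′)) → HasSign match s
      go (s′ , _ , h′) = subst (HasSign match) (cong (Sign._* s) (Sign.s*s≡+ s′))
        (HasSign-resp-≗ (λ i → sym (trans (cong (aff n (a ℤ.* b) τ) (aff-∘ a⁻¹ 0ℤ a⁻¹ 0ℤ (a⁻¹ ℤ.* a⁻¹) 0ℤ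
              (divides 0ℤ (lem₀ (a⁻¹ ℤ.* a⁻¹))) (divides 0ℤ (lem₁ a⁻¹)) i))
            (aff-∘ (a ℤ.* b) τ (a⁻¹ ℤ.* a⁻¹) 0ℤ (a⁻¹ ℤ.* b) τ (∣-multiple (a⁻¹ ℤ.* b) n∣aa⁻¹-1 (lem₂ a a⁻¹ b))
              (divides 0ℤ (lem₃ (a ℤ.* b) τ)) i)))
          (HasSign-∘ (hab τ) (HasSign-∘ (h′ 0ℤ) (h′ 0ℤ))))

  module _ {c ℓ₁ ℓ₂} (F : HeytingField c ℓ₁ ℓ₂) (q : HeytingField.Carrier F)
    (q#0 : HeytingField._#_ F q (HeytingField.0# F)) (q#1 : HeytingField._#_ F q (HeytingField.1# F))
    (a : ℤ) (n′ : ℕ) where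
    private
      module K = HeytingField F
    open HeytingField F using (_≈_; _*_; 0#)
    open Exponents a n′
    open Matrix F q q#0 q#1 a n′ using (R; columns; three-similar-columns; colDet-columns)

    determinant : ∀ h → n ≡ suc (h ℕ.+ h) →
      det R (λ j k → columns k j) ≈ fromℤ R (jacobi (a ℤ.* b) n) * _^_ (CommutativeRing.semiring R) q h
    determinant h n≡1+2h = go (any? (λ p → + p ∣? a) ps) (any? (λ p → + p ∣? b) ps)
      where
      factorisation = factorise n
      ps = PrimeFactorisation.factors factorisation
      n≡ = PrimeFactorisation.isFactorisation factorisation
      primes = PrimeFactorisation.factorsPrime factorisation
      odd : Odd n
      odd = h , n≡1+2h

      ∈⇒∣n : ∀ {p} → p ∈ ps → p ℕ.∣ n
      ∈⇒∣n {p} p∈ps = subst (p ℕ.∣_) (sym n≡) (∈⇒∣product p∈ps)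

      ∈⇒≥3 : ∀ {p} → p ∈ ps → ∃[ k ] p ≡ 3 ℕ.+ (k ℕ.+ k)
      ∈⇒≥3 {p} p∈ps with ℕ.divides m eq ← ∈⇒∣n p∈ps =
        odd-prime≥3 (All.lookup primes p∈ps) (proj₂ (odd-*⁻ m p (subst Odd eq odd)))

      vanishes : ∀ {p} → p ∈ ps → + p ∣ a ℤ.* b → det R (λ j k → columns k j) ≈ 0# →
        det R (λ j k → columns k j) ≈ fromℤ R (jacobi (a ℤ.* b) n) * _^_ (CommutativeRing.semiring R) q h
      vanishes p∈ps p∣ab det≈0 = K.trans det≈0 (K.sym (K.trans
        (K.*-congʳ (K.reflexive (cong (fromℤ R) (legendre-product-∣ ps p∈ps p∣ab)))) (K.zeroˡ _)))

      0<3 : 0 ℕ.< 3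
      0<3 = ℕ.s≤s ℕ.z≤n
      1<3 : 1 ℕ.< 3
      1<3 = ℕ.s≤s (ℕ.s≤s ℕ.z≤n)
      2<3 : 2 ℕ.< 3
      2<3 = ℕ.s≤s (ℕ.s≤s (ℕ.s≤s ℕ.z≤n))

      0≢1 : 0 ≢ 1
      0≢1 ()
      0≢2 : 0 ≢ 2
      0≢2 ()
      1≢2 : 1 ≢ 2
      1≢2 ()

      go : Dec _ → Dec _ →
        det R (λ j k → columns k j) ≈ fromℤ R (jacobi (a ℤ.* b) n) * _^_ (CommutativeRing.semiring R) q h
      go (yes p∣a-somewhere) _ with p , p∈ps , p∣a ← find p∣a-somewhere
        with k , p≡ ← ∈⇒≥3 p∈ps | ℕ.divides (suc m′) eq ← ∈⇒∣n p∈ps =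
        vanishes p∈ps (∣m⇒∣m*n b p∣a)
          (three-similar-columns {multiple 0 0<3} {multiple 1 1<3} {multiple 2 2<3}
            (0≢1 ∘ multiple-injective 0<3 1<3) (0≢2 ∘ multiple-injective 0<3 2<3) (1≢2 ∘ multiple-injective 1<3 2<3)
            (λ j → jump (toℕ (rowResidue j)) 0) (same 0 0<3) (same 1 1<3) (same 2 2<3))
        where
        open CommonFactor a n′ {m′ = m′} p≡ eq p∣a
        same : ∀ i i<3 j → jump (toℕ (rowResidue j)) (toℕ (colResidue (multiple i i<3))) ≡ jump (toℕ (rowResidue j)) 0
        same i i<3 j = cong (λ k → jump (toℕ (rowResidue j)) (toℕ k)) (colResidue-multiple i i<3)
      -- Divisors of a have been tested before, so a is invertible modulo n and the column residues
      -- 0, 1 and 2 all occur.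
      go (no ∤a) (yes p∣b-somewhere) with p , p∈ps , p∣b ← find p∣b-somewhere
        with k , p≡ ← ∈⇒≥3 p∈ps =
        vanishes p∈ps (∣n⇒∣m*n a p∣b)
          (three-similar-columns {withResidue 0 0<3} {withResidue 1 1<3} {withResidue 2 2<3}
            (0≢1 ∘ withResidue-injective 0<3 1<3) (0≢2 ∘ withResidue-injective 0<3 2<3)
            (1≢2 ∘ withResidue-injective 1<3 2<3)
            (λ j → jump (toℕ (rowResidue j)) 0)
            (jump-withResidue 0 0<3) (jump-withResidue 1 1<3) (jump-withResidue 2 2<3))
        where
        a-invertible : Invertible n a
        a-invertible = subst (λ n → Invertible n a) (sym n≡) (∤⇒invertible-product ps primes (¬Any⇒All¬ ps ∤a))
        open CommonFactor⁺ a n′ p≡ (∈⇒∣n p∈ps) p∣b a-invertible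
      go (no ∤a) (no ∤b) = coprime (zolotarev ps n≡ primes odd ∤ab)
        where
        invertible : ∀ {c} → All (λ p → ¬ (+ p ∣ c)) ps → Invertible n c
        invertible {c} ∤c = subst (λ n → Invertible n c) (sym n≡) (∤⇒invertible-product ps primes ∤c)
        a-invertible : Invertible n a
        a-invertible = invertible (¬Any⇒All¬ ps ∤a)
        b-invertible : Invertible n b
        b-invertible = invertible (¬Any⇒All¬ ps ∤b)
        ∤ab : All (λ p → ¬ (+ p ∣ a ℤ.* b)) ps
        ∤ab = All.tabulate λ p∈ps p∣ab → [ All.lookup (¬Any⇒All¬ ps ∤a) p∈ps , All.lookup (¬Any⇒All¬ ps ∤b) p∈ps ]′
          (euclidsLemmaℤ (All.lookup primes p∈ps) a b p∣ab)
        coprime : ∃[ s ] jacobi (a ℤ.* b) n ≡ toℤ s × (∀ τ → HasSign (aff n (a ℤ.* b) τ) s) →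
          det R (λ j k → columns k j) ≈ fromℤ R (jacobi (a ℤ.* b) n) * _^_ (CommutativeRing.semiring R) q h
        coprime (s , jacobi≡ , hab) = K.trans
          (colDet-columns a-invertible b-invertible h n≡1+2h
            (match-HasSign a n′ a-invertible b-invertible ps n≡ primes odd hab))
          (K.*-congʳ (K.reflexive (cong (fromℤ R) (sym jacobi≡))))

open Conclusion using (determinant)
open import Algebra.Properties.Semiring.Exp using (_^_)
open import Data.Fin.Base using (toℕ)
open import Data.Integer.Base as ℤ using (ℤ; +_; 1ℤ)
open import Data.Nat.Base as ℕ using (ℕ; suc; NonZero)
open import Data.Nat.DivMod using (_%_; m≡m%n+[m/n]*n; m*n/n≡m)
import Data.Nat.Properties as ℕ
open import Data.Rational.Base as ℚ using (ceiling)
open import Relation.Binary.PropositionalEquality using (_≡_; cong; sym; trans)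

theorem1p2 : ∀ {c ℓ₁ ℓ₂} (F : HeytingField c ℓ₁ ℓ₂) →
    let open HeytingField F
        R = fieldRing F
    in
    (q : Carrier) (q#0 : q # 0#) (q#1 : q # 1#) →
    (a : ℤ) (n : ℕ) .{{_ : NonZero n}} → n % 2 ≡ 1 →
    det R {n} (λ j k → qAnalogue F q q#0 q#1
      (ceiling (((a ℤ.+ 1ℤ) ℤ.* + suc (toℕ j) ℤ.- a ℤ.* + suc (toℕ k)) ℚ./ n)))
      ≈ fromℤ R (jacobi (a ℤ.* (a ℤ.+ 1ℤ)) n) * _^_ (CommutativeRing.semiring R) q ((n ℕ.∸ 1) ℕ./ 2)
theorem1p2 F q q#0 q#1 a n@(suc n′) n%2≡1 = K.trans
  (determinant F q q#0 q#1 a n′ h (cong suc (trans n′≡h*2 (trans (ℕ.*-comm h 2) (cong (h ℕ.+_) (ℕ.+-identityʳ h))))))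
  (K.*-congˡ (K.reflexive (cong (_^_ (CommutativeRing.semiring (fieldRing F)) q)
    (sym (trans (cong (ℕ._/ 2) n′≡h*2) (m*n/n≡m h 2))))))
  where
  module K = HeytingField F
  -- For odd n this is (n - 1)/2.
  h = n ℕ./ 2
  n′≡h*2 : n′ ≡ h ℕ.* 2
  n′≡h*2 = ℕ.suc-injective (trans (m≡m%n+[m/n]*n n 2) (cong (ℕ._+ h ℕ.* 2) n%2≡1))
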